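{- For any integers $s,t,k\ge 1$, $\mathrm{ex}(n,L_{s,t}(k))=O(n^{1+\frac{s}{sk+1}})$ as $n\to\infty$, where the implied constant may depend on $s,t,k$.
   Context: For a graph $H$, $\mathrm{ex}(n,H)$ is the maximum number of edges in an $n$-vertex graph containing no copy of $H$ as a subgraph. For a graph $F$ with a set of roots $R\subsetneq V(F)$, the (rooted) $t$-blowup of $F$ is the graph obtained by taking $t$ vertex-disjoint copies of $F$ and identifying the different copies of $v$ for each $v\in R$. $L_{s,1}(k)$ is the graph with vertices $u$, $v$, $w_{i,j}$ ($1\le i\le k$, $1\le j\le s$) and edges $uv$, $vw_{1,j}$ ($1\le j\le s$), $w_{i,j}w_{i+1,j}$ ($1\le i\le k-1$, $1\le j\le s$), with roots $u,w_{k,1},\dots,w_{k,s}$. $L_{s,t}(k)$ is the rooted $t$-blowup of $L_{s,1}(k)$. Equivalently, $L_{s,t}(k)$ is obtained from $K_{s,t}$ by replacing its edges by internally disjoint paths of length $k$ and then adding an extra vertex joined to all vertices of the part of size $t$. -}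

module Defs where

open import Data.Bool.Base using (Bool; true; false; if_then_else_)
open import Data.Fin.Base using (Fin; zero; suc; toℕ; combine; remQuot; finToFun; funToFin)
open import Data.Fin.Properties as Fin using (any?; all?; finToFun-funToFin; remQuot-combine)
open import Data.List.Base
  using (List; _∷_; map; filter; length; lookup; allFin; cartesianProduct;
         cartesianProductWith; concatMap)
open import Data.List.Extrema.Nat using (max; xs≤max; argmax-sel)
open import Data.List.Membership.Propositional using (_∈_; lose)
open import Data.List.Membership.Propositional.Properties
  using (∈-allFin; ∈-map⁺; ∈-map⁻; ∈-filter⁺; ∈-filter⁻; ∈-concatMap⁺; ∈-cartesianProductWith⁺)
open import Data.List.Properties using (filter-≐)
import Data.List.Relation.Unary.All as All
open import Data.List.Relation.Unary.Any as Any using (here; there)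
open import Data.List.Relation.Unary.Any.Properties using (lookup-index)
open import Data.List.Relation.Unary.Enumerates.Setoid using (IsEnumeration)
open import Data.Nat.Base as ℕ using (ℕ; _≤_; _*_; _^_)
open import Data.Nat.Properties as ℕ using (n≤0⇒n≡0)
open import Data.Product using (∃; ∃-syntax; Σ-syntax; _×_; _,_; proj₁; proj₂)
open import Data.Sum.Base using (_⊎_; inj₁; inj₂; swap)
open import Function.Base using (_∘_; id)
open import Function.Definitions using (Injective)
open import Relation.Binary.Construct.Closure.Symmetric as Sym using (SymClosure; fwd; bwd)
open import Relation.Binary.Definitions using (Symmetric; Decidable)
open import Relation.Binary.PropositionalEquality
  using (_≡_; _≢_; refl; sym; trans; cong; subst; subst₂; setoid)
open import Relation.Nullary using (Dec; yes; no; ¬_; contradiction)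
open import Relation.Nullary.Decidable using (map′; _×-dec_; _⊎-dec_; _→-dec_; ¬?)

------------------------------------------------------------------------
-- Finite simple graphs

record Finite (V : Set) : Set where
  field
    elements : List V
    complete : IsEnumeration (setoid V) elements

open Finite ⦃ ... ⦄ public

record Graph (V : Set) : Set₁ where
  infix 4 _~_ _~?_
  field
    _~_    : V → V → Set
    ~-sym  : Symmetric _~_
    irrefl : ∀ {x} → ¬ (x ~ x)
    _~?_   : Decidable _~_

-- Each edge is counted once, as a pair of adjacent vertices i < j.
edgeCount : ∀ {n} → Graph (Fin n) → ℕ
edgeCount {n} G =
  length (filter (λ (i , j) → (i Fin.<? j) ×-dec (i ~? j))
                 (cartesianProduct (allFin n) (allFin n)))
  where open Graph G

-- A copy of H in G as a (not necessarily induced) subgraph.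
record Copy {V W : Set} (H : Graph V) (G : Graph W) : Set where
  private
    module H = Graph H
    module G = Graph G
  field
    embed     : V → W
    injective : Injective _≡_ _≡_ embed
    preserves : ∀ {x y} → x H.~ y → embed x G.~ embed y

Free : {V W : Set} → Graph V → Graph W → Set
Free H G = ¬ Copy H G

------------------------------------------------------------------------
-- Deciding whether a graph on Fin n contains a copy of a finite graph

module _ {V : Set} ⦃ fin : Finite V ⦄ where

  private
    position : V → Fin (length (elements {V}))
    position x = Any.index (complete x)

    lookup-position : ∀ x → lookup elements (position x) ≡ x
    lookup-position x = sym (lookup-index (complete x))

    position-injective : ∀ {x y} → position x ≡ position y → x ≡ y
    position-injective {x} {y} eq =
      trans (sym (lookup-position x)) (trans (cong (lookup elements) eq) (lookup-position y))

    _≟_ : Decidable (_≡_ {A = V})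
    x ≟ y = map′ position-injective (cong position) (position x Fin.≟ position y)

    ∀? : {P : V → Set} → (∀ x → Dec (P x)) → Dec (∀ x → P x)
    ∀? {P} P? = map′ (λ p x → subst P (lookup-position x) (p (position x)))
                     (λ p i → p (lookup elements i))
                     (all? (P? ∘ lookup elements))

  copy? : ∀ {n} (H : Graph V) (G : Graph (Fin n)) → Dec (Copy H G)
  copy? {n} H G = map′ to from (any? (λ c → isCopy? (finToFun c ∘ position)))
    where
    module H = Graph H
    module G = Graph G

    IsCopy : (V → Fin n) → Set
    IsCopy f = ∀ x y → (f x ≡ f y → x ≡ y) × (x H.~ y → f x G.~ f y)

    isCopy? : ∀ f → Dec (IsCopy f)
    isCopy? f = ∀? λ x → ∀? λ y →
      ((f x Fin.≟ f y) →-dec (x ≟ y)) ×-dec ((x H.~? y) →-dec (f x G.~? f y))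

    to : (∃ λ c → IsCopy (finToFun c ∘ position)) → Copy H G
    to (c , p) = record
      { embed     = finToFun c ∘ position
      ; injective = λ {x} {y} → proj₁ (p x y)
      ; preserves = λ {x} {y} → proj₂ (p x y)
      }

    from : Copy H G → ∃ λ c → IsCopy (finToFun c ∘ position)
    from C = funToFin g , λ x y →
        (λ eq → injective (trans (sym (eq-g x)) (trans eq (eq-g y))))
      , (λ e → subst₂ G._~_ (sym (eq-g x)) (sym (eq-g y)) (preserves e))
      where
      open Copy C
      g : Fin (length (elements {V})) → Fin n
      g = embed ∘ lookup elements
      eq-g : ∀ x → finToFun (funToFin g) (position x) ≡ embed x
      eq-g x = trans (finToFun-funToFin g (position x)) (cong embed (lookup-position x))

------------------------------------------------------------------------
-- The extremal number

-- The code c is read as an n × n Boolean matrix, which is symmetrised and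
-- whose diagonal is ignored.
decode : ∀ n → Fin (2 ^ (n * n)) → Graph (Fin n)
decode n c = record
  { _~_    = λ i j → i ≢ j × (bit i j ⊎ bit j i)
  ; ~-sym  = λ (i≢j , b) → i≢j ∘ sym , swap b
  ; irrefl = λ (i≢i , _) → i≢i refl
  ; _~?_   = λ i j → ¬? (i Fin.≟ j) ×-dec (bit? i j ⊎-dec bit? j i)
  }
  where
  bit : Fin n → Fin n → Set
  bit i j = finToFun c (combine i j) ≡ suc zero
  bit? : Decidable bit
  bit? i j = finToFun c (combine i j) Fin.≟ suc zero

allGraphs : ∀ n → List (Graph (Fin n))
allGraphs n = map (decode n) (allFin (2 ^ (n * n)))

-- If there is no H-free graph on n vertices (possible only when H has no
-- edges) this is 0; otherwise ex-attained and ex-bound show that it is the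
-- maximum of edgeCount over all H-free graphs on n vertices.
ex : {V : Set} ⦃ _ : Finite V ⦄ → ℕ → Graph V → ℕ
ex n H = max 0 (map edgeCount (filter (λ G → ¬? (copy? H G)) (allGraphs n)))

module _ {n : ℕ} where

  private
    _≅_ : Graph (Fin n) → Graph (Fin n) → Set
    G ≅ G′ = (∀ {i j} → i G.~ j → i G′.~ j) × (∀ {i j} → i G′.~ j → i G.~ j)
      where
      module G  = Graph G
      module G′ = Graph G′

    edgeCount-cong : ∀ {G G′} → G ≅ G′ → edgeCount G ≡ edgeCount G′
    edgeCount-cong {G} {G′} (f , g) = cong length
      (filter-≐ (λ (i , j) → (i Fin.<? j) ×-dec (Graph._~?_ G i j))
                (λ (i , j) → (i Fin.<? j) ×-dec (Graph._~?_ G′ i j))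
                ((λ (i<j , e) → i<j , f e) , (λ (i<j , e) → i<j , g e))
                (cartesianProduct (allFin n) (allFin n)))

    Free-cong : ∀ {V} {H : Graph V} {G G′} → G ≅ G′ → Free H G → Free H G′
    Free-cong (_ , g) free C = free record
      { embed = C.embed ; injective = C.injective ; preserves = g ∘ C.preserves }
      where module C = Copy C

    allGraphs-complete : ∀ G → ∃ λ G′ → G′ ∈ allGraphs n × G ≅ G′
    allGraphs-complete G =
      decode n c , ∈-map⁺ (decode n) (∈-allFin c)
      , (λ e → (λ eq → irrefl (subst (_ ~_) (sym eq) e)) , inj₁ (bit⁺ e))
      , (λ { (_ , inj₁ b) → bit⁻ b ; (_ , inj₂ b) → ~-sym (bit⁻ b) })
      where
      open Graph G
      indicator : ∀ {P : Set} → Dec P → Fin 2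
      indicator (yes _) = suc zero
      indicator (no _)  = zero
      indicator⁺ : ∀ {P : Set} (d : Dec P) → P → indicator d ≡ suc zero
      indicator⁺ (yes _) _ = refl
      indicator⁺ (no ¬p) p = contradiction p ¬p
      indicator⁻ : ∀ {P : Set} (d : Dec P) → indicator d ≡ suc zero → P
      indicator⁻ (yes p) _ = p
      entry : Fin n × Fin n → Fin 2
      entry (i , j) = indicator (i ~? j)
      matrix : Fin (n * n) → Fin 2
      matrix x = entry (remQuot {n} n x)
      c : Fin (2 ^ (n * n))
      c = funToFin matrix
      c-entry : ∀ i j → finToFun c (combine i j) ≡ indicator (i ~? j)
      c-entry i j = trans (finToFun-funToFin matrix (combine i j))
                          (cong entry (remQuot-combine i j))
      bit⁺ : ∀ {i j} → i ~ j → finToFun c (combine i j) ≡ suc zero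
      bit⁺ {i} {j} e = trans (c-entry i j) (indicator⁺ (i ~? j) e)
      bit⁻ : ∀ {i j} → finToFun c (combine i j) ≡ suc zero → i ~ j
      bit⁻ {i} {j} b = indicator⁻ (i ~? j) (trans (sym (c-entry i j)) b)

  module _ {V : Set} ⦃ _ : Finite V ⦄ (H : Graph V) where

    private
      free? : (G : Graph (Fin n)) → Dec (Free H G)
      free? G = ¬? (copy? H G)

    ex-bound : ∀ G → Free H G → edgeCount G ≤ ex n H
    ex-bound G free with G′ , G′∈ , G≅G′ ← allGraphs-complete G =
      subst (_≤ ex n H) (sym (edgeCount-cong {G} {G′} G≅G′))
        (All.lookup (xs≤max 0 _)
          (∈-map⁺ edgeCount (∈-filter⁺ free? G′∈ (Free-cong {G = G} {G′} G≅G′ free))))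

    ex-attained : ∀ G → Free H G → ∃ λ G′ → Free H G′ × edgeCount {n} G′ ≡ ex n H
    ex-attained G free with argmax-sel id 0 (map edgeCount (filter free? (allGraphs n)))
    ... | inj₁ ex≡0 =
      G , free , trans (n≤0⇒n≡0 (subst (edgeCount G ≤_) ex≡0 (ex-bound G free))) (sym ex≡0)
    ... | inj₂ ex∈ with G′ , G′∈ , eq ← ∈-map⁻ edgeCount ex∈ =
      G′ , proj₂ (∈-filter⁻ free? {xs = allGraphs n} G′∈) , sym eq

------------------------------------------------------------------------
-- Rooted blowups

record RootedGraph (V : Set) : Set₁ where
  field
    graph  : Graph V
    isRoot : V → Bool
    proper : ∃[ x ] isRoot x ≡ false

module Blowup {V : Set} (F : RootedGraph V) (t : ℕ) where
  open RootedGraph F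
  open Graph graph

  -- A root has a single image in the blowup, any other vertex has t images.
  Images : Bool → Set
  Images root? = Fin (if root? then 1 else t)

  Vertex : Set
  Vertex = Σ[ x ∈ V ] Images (isRoot x)

  image : (root? : Bool) → Fin t → Images root?
  image true  _ = zero
  image false c = c

  -- The c-th copy of F, after the identification of roots.
  inCopy : Fin t → V → Vertex
  inCopy c x = x , image (isRoot x) c

  data Edge : Vertex → Vertex → Set where
    edge : ∀ c {x y} → x ~ y → Edge (inCopy c x) (inCopy c y)

  private
    project : ∀ {p q} → Edge p q → proj₁ p ~ proj₁ q
    project (edge _ e) = e

    edge? : Decidable Edge
    edge? p@(x , i) q@(y , j) = map′ to from
      ((x ~? y) ×-dec any? λ c → (image (isRoot x) c Fin.≟ i) ×-dec (image (isRoot y) c Fin.≟ j))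
      where
      to : x ~ y × (∃ λ c → image (isRoot x) c ≡ i × image (isRoot y) c ≡ j) → Edge p q
      to (e , c , eq , eq′) =
        subst₂ Edge (cong (x ,_) eq) (cong (y ,_) eq′) (edge c e)
      from : Edge p q → x ~ y × (∃ λ c → image (isRoot x) c ≡ i × image (isRoot y) c ≡ j)
      from (edge c e) = e , c , refl , refl

  blowup : Graph Vertex
  blowup = record
    { _~_    = Edge
    ; ~-sym  = λ { (edge c e) → edge c (~-sym e) }
    ; irrefl = λ e → irrefl (project e)
    ; _~?_   = edge?
    }

  finite-blowup : ⦃ Finite V ⦄ → Finite Vertex
  finite-blowup = record
    { elements = concatMap fibre elements
    ; complete = λ (x , i) →
        ∈-concatMap⁺ fibre (lose (complete x) (∈-map⁺ (x ,_) (∈-allFin i)))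
    }
    where
    fibre : V → List Vertex
    fibre x = map (x ,_) (allFin _)

------------------------------------------------------------------------
-- L_{s,1}(k) and L_{s,t}(k)

-- The indices i and j of w i j are 0-based, so w_{1,j} and w_{k,j} are the
-- vertices with toℕ i ≡ 0 and suc (toℕ i) ≡ k respectively.
data L₁Vertex (s k : ℕ) : Set where
  u v : L₁Vertex s k
  w   : Fin k → Fin s → L₁Vertex s k

data L₁Edge {s k : ℕ} : L₁Vertex s k → L₁Vertex s k → Set where
  uv : L₁Edge u v
  vw : ∀ {i j} → toℕ i ≡ 0 → L₁Edge v (w i j)
  ww : ∀ {i i′ j} → toℕ i′ ≡ ℕ.suc (toℕ i) → L₁Edge (w i j) (w i′ j)

instance
  finite-L₁ : ∀ {s k} → Finite (L₁Vertex s k)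
  finite-L₁ {s} {k} = record
    { elements = u ∷ v ∷ cartesianProductWith w (allFin k) (allFin s)
    ; complete = λ
        { u       → here refl
        ; v       → there (here refl)
        ; (w i j) → there (there (∈-cartesianProductWith⁺ w (∈-allFin i) (∈-allFin j)))
        }
    }

private
  L₁Edge? : ∀ {s k} → Decidable (L₁Edge {s} {k})
  L₁Edge? u u = no λ ()
  L₁Edge? u v = yes uv
  L₁Edge? u (w _ _) = no λ ()
  L₁Edge? v u = no λ ()
  L₁Edge? v v = no λ ()
  L₁Edge? v (w i _) = map′ vw (λ { (vw p) → p }) (toℕ i ℕ.≟ 0)
  L₁Edge? (w _ _) u = no λ ()
  L₁Edge? (w _ _) v = no λ ()
  L₁Edge? (w i j) (w i′ j′) =
    map′ (λ { (p , refl) → ww p }) (λ { (ww p) → p , refl })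
         ((toℕ i′ ℕ.≟ ℕ.suc (toℕ i)) ×-dec (j Fin.≟ j′))

  L₁-loopless : ∀ {s k} {x : L₁Vertex s k} → ¬ L₁Edge x x
  L₁-loopless (ww p) = ℕ.1+n≢n (sym p)

L₁ : (s k : ℕ) → RootedGraph (L₁Vertex s k)
L₁ s k = record
  { graph = record
    { _~_    = SymClosure L₁Edge
    ; ~-sym  = Sym.symmetric L₁Edge
    ; irrefl = λ { (fwd e) → L₁-loopless e ; (bwd e) → L₁-loopless e }
    ; _~?_   = λ x y → map′ (λ { (inj₁ e) → fwd e ; (inj₂ e) → bwd e })
                            (λ { (fwd e) → inj₁ e ; (bwd e) → inj₂ e })
                            (L₁Edge? x y ⊎-dec L₁Edge? y x)
    }
  ; isRoot = λ { u → true ; v → false ; (w i _) → ℕ.suc (toℕ i) ℕ.≡ᵇ k }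
  ; proper = v , refl
  }

module _ (s t k : ℕ) where
  open Blowup (L₁ s k) t

  LVertex : Set
  LVertex = Vertex

  L : Graph LVertex
  L = blowup

instance
  finite-L : ∀ {s t k} → Finite (LVertex s t k)
  finite-L {s} {t} {k} = Blowup.finite-blowup (L₁ s k) t

------------------------------------------------------------------------
-- Asymptotics

-- f(n) = O(n^(p/q)) as n → ∞, for q ≥ 1: the inequality f(n) ≤ C n^(p/q) is
-- raised to the q-th power.  Natural constants C suffice.
_=O[n^_/_] : (ℕ → ℕ) → ℕ → ℕ → Set
f =O[n^ p / q ] = ∃[ C ] ∃[ N ] ∀ n → N ≤ n → f n ^ q ≤ C ^ q * n ^ p

{-# OPTIONS --safe #-}

-- Let α = s / (sk + 1).  A graph with n vertices and at least C n^(1 + α) edges has a subgraph with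
-- m vertices, for some m, all of whose degrees lie between D ≥ C′ m^α and K D, where K is a constant.
--
-- In such a subgraph call a pair of vertices rich at length ℓ if no set of bounded size meets the
-- interiors of all paths of length ℓ between them.  A walk is good if no pair of its vertices is rich (or
-- equal) at the length of the walk between them.  Between two given vertices there are boundedly many
-- good paths: as the pair is not rich, all of them meet a bounded set, and one splits there.
--
-- If for some vertex u many walks u … y of length ℓ - 1 end at a vertex y forming rich pairs of length
-- ℓ with a positive fraction of the neighbours of u, then many neighbours v of u have a large set W of
-- common rich partners.  Every vertex of W has many neighbours among the at most (K D)^(ℓ - 1) ends of
-- walks of length ℓ - 1 from one of these v, so the bipartite graph between W and these ends has a
-- subgraph of large minimum degree.  A leg from v to a root consists of a rich path from v to W
-- followed by k - ℓ steps in this subgraph, and greedily chosen legs form a copy of L_{s,t}(k).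
--
-- Otherwise most walks of length k + 1 are good.  Counting the n D^(sk + 1) extensions of walks u, v by
-- s disjoint good legs gives roots u, w₁, …, w_s with many centres v.  Boundedly many of the centres
-- have legs meeting a given bounded set, so t disjoint fans between these roots can be found.

module Submission where

open import Defs
open import Data.Nat.Base using (ℕ; _≤_; _+_; _*_)
open import Data.Bool.Base as Bool using (false; true)
open import Data.Empty using (⊥; ⊥-elim)
open import Data.Fin.Base using (Fin; cast; fromℕ<; suc; toℕ; zero)
open import Data.Fin.Properties as Fin
  using (toℕ-cast; toℕ-fromℕ<; toℕ-injective; toℕ<n; toℕ≤pred[n])
open import Data.List.Base
  using (List; []; _++_; _∷_; _∷ʳ_; _∷ʳ′_; allFin; cartesianProduct; cartesianProductWith;
    concatMap; drop; filter; initLast; length; lookup; map; replicate; tabulate; take)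
open import Data.List.Extrema.Nat using (argmax-sel)
open import Data.List.Membership.Propositional using (_∈_; _∉_; find; lose)
open import Data.List.Membership.Propositional.Properties
  using (∈-++⁺ʳ; ∈-++⁺ˡ; ∈-++⁻; ∈-allFin; ∈-cartesianProductWith⁺; ∈-concatMap⁺; ∈-concatMap⁻;
    ∈-filter⁺; ∈-filter⁻; ∈-lookup; ∈-map⁺; ∈-map⁻; ∈-tabulate⁺; ∈-∃++)
open import Data.List.Properties
  using (++-assoc; filter-notAll; length-++; length-drop; length-filter; length-map;
    length-replicate; length-tabulate; length-take; map-++; map-tabulate; map-∘; tabulate-lookup;
    take++drop≡id; ≡-dec)
open import Data.List.Relation.Binary.Disjoint.Propositional using (Disjoint)
open import Data.List.Relation.Unary.All as All using (All; []; _∷_)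
open import Data.List.Relation.Unary.AllPairs as AllPairs using ([]; _∷_)
open import Data.List.Relation.Unary.Any as Any using (any?; here; there)
open import Data.List.Relation.Unary.Linked as Linked using (Linked; [-]; []; _∷_; linked?)
import Data.List.Relation.Unary.Unique.DecPropositional as DecUnique
open import Data.List.Relation.Unary.Unique.Propositional using (Unique)
import Data.List.Relation.Unary.Unique.Propositional.Properties as Unique
open import Data.Nat.Base using (>-nonZero; NonZero; _<_; _^_; _∸_; suc; s≤s; zero; z≤n)
open import Data.Nat.DivMod using (_%_; _/_; m%n<n; m/n*n≤m; m≡m%n+[m/n]*n)
open import Data.Nat.ListAction using (sum)
open import Data.Nat.ListAction.Properties using (sum-++)
open import Data.Nat.Properties
open import Data.Nat.Tactic.RingSolver using (solve-∀)
open import Data.Product using (_,_; _×_; proj₁; proj₂; Σ-syntax; ∃; ∃-syntax)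
open import Data.Sum.Base using ([_,_]′; _⊎_; inj₁; inj₂)
open import Data.Unit.Base using (tt; ⊤)
open import Data.Vec.Base using (Vec; []; _∷_) renaming (lookup to lookupⱽ)
open import Function.Base using (_∘_; id)
open import Relation.Binary.Construct.Closure.Symmetric using (bwd; fwd)
open import Relation.Binary.Definitions using (DecidableEquality)
open import Relation.Binary.PropositionalEquality
  using (_≡_; _≢_; cong; cong₂; refl; subst; subst₂; sym; trans; module ≡-Reasoning)
open import Relation.Nullary using (Dec; contradiction; no; yes; ¬_)
open import Relation.Nullary.Decidable using (_×-dec_; _⊎-dec_; ¬?)
open import Relation.Unary using (Decidable; Pred)

-- Finite sums

-- The obstacle is disjointness. Counting alone yields roots u, w₁, ..., w_s with many centres v,
-- but all legs might run through a few common vertices. Goodness excludes this: if a leg of v meets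
-- a vertex a, then v is the second vertex of a good walk from u to a, and there are boundedly many
-- of these. So the extra root u serves twice: it anchors these walks, and in the rich case every
-- hub v is adjacent to it by construction. The exponent comes from comparing the extensions with
-- the n^(1 + s) choices of roots: D^(sk + 1) has to exceed a constant times n^s. Fractional powers
-- are avoided by raising such inequalities to the power q = sk + 1. The degree ratio K has to be
-- fixed before the density C. Bad walks are bounded above by powers of the maximum degree K D and
-- all walks below by powers of D, so K enters every later constant, and C is chosen last. In `Fan`
-- and whatever is built on it, `k` counts the vertices of a leg strictly between v and its root,
-- one less than the k of the theorem.

module _ {a} {A : Set a} where

  ∑ : List A → (A → ℕ) → ℕ
  ∑ xs f = sum (map f xs)

  ∑-mono-∈ : ∀ xs {f g : A → ℕ} → (∀ {x} → x ∈ xs → f x ≤ g x) → ∑ xs f ≤ ∑ xs g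
  ∑-mono-∈ []       _   = z≤n
  ∑-mono-∈ (x ∷ xs) f≤g = +-mono-≤ (f≤g (here refl)) (∑-mono-∈ xs (f≤g ∘ there))

  ∑-mono : ∀ xs {f g : A → ℕ} → (∀ x → f x ≤ g x) → ∑ xs f ≤ ∑ xs g
  ∑-mono xs f≤g = ∑-mono-∈ xs (λ {x} _ → f≤g x)

  ∑-cong : ∀ xs {f g : A → ℕ} → (∀ x → f x ≡ g x) → ∑ xs f ≡ ∑ xs g
  ∑-cong []       _   = refl
  ∑-cong (x ∷ xs) f≡g = cong₂ _+_ (f≡g x) (∑-cong xs f≡g)

  ∑-+ : ∀ xs (f g : A → ℕ) → ∑ xs (λ x → f x + g x) ≡ ∑ xs f + ∑ xs g
  ∑-+ []       f g = refl
  ∑-+ (x ∷ xs) f g =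
    trans (cong (f x + g x +_) (∑-+ xs f g)) (swap₄ (f x) (g x) (∑ xs f) (∑ xs g))
    where
    swap₄ : ∀ a b c d → a + b + (c + d) ≡ a + c + (b + d)
    swap₄ = solve-∀

  ∑-*ˡ : ∀ c xs (f : A → ℕ) → ∑ xs (λ x → c * f x) ≡ c * ∑ xs f
  ∑-*ˡ c []       f = sym (*-zeroʳ c)
  ∑-*ˡ c (x ∷ xs) f =
    trans (cong (c * f x +_) (∑-*ˡ c xs f)) (sym (*-distribˡ-+ c (f x) (∑ xs f)))

  ∑-*ʳ : ∀ c xs (f : A → ℕ) → ∑ xs (λ x → f x * c) ≡ ∑ xs f * c
  ∑-*ʳ c xs f =
    trans (∑-cong xs (λ x → *-comm (f x) c)) (trans (∑-*ˡ c xs f) (*-comm c _))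

  ∑-const : ∀ xs c → ∑ xs (λ _ → c) ≡ length xs * c
  ∑-const []       c = refl
  ∑-const (_ ∷ xs) c = cong (c +_) (∑-const xs c)

  ∑-≤ : ∀ xs {f : A → ℕ} c → (∀ {x} → x ∈ xs → f x ≤ c) → ∑ xs f ≤ length xs * c
  ∑-≤ xs c f≤c = ≤-trans (∑-mono-∈ xs f≤c) (≤-reflexive (∑-const xs c))

  ∑-≥ : ∀ xs {f : A → ℕ} c → (∀ {x} → x ∈ xs → c ≤ f x) → length xs * c ≤ ∑ xs f
  ∑-≥ xs c c≤f = ≤-trans (≤-reflexive (sym (∑-const xs c))) (∑-mono-∈ xs c≤f)

  ∑-++ : ∀ xs ys (f : A → ℕ) → ∑ (xs ++ ys) f ≡ ∑ xs f + ∑ ys f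
  ∑-++ xs ys f = trans (cong sum (map-++ f xs ys)) (sum-++ (map f xs) (map f ys))

  ∑-∈ : ∀ {xs x} (f : A → ℕ) → x ∈ xs → f x ≤ ∑ xs f
  ∑-∈ f (here refl) = m≤m+n _ _
  ∑-∈ f (there x∈)  = ≤-trans (∑-∈ f x∈) (m≤n+m _ _)

  pigeonhole-∑ : ∀ xs {f : A → ℕ} c → length xs * c < ∑ xs f → ∃[ x ] x ∈ xs × c < f x
  pigeonhole-∑ (x ∷ xs) {f} c lt with suc c ≤? f x
  ... | yes c<fx = x , here refl , c<fx
  ... | no  c≮fx =
    let y , y∈ , c<fy = pigeonhole-∑ xs c
          (+-cancelˡ-< c _ _ (≤-trans lt (+-monoˡ-≤ (∑ xs f) (≮⇒≥ c≮fx))))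
    in y , there y∈ , c<fy

module _ {a b} {A : Set a} {B : Set b} where

  ∑-map : ∀ (g : A → B) xs (f : B → ℕ) → ∑ (map g xs) f ≡ ∑ xs (f ∘ g)
  ∑-map g xs f = cong sum (sym (map-∘ xs))

  ∑-concatMap : ∀ (g : A → List B) xs (f : B → ℕ) →
                ∑ (concatMap g xs) f ≡ ∑ xs (λ x → ∑ (g x) f)
  ∑-concatMap g []       f = refl
  ∑-concatMap g (x ∷ xs) f =
    trans (∑-++ (g x) (concatMap g xs) f) (cong (∑ (g x) f +_) (∑-concatMap g xs f))

  length-concatMap-≤ : ∀ (g : A → List B) xs c → (∀ x → length (g x) ≤ c) →
                       length (concatMap g xs) ≤ length xs * c
  length-concatMap-≤ g xs c g≤c = begin
    length (concatMap g xs)                 ≡⟨ *-identityʳ _ ⟨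
    length (concatMap g xs) * 1             ≡⟨ ∑-const (concatMap g xs) 1 ⟨
    ∑ (concatMap g xs) (λ _ → 1)            ≡⟨ ∑-concatMap g xs _ ⟩
    ∑ xs (λ x → ∑ (g x) (λ _ → 1))          ≡⟨ ∑-cong xs (λ x → trans (∑-const (g x) 1) (*-identityʳ _)) ⟩
    ∑ xs (length ∘ g)                       ≤⟨ ∑-≤ xs c (λ {x} _ → g≤c x) ⟩
    length xs * c                           ∎
    where open ≤-Reasoning

  ∑-swap : ∀ xs ys (f : A → B → ℕ) →
           ∑ xs (λ x → ∑ ys (f x)) ≡ ∑ ys (λ y → ∑ xs (λ x → f x y))
  ∑-swap []       ys f = sym (trans (∑-const ys 0) (*-zeroʳ (length ys)))
  ∑-swap (x ∷ xs) ys f =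
    trans (cong (∑ ys (f x) +_) (∑-swap xs ys f)) (sym (∑-+ ys (f x) _))

-- Indicator functions and counting

χ : ∀ {p} {P : Set p} → Dec P → ℕ
χ (yes _) = 1
χ (no  _) = 0

module _ {p} {P : Set p} where

  χ≤1 : (P? : Dec P) → χ P? ≤ 1
  χ≤1 (yes _) = ≤-refl
  χ≤1 (no  _) = z≤n

  χ-yes : (P? : Dec P) → P → χ P? ≡ 1
  χ-yes (yes _) _ = refl
  χ-yes (no ¬p) p = contradiction p ¬p

  χ-no : (P? : Dec P) → ¬ P → χ P? ≡ 0
  χ-no (yes p) ¬p = contradiction p ¬p
  χ-no (no _)  _  = refl

  χ-≤ : (P? : Dec P) {m : ℕ} → (P → 1 ≤ m) → χ P? ≤ m
  χ-≤ (yes p) h = h p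
  χ-≤ (no _)  _ = z≤n

  χ*-≤ : (P? : Dec P) {m n : ℕ} → (P → m ≤ n) → χ P? * m ≤ n
  χ*-≤ (yes p) h = ≤-trans (≤-reflexive (+-identityʳ _)) (h p)
  χ*-≤ (no _)  _ = z≤n

  χ-¬ : (P? : Dec P) → χ P? + χ (¬? P?) ≡ 1
  χ-¬ (yes _) = refl
  χ-¬ (no _)  = refl

  χ-pos : (P? : Dec P) → 1 ≤ χ P? → P
  χ-pos (yes p) _ = p

χ-mono : ∀ {p q} {P : Set p} {Q : Set q} (P? : Dec P) (Q? : Dec Q) → (P → Q) → χ P? ≤ χ Q?
χ-mono P? Q? f = χ-≤ P? (λ p → ≤-reflexive (sym (χ-yes Q? (f p))))

module _ {a p} {A : Set a} {P : Pred A p} (P? : Decidable P) where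

  ∑-filter : ∀ xs (f : A → ℕ) → ∑ (filter P? xs) f ≡ ∑ xs (λ x → χ (P? x) * f x)
  ∑-filter []       f = refl
  ∑-filter (x ∷ xs) f with P? x
  ... | yes _ = cong₂ _+_ (sym (+-identityʳ (f x))) (∑-filter xs f)
  ... | no  _ = ∑-filter xs f

  length-filter-∑ : ∀ xs → length (filter P? xs) ≡ ∑ xs (χ ∘ P?)
  length-filter-∑ []       = refl
  length-filter-∑ (x ∷ xs) with P? x
  ... | yes _ = cong suc (length-filter-∑ xs)
  ... | no  _ = length-filter-∑ xs

  ∑-partition : ∀ xs (f : A → ℕ) → ∑ xs f ≡ ∑ (filter P? xs) f + ∑ (filter (¬? ∘ P?) xs) f
  ∑-partition []       f = refl
  ∑-partition (x ∷ xs) f with P? x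
  ... | yes _ = trans (cong (f x +_) (∑-partition xs f)) (sym (+-assoc (f x) _ _))
  ... | no  _ = trans (cong (f x +_) (∑-partition xs f))
                      (shuffle (f x) (∑ (filter P? xs) f) (∑ (filter (¬? ∘ P?) xs) f))
    where
    shuffle : ∀ a b c → a + (b + c) ≡ b + (a + c)
    shuffle = solve-∀

module _ {a} {A : Set a} (_≟_ : DecidableEquality A) where

  ∑-χ≡ : ∀ {xs} → Unique xs → ∀ z → ∑ xs (λ x → χ (x ≟ z)) ≤ 1
  ∑-χ≡ []                      z = z≤n
  ∑-χ≡ {x ∷ xs} (x∉ ∷ unique) z with x ≟ z
  ... | no  _    = ∑-χ≡ unique z
  ... | yes refl = s≤s (≤-trans (∑-mono-∈ xs {g = λ _ → 0} (λ {y} y∈ →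
      ≤-reflexive (χ-no (y ≟ z) (λ { refl → All.lookup x∉ y∈ refl }))))
    (≤-reflexive (trans (∑-const xs 0) (*-zeroʳ (length xs)))))

  _∈?_ : ∀ x xs → Dec (x ∈ xs)
  x ∈? xs = any? (x ≟_) xs

  -- The multiplicity bound stands in for `Unique` because lists of walks get it from `walks-once`,
  -- by recursion on the first step.
  ∑-χ∈′ : ∀ {xs} → (∀ z → ∑ xs (λ x → χ (x ≟ z)) ≤ 1) → ∀ zs → ∑ xs (λ x → χ (x ∈? zs)) ≤ length zs
  ∑-χ∈′ {xs} once zs = begin
    ∑ xs (λ x → χ (x ∈? zs))                ≤⟨ ∑-mono xs (λ x → χ-≤ (x ∈? zs) (λ x∈ →
      ≤-trans (≤-reflexive (sym (χ-yes (x ≟ x) refl))) (∑-∈ (λ z → χ (x ≟ z)) x∈))) ⟩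
    ∑ xs (λ x → ∑ zs (λ z → χ (x ≟ z)))     ≡⟨ ∑-swap xs zs _ ⟩
    ∑ zs (λ z → ∑ xs (λ x → χ (x ≟ z)))     ≤⟨ ∑-≤ zs 1 (λ {z} _ → once z) ⟩
    length zs * 1                           ≡⟨ *-identityʳ _ ⟩
    length zs                               ∎
    where open ≤-Reasoning

  ∑-χ∈ : ∀ {xs} → Unique xs → ∀ zs → ∑ xs (λ x → χ (x ∈? zs)) ≤ length zs
  ∑-χ∈ {xs} unique = ∑-χ∈′ {xs} (∑-χ≡ unique)

  fresh : ∀ {xs} → Unique xs → ∀ zs → length zs < length xs → ∃[ x ] x ∈ xs × x ∉ zs
  fresh {xs} unique zs lt with pigeonhole-∑ xs {λ x → χ (¬? (x ∈? zs))} 0 positive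
    where
    open ≤-Reasoning
    positive : length xs * 0 < ∑ xs (λ x → χ (¬? (x ∈? zs)))
    positive = subst (_< ∑ xs (λ x → χ (¬? (x ∈? zs)))) (sym (*-zeroʳ (length xs))) (+-cancelˡ-< (length zs) _ _ (begin-strict
      length zs + 0                                                       ≡⟨ +-identityʳ _ ⟩
      length zs                                                           <⟨ lt ⟩
      length xs                                                           ≡⟨ *-identityʳ _ ⟨
      length xs * 1                                                       ≡⟨ ∑-const xs 1 ⟨
      ∑ xs (λ _ → 1)                                                      ≡⟨ ∑-cong xs (λ x → χ-¬ (x ∈? zs)) ⟨
      ∑ xs (λ x → χ (x ∈? zs) + χ (¬? (x ∈? zs)))                         ≡⟨ ∑-+ xs _ _ ⟩
      ∑ xs (λ x → χ (x ∈? zs)) + ∑ xs (λ x → χ (¬? (x ∈? zs)))            ≤⟨ +-monoˡ-≤ _ (∑-χ∈ unique zs) ⟩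
      length zs + ∑ xs (λ x → χ (¬? (x ∈? zs)))                           ∎))
  ... | x , x∈ , pos = x , x∈ , χ-pos (¬? (x ∈? zs)) pos

-- Copies of blowups

module _ {V W : Set} ⦃ fin : Finite V ⦄ (F : RootedGraph V) (G : Graph W) (t : ℕ) where
  open RootedGraph F
  open Blowup F t
  private module G = Graph G

  -- Only non-roots must avoid `Used`: all copies share their roots, so `Used` may contain the
  -- complete image of an earlier copy.
  CopyAvoiding : (V → W) → List W → Set
  CopyAvoiding ρ Used = Σ[ C ∈ Copy graph G ]
    (∀ x → isRoot x ≡ true → Copy.embed C x ≡ ρ x) ×
    (∀ x → isRoot x ≡ false → Copy.embed C x ∉ Used)

  module _ (ρ : V → W)
           (spread : ∀ Used → length Used ≤ t * length (elements {V}) → CopyAvoiding ρ Used) where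

    private
      images : ∀ {Used} → CopyAvoiding ρ Used → List W
      images (C , _) = map (Copy.embed C) elements

      FreshFamily : ℕ → List W → Set
      FreshFamily m Used = Σ[ φ ∈ (Fin m → CopyAvoiding ρ []) ]
        (∀ c x → isRoot x ≡ false → Copy.embed (proj₁ (φ c)) x ∉ Used) ×
        (∀ {c c′ x y} → isRoot x ≡ false → c ≢ c′ →
          Copy.embed (proj₁ (φ c)) x ≢ Copy.embed (proj₁ (φ c′)) y)

      weaken : ∀ {Used} → CopyAvoiding ρ Used → CopyAvoiding ρ []
      weaken (C , roots , _) = C , roots , λ _ _ ()

      family : ∀ m Used → length Used + m * length (elements {V}) ≤ t * length (elements {V}) →
               FreshFamily m Used
      family zero    Used _ = (λ ()) , (λ ()) , λ { {()} }
      family (suc m) Used le = φ , avoids , distinct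
        where
        first = spread Used (≤-trans (m≤m+n _ _) le)
        C₀ = proj₁ first
        Used′ = images first ++ Used
        le′ : length Used′ + m * length (elements {V}) ≤ t * length (elements {V})
        le′ = ≤-trans (≤-reflexive (trans
          (cong (_+ m * length (elements {V}))
            (trans (length-++ (images first))
              (cong (_+ length Used) (length-map (Copy.embed C₀) elements))))
          (trans (cong (_+ m * length (elements {V})) (+-comm (length (elements {V})) (length Used)))
                 (+-assoc (length Used) _ _)))) le
        rest = family m Used′ le′
        ψ = proj₁ rest
        ψ-avoids = proj₁ (proj₂ rest)
        φ : Fin (suc m) → CopyAvoiding ρ []
        φ zero    = weaken first
        φ (suc c) = ψ c
        avoids : ∀ c x → isRoot x ≡ false → Copy.embed (proj₁ (φ c)) x ∉ Used
        avoids zero    x r = proj₂ (proj₂ first) x r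
        avoids (suc c) x r = ψ-avoids c x r ∘ ∈-++⁺ʳ (images first)
        ψ≢C₀ : ∀ c {x y} → isRoot x ≡ false → Copy.embed (proj₁ (ψ c)) x ≢ Copy.embed C₀ y
        ψ≢C₀ c {x} {y} r eq = ψ-avoids c x r
          (∈-++⁺ˡ (subst (_∈ images first) (sym eq) (∈-map⁺ (Copy.embed C₀) (Finite.complete fin y))))
        distinct : ∀ {c c′ x y} → isRoot x ≡ false → c ≢ c′ →
          Copy.embed (proj₁ (φ c)) x ≢ Copy.embed (proj₁ (φ c′)) y
        distinct {zero}  {zero}   r c≢c′ = contradiction refl c≢c′
        distinct {suc c} {zero}   r _    = ψ≢C₀ c r
        distinct {suc c} {suc c′} r c≢c′ = proj₂ (proj₂ rest) r (c≢c′ ∘ cong suc)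
        -- If `y` is a root, both copies send it to `ρ y`, so injectivity of `C₀` already separates
        -- it from the non-root `x`.
        distinct {zero}  {suc c′} {x} {y} r _ eq with isRoot y in ry
        ... | false = ψ≢C₀ c′ {y} {x} ry (sym eq)
        ... | true  = proj₂ (proj₂ first) x r (contradiction (Copy.injective C₀ eq₀) x≢y)
          where
          eq₀ : Copy.embed C₀ x ≡ Copy.embed C₀ y
          eq₀ = trans eq (trans (proj₁ (proj₂ (ψ c′)) y ry) (sym (proj₁ (proj₂ first) y ry)))
          x≢y : x ≢ y
          x≢y refl with () ← trans (sym r) ry

    -- Since distinct copies share only roots, t of them can be chosen greedily.
    blowup-copy : Copy blowup G
    blowup-copy = record
      { embed     = embed
      ; injective = λ {p} {q} → injective p q
      ; preserves = λ { (edge c {x} {y} e) →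
          subst₂ G._~_ (sym (embed-inCopy c x)) (sym (embed-inCopy c y)) (Copy.preserves (C c) e) }
      }
      where
      all = family t [] ≤-refl
      C : Fin t → Copy graph G
      C c = proj₁ (proj₁ all c)
      roots : ∀ c x → isRoot x ≡ true → Copy.embed (C c) x ≡ ρ x
      roots c = proj₁ (proj₂ (proj₁ all c))
      on : ∀ x r → isRoot x ≡ r → Images r → W
      on x true  _ _ = ρ x
      on x false _ c = Copy.embed (C c) x
      embed : Vertex → W
      embed (x , i) = on x (isRoot x) refl i
      embed-inCopy : ∀ c x → embed (inCopy c x) ≡ Copy.embed (C c) x
      embed-inCopy c x = helper (isRoot x) refl
        where
        helper : ∀ r (eq : isRoot x ≡ r) → on x r eq (image r c) ≡ Copy.embed (C c) x
        helper true  eq = sym (roots c x eq)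
        helper false _  = refl
      embed-root : ∀ x i → isRoot x ≡ true → embed (x , i) ≡ ρ x
      embed-root x = helper (isRoot x) refl
        where
        helper : ∀ r (eq : isRoot x ≡ r) i → r ≡ true → on x r eq i ≡ ρ x
        helper true _ _ _ = refl
      images-root : ∀ r → r ≡ true → (i j : Images r) → i ≡ j
      images-root true _ zero zero = refl
      images-copy : ∀ r → r ≡ false → (i : Images r) → ∃[ c ] image r c ≡ i
      images-copy false _ c = c , refl
      root? : ∀ x → isRoot x ≡ true ⊎ isRoot x ≡ false
      root? x with isRoot x
      ... | true  = inj₁ refl
      ... | false = inj₂ refl
      roots≢copies : ∀ {x y} c → isRoot x ≡ true → isRoot y ≡ false → ρ x ≢ Copy.embed (C c) y
      roots≢copies {x} {y} c rx ry eq with refl ← Copy.injective (C c) (trans (roots c x rx) eq)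
        with () ← trans (sym rx) ry
      injective : ∀ p q → embed p ≡ embed q → p ≡ q
      injective (x , i) (y , j) eq with root? x | root? y
      ... | inj₁ rx | inj₁ ry
        -- Injectivity of `ρ` on roots is read off from any single copy. Taking it from `spread`
        -- rather than from the family also covers t = 0.
        with C₀ , roots₀ , _ ← spread [] z≤n
        with refl ← Copy.injective C₀ {x} {y} (trans (roots₀ x rx) (trans
          (trans (sym (embed-root x i rx)) (trans eq (embed-root y j ry))) (sym (roots₀ y ry))))
        = cong (x ,_) (images-root (isRoot x) rx i j)
      ... | inj₁ rx | inj₂ ry with c , refl ← images-copy (isRoot y) ry j =
        contradiction (trans (sym (embed-root x i rx)) (trans eq (embed-inCopy c y)))
                      (roots≢copies c rx ry)
      ... | inj₂ rx | inj₁ ry with c , refl ← images-copy (isRoot x) rx i =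
        contradiction (trans (sym (embed-root y j ry)) (trans (sym eq) (embed-inCopy c x)))
                      (roots≢copies c ry rx)
      ... | inj₂ rx | inj₂ ry
        with c , refl ← images-copy (isRoot x) rx i | c′ , refl ← images-copy (isRoot y) ry j
        with eq′ ← trans (sym (embed-inCopy c x)) (trans eq (embed-inCopy c′ y))
        with c Fin.≟ c′
      ... | no  c≢c′ = contradiction eq′ (proj₂ (proj₂ all) rx c≢c′)
      ... | yes refl with refl ← Copy.injective (C c) eq′ = refl

-- Fans as copies of L_{s,1}(k + 1)

module _ {A : Set} where

  lookup-unique : ∀ {xs : List A} → Unique xs → ∀ i j → lookup xs i ≡ lookup xs j → i ≡ j
  lookup-unique (_  ∷ _) zero    zero    _  = refl
  lookup-unique (x∉ ∷ _) zero    (suc j) eq = contradiction eq (All.lookup x∉ (∈-lookup j))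
  lookup-unique (x∉ ∷ _) (suc i) zero    eq = contradiction (sym eq) (All.lookup x∉ (∈-lookup i))
  lookup-unique (_  ∷ xs!) (suc i) (suc j) eq = cong suc (lookup-unique xs! i j eq)

  lookup-linked : ∀ {R : A → A → Set} {xs} → Linked R xs →
                  ∀ i j → toℕ j ≡ suc (toℕ i) → R (lookup xs i) (lookup xs j)
  lookup-linked (r ∷ _)  zero    (suc zero) _  = r
  lookup-linked (_ ∷ rs) (suc i) (suc j)    eq = lookup-linked rs i j (suc-injective eq)
  lookup-linked [-] zero (suc ()) _

  lookup-∷ʳ-last : ∀ xs {x : A} i → toℕ i ≡ length xs → lookup (xs ∷ʳ x) i ≡ x
  lookup-∷ʳ-last []       zero    _  = refl
  lookup-∷ʳ-last (_ ∷ xs) (suc i) eq = lookup-∷ʳ-last xs i (suc-injective eq)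

  lookup-∷ʳ-init : ∀ xs {x : A} i → toℕ i ≢ length xs → lookup (xs ∷ʳ x) i ∈ xs
  lookup-∷ʳ-init []       zero    ne = contradiction refl ne
  lookup-∷ʳ-init (_ ∷ xs) zero    _  = here refl
  lookup-∷ʳ-init (_ ∷ xs) (suc i) ne = there (lookup-∷ʳ-init xs i (ne ∘ cong suc))

-- The legs of a copy of L_{s,1}(k + 1): the vertex w_{k+1,j} is ws j, and qs j lists w_{1,j}, …, w_{k,j}.
record Fan {W : Set} (G : Graph W) (s k : ℕ) (u₀ v₀ : W) (ws : Fin s → W) (Used : List W) : Set where
  open Graph G
  field
    qs         : Fin s → List W
    length-qs  : ∀ j → length (qs j) ≡ k
    root-edge  : u₀ ~ v₀
    linked     : ∀ j → Linked _~_ (v₀ ∷ qs j ∷ʳ ws j)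
    u∉         : ∀ j → u₀ ∉ qs j ∷ʳ ws j
    v∉         : ∀ j → v₀ ∉ qs j ∷ʳ ws j
    unique     : ∀ j → Unique (qs j ∷ʳ ws j)
    disjoint   : ∀ {j j′} → j ≢ j′ → Disjoint (qs j ∷ʳ ws j) (qs j′ ∷ʳ ws j′)
    v∉Used     : v₀ ∉ Used
    qs∉Used    : ∀ j → Disjoint (qs j) Used

module _ {W : Set} (G : Graph W) {s k : ℕ} (u₀ : W) (ws : Fin s → W) where
  private module G = Graph G
  open RootedGraph (L₁ s (suc k)) using (graph; isRoot)

  roots : L₁Vertex s (suc k) → W
  roots u       = u₀
  roots v       = u₀
  roots (w _ j) = ws j

  fan-copy : ∀ {v₀ Used} → Fan G s k u₀ v₀ ws Used → ∀ t → CopyAvoiding (L₁ s (suc k)) G t roots Used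
  fan-copy {v₀} {Used} fan _ = record
    { embed = embed ; injective = λ {x} {y} → injective x y ; preserves = preserves }
    , on-roots , off-roots
    where
    open Fan fan
    length-leg : ∀ j → length (qs j ∷ʳ ws j) ≡ suc k
    length-leg j = trans (length-++ (qs j)) (trans (+-comm _ 1) (cong suc (length-qs j)))
    idx : ∀ j → Fin (suc k) → Fin (length (qs j ∷ʳ ws j))
    idx j = cast (sym (length-leg j))
    toℕ-idx : ∀ j i → toℕ (idx j i) ≡ toℕ i
    toℕ-idx j = toℕ-cast (sym (length-leg j))
    embed : L₁Vertex s (suc k) → W
    embed u       = u₀
    embed v       = v₀
    embed (w i j) = lookup (qs j ∷ʳ ws j) (idx j i)
    on-leg : ∀ i j → embed (w i j) ∈ qs j ∷ʳ ws j
    on-leg i j = ∈-lookup (idx j i)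
    u≢v : u₀ ≢ v₀
    u≢v eq = G.irrefl (subst (u₀ G.~_) (sym eq) root-edge)
    injective : ∀ x y → embed x ≡ embed y → x ≡ y
    injective u u _ = refl
    injective u v eq = contradiction eq u≢v
    injective u (w i j) eq = contradiction (subst (_∈ qs j ∷ʳ ws j) (sym eq) (on-leg i j)) (u∉ j)
    injective v u eq = contradiction (sym eq) u≢v
    injective v v _ = refl
    injective v (w i j) eq = contradiction (subst (_∈ qs j ∷ʳ ws j) (sym eq) (on-leg i j)) (v∉ j)
    injective (w i j) u eq = contradiction (subst (_∈ qs j ∷ʳ ws j) eq (on-leg i j)) (u∉ j)
    injective (w i j) v eq = contradiction (subst (_∈ qs j ∷ʳ ws j) eq (on-leg i j)) (v∉ j)
    injective (w i j) (w i′ j′) eq with j Fin.≟ j′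
    ... | no  j≢j′ = ⊥-elim (disjoint j≢j′
                      (on-leg i j , subst (_∈ qs j′ ∷ʳ ws j′) (sym eq) (on-leg i′ j′)))
    ... | yes refl = cong (λ i → w i j) (toℕ-injective (trans (sym (toℕ-idx j i))
                       (trans (cong toℕ (lookup-unique (unique j) (idx j i) (idx j i′) eq)) (toℕ-idx j i′))))
    preserves₁ : ∀ {x y} → L₁Edge x y → embed x G.~ embed y
    preserves₁ uv = root-edge
    preserves₁ (vw {i} {j} i≡0) =
      lookup-linked (linked j) zero (suc (idx j i)) (cong suc (trans (toℕ-idx j i) i≡0))
    preserves₁ (ww {i} {i′} {j} eq) =
      lookup-linked (linked j) (suc (idx j i)) (suc (idx j i′))
        (cong suc (trans (toℕ-idx j i′) (trans eq (cong suc (sym (toℕ-idx j i))))))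
    preserves : ∀ {x y} → Graph._~_ graph x y → embed x G.~ embed y
    preserves (fwd e) = preserves₁ e
    preserves (bwd e) = G.~-sym (preserves₁ e)
    on-roots : ∀ x → isRoot x ≡ true → embed x ≡ roots x
    on-roots u _ = refl
    on-roots (w i j) r = lookup-∷ʳ-last (qs j) (idx j i)
      (trans (toℕ-idx j i) (trans (≡ᵇ⇒≡ (toℕ i) k (subst Bool.T (sym r) tt)) (sym (length-qs j))))
    off-roots : ∀ x → isRoot x ≡ false → embed x ∉ Used
    off-roots v _ = v∉Used
    off-roots (w i j) r x∈ = qs∉Used j (lookup-∷ʳ-init (qs j) (idx j i) i≢ , x∈)
      where
      i≢ : toℕ (idx j i) ≢ length (qs j)
      i≢ eq = subst Bool.T r (≡⇒≡ᵇ (toℕ i) k (trans (sym (toℕ-idx j i)) (trans eq (length-qs j))))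

  fans-copy : ∀ t → (∀ Used → length Used ≤ t * length (elements {L₁Vertex s (suc k)}) →
                       ∃[ v₀ ] Fan G s k u₀ v₀ ws Used) →
              Copy (L s t (suc k)) G
  fans-copy t spread = blowup-copy (L₁ s (suc k)) G t roots
    (λ Used small → fan-copy (proj₂ (spread Used small)) t)

-- Almost regular subgraphs

module _ {n : ℕ} where

  remove : Fin n → List (Fin n) → List (Fin n)
  remove x = filter (¬? ∘ (Fin._≟ x))

  ∑-remove : ∀ {xs} → Unique xs → ∀ x (f : Fin n → ℕ) → ∑ xs f ≤ f x + ∑ (remove x xs) f
  ∑-remove {xs} unique x f = begin
    ∑ xs f
      ≡⟨ ∑-partition (Fin._≟ x) xs f ⟩
    ∑ (filter (Fin._≟ x) xs) f + ∑ (remove x xs) f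
      ≡⟨ cong (_+ ∑ (remove x xs) f) (∑-filter (Fin._≟ x) xs f) ⟩
    ∑ xs (λ y → χ (y Fin.≟ x) * f y) + ∑ (remove x xs) f
      ≤⟨ +-monoˡ-≤ _ (∑-mono xs (λ y → χ*-≤ (y Fin.≟ x)
           (λ { refl → ≤-reflexive (sym (trans (cong (_* f y) (χ-yes (y Fin.≟ y) refl)) (+-identityʳ _))) }))) ⟩
    ∑ xs (λ y → χ (y Fin.≟ x) * f x) + ∑ (remove x xs) f
      ≡⟨ cong (_+ ∑ (remove x xs) f) (∑-*ʳ (f x) xs _) ⟩
    ∑ xs (λ y → χ (y Fin.≟ x)) * f x + ∑ (remove x xs) f
      ≤⟨ +-monoˡ-≤ _ (*-monoˡ-≤ (f x) (∑-χ≡ Fin._≟_ unique x)) ⟩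
    1 * f x + ∑ (remove x xs) f
      ≡⟨ cong (_+ ∑ (remove x xs) f) (+-identityʳ (f x)) ⟩
    f x + ∑ (remove x xs) f ∎
    where open ≤-Reasoning

  ∑-remove-≤ : ∀ x xs (f : Fin n → ℕ) → ∑ (remove x xs) f ≤ ∑ xs f
  ∑-remove-≤ x xs f =
    ≤-trans (≤-reflexive (∑-filter (¬? ∘ (Fin._≟ x)) xs f))
            (∑-mono xs (λ y → χ*-≤ (¬? (y Fin.≟ x)) (λ _ → ≤-refl)))

module EdgeDensity {n : ℕ} (G : Graph (Fin n)) where
  open Graph G

  adj : Fin n → Fin n → ℕ
  adj x y = χ (x ~? y)

  degree : List (Fin n) → Fin n → ℕ
  degree xs x = ∑ xs (adj x)

  -- Every edge is counted twice.
  edges : List (Fin n) → ℕ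
  edges xs = ∑ xs (degree xs)

  cross : List (Fin n) → List (Fin n) → ℕ
  cross xs ys = ∑ xs (degree ys)

  adj-sym : ∀ x y → adj x y ≡ adj y x
  adj-sym x y = ≤-antisym (χ-mono (x ~? y) (y ~? x) ~-sym) (χ-mono (y ~? x) (x ~? y) ~-sym)

  cross-sym : ∀ xs ys → cross xs ys ≡ cross ys xs
  cross-sym xs ys = trans (∑-swap xs ys adj) (∑-cong ys (λ y → ∑-cong xs (λ x → adj-sym x y)))

  cross-++ʳ : ∀ xs ys zs → cross xs (ys ++ zs) ≡ cross xs ys + cross xs zs
  cross-++ʳ xs ys zs = trans (∑-cong xs (λ x → ∑-++ ys zs (adj x))) (∑-+ xs _ _)

  edges-++ : ∀ xs ys → edges (xs ++ ys) ≡ edges xs + 2 * cross xs ys + edges ys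
  edges-++ xs ys = begin
    edges (xs ++ ys)
      ≡⟨ ∑-++ xs ys _ ⟩
    cross xs (xs ++ ys) + cross ys (xs ++ ys)
      ≡⟨ cong₂ _+_ (cross-++ʳ xs xs ys) (cross-++ʳ ys xs ys) ⟩
    edges xs + cross xs ys + (cross ys xs + edges ys)
      ≡⟨ cong (λ c → edges xs + cross xs ys + (c + edges ys)) (cross-sym ys xs) ⟩
    edges xs + cross xs ys + (cross xs ys + edges ys)
      ≡⟨ regroup (edges xs) (cross xs ys) (edges ys) ⟩
    edges xs + 2 * cross xs ys + edges ys ∎
    where
    open ≡-Reasoning
    regroup : ∀ a b c → a + b + (b + c) ≡ a + 2 * b + c
    regroup = solve-∀

  degree≤length : ∀ xs x → degree xs x ≤ length xs
  degree≤length xs x =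
    ≤-trans (∑-≤ xs 1 (λ {y} _ → χ≤1 (x ~? y))) (≤-reflexive (*-identityʳ (length xs)))

  edges≤length² : ∀ xs → edges xs ≤ length xs * length xs
  edges≤length² xs = ∑-≤ xs (length xs) (λ {x} _ → degree≤length xs x)

  edges-remove : ∀ {xs} → Unique xs → ∀ x →
                 edges xs ≤ 2 * degree xs x + edges (remove x xs)
  edges-remove {xs} unique x = begin
    edges xs
      ≤⟨ ∑-remove unique x (degree xs) ⟩
    degree xs x + ∑ (remove x xs) (degree xs)
      ≤⟨ +-monoʳ-≤ (degree xs x) (∑-mono (remove x xs) (λ y → ∑-remove unique x (adj y))) ⟩
    degree xs x + ∑ (remove x xs) (λ y → adj y x + degree (remove x xs) y)
      ≡⟨ cong (degree xs x +_) (∑-+ (remove x xs) _ _) ⟩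
    degree xs x + (∑ (remove x xs) (λ y → adj y x) + edges (remove x xs))
      ≡⟨ cong (λ c → degree xs x + (c + edges (remove x xs)))
           (∑-cong (remove x xs) (λ y → adj-sym y x)) ⟩
    degree xs x + (degree (remove x xs) x + edges (remove x xs))
      ≤⟨ +-monoʳ-≤ (degree xs x) (+-monoˡ-≤ _ (∑-remove-≤ x xs (adj x))) ⟩
    degree xs x + (degree xs x + edges (remove x xs))
      ≡⟨ double (degree xs x) (edges (remove x xs)) ⟩
    2 * degree xs x + edges (remove x xs) ∎
    where
    open ≤-Reasoning
    double : ∀ a b → a + (a + b) ≡ 2 * a + b
    double = solve-∀

  record DenseCore (d : ℕ) (xs : List (Fin n)) : Set where
    field
      core       : List (Fin n)
      unique     : Unique core
      nonempty   : 1 ≤ length core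
      smaller    : length core ≤ length xs
      min-degree : ∀ {x} → x ∈ core → d ≤ degree core x
      sub-degree : ∀ x → degree core x ≤ degree xs x
      core⊆      : ∀ {x} → x ∈ core → x ∈ xs

  dense-core : ∀ d fuel {xs} → length xs ≤ fuel → Unique xs → 1 ≤ length xs →
               2 * d * length xs ≤ edges xs → DenseCore d xs
  dense-core d zero       {_ ∷ _} ()
  dense-core d (suc fuel) {xs} le unique nonempty dense
    with any? (λ x → degree xs x <? d) xs
  ... | no ¬small = record
    { core = xs ; unique = unique ; nonempty = nonempty ; smaller = ≤-refl
    ; min-degree = λ x∈ → ≮⇒≥ (λ lt → ¬small (Any.map (λ { refl → lt }) x∈))
    ; sub-degree = λ _ → ≤-refl ; core⊆ = id }
  ... | yes small with x , x∈ , lt ← find small = record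
    { core = core ; unique = unique′ ; nonempty = nonempty′
    ; smaller = ≤-trans smaller (<⇒≤ shorter)
    ; min-degree = min-degree
    ; sub-degree = λ y → ≤-trans (sub-degree y) (∑-remove-≤ x xs (adj y))
    ; core⊆ = λ y∈ → proj₁ (∈-filter⁻ (¬? ∘ (Fin._≟ x)) (core⊆ y∈)) }
    where
    ys = remove x xs
    shorter : length ys < length xs
    shorter = filter-notAll (¬? ∘ (Fin._≟ x)) xs (Any.map (λ { refl ¬p → ¬p refl }) x∈)
    -- The surplus 2 comes from the strict inequality `degree xs x < d`. It keeps an edge in `ys`,
    -- so deletion cannot exhaust the vertices.
    still-dense : 2 * d * length ys + 2 ≤ edges ys
    still-dense = +-cancelˡ-≤ (2 * degree xs x) _ _ (begin
      2 * degree xs x + (2 * d * length ys + 2)   ≡⟨ regroup (degree xs x) d (length ys) ⟩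
      2 * suc (degree xs x) + 2 * d * length ys   ≤⟨ +-monoˡ-≤ _ (*-monoʳ-≤ 2 lt) ⟩
      2 * d + 2 * d * length ys                   ≡⟨ *-suc (2 * d) (length ys) ⟨
      2 * d * suc (length ys)                     ≤⟨ *-monoʳ-≤ (2 * d) shorter ⟩
      2 * d * length xs                           ≤⟨ dense ⟩
      edges xs                                    ≤⟨ edges-remove unique x ⟩
      2 * degree xs x + edges ys                  ∎)
      where
      open ≤-Reasoning
      regroup : ∀ a d l → 2 * a + (2 * d * l + 2) ≡ 2 * suc a + 2 * d * l
      regroup = solve-∀
    ys-nonempty : 1 ≤ length ys
    ys-nonempty with ys | still-dense
    ... | []    | dense′ = contradiction (≤-trans (m≤n+m 2 (2 * d * 0)) dense′) λ ()
    ... | _ ∷ _ | _      = s≤s z≤n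
    open DenseCore (dense-core d fuel (≤-pred (≤-trans shorter le)) (Unique.filter⁺ _ unique)
                      ys-nonempty (≤-trans (m≤m+n _ 2) still-dense))
      renaming (unique to unique′; nonempty to nonempty′)

  DenserPart : (T xs : List (Fin n)) (h b E : ℕ) → Set
  DenserPart T xs h b E = ∃[ C ] Unique C × (∀ {x} → x ∈ C → x ∈ xs) × length C ≤ h ×
                                 E < b * edges (T ++ C)

  -- Every block `C` of `h` vertices satisfies 2 cross(T, C) ≤ edges(T ++ C). So either one block
  -- pushes this above E / b, or the bounds for the `r` blocks add up.
  chop : ∀ T h b E r {xs} → Unique xs → length xs ≤ r * h →
         DenserPart T xs h b E ⊎ b * (2 * cross T xs) ≤ r * E
  chop T h b E zero {[]} _ _ = inj₂ (≤-reflexive (begin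
    b * (2 * cross T [])  ≡⟨ cong (λ c → b * (2 * c)) (trans (∑-const T 0) (*-zeroʳ (length T))) ⟩
    b * 0                 ≡⟨ *-zeroʳ b ⟩
    0                     ∎))
    where open ≡-Reasoning
  chop T h b E (suc r) {xs} unique le = decide (E <? b * edges (T ++ C))
                                               (chop T h b E r (Unique.drop⁺ h unique) le′)
    where
    C = take h xs
    D = drop h xs
    C++D≡xs = take++drop≡id h xs
    le′ : length D ≤ r * h
    le′ = ≤-trans (≤-reflexive (length-drop h xs))
                  (≤-trans (∸-monoˡ-≤ h le) (≤-reflexive (m+n∸m≡n h (r * h))))
    decide : Dec (E < b * edges (T ++ C)) → DenserPart T D h b E ⊎ b * (2 * cross T D) ≤ r * E →
             DenserPart T xs h b E ⊎ b * (2 * cross T xs) ≤ suc r * E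
    decide (yes lt) _ = inj₁ (C , Unique.take⁺ h unique
      , (λ x∈ → subst (_ ∈_) C++D≡xs (∈-++⁺ˡ x∈))
      , ≤-trans (≤-reflexive (length-take h xs)) (m⊓n≤m h _) , lt)
    decide (no _) (inj₁ (C′ , unique′ , C′⊆ , rest)) =
      inj₁ (C′ , unique′ , (λ x∈ → subst (_ ∈_) C++D≡xs (∈-++⁺ʳ C (C′⊆ x∈))) , rest)
    decide (no ≮) (inj₂ small) = inj₂ (begin
      b * (2 * cross T xs)                        ≡⟨ cong (λ zs → b * (2 * cross T zs)) C++D≡xs ⟨
      b * (2 * cross T (C ++ D))                  ≡⟨ cong (λ c → b * (2 * c)) (cross-++ʳ T C D) ⟩
      b * (2 * (cross T C + cross T D))           ≡⟨ distrib b (cross T C) (cross T D) ⟩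
      b * (2 * cross T C) + b * (2 * cross T D)
        ≤⟨ +-mono-≤ (≤-trans (*-monoʳ-≤ b part) (≮⇒≥ ≮)) small ⟩
      E + r * E                                   ∎)
      where
      open ≤-Reasoning
      distrib : ∀ b c d → b * (2 * (c + d)) ≡ b * (2 * c) + b * (2 * d)
      distrib = solve-∀
      part : 2 * cross T C ≤ edges (T ++ C)
      part = ≤-trans (m≤n+m _ (edges T)) (≤-trans (m≤m+n _ (edges C)) (≤-reflexive (sym (edges-++ T C))))

-- Powers, cancellation and division

^-distribʳ-* : ∀ m n o → (m * n) ^ o ≡ m ^ o * n ^ o
^-distribʳ-* m n zero    = refl
^-distribʳ-* m n (suc o) = trans (cong (m * n *_) (^-distribʳ-* m n o)) (interchange m n (m ^ o) (n ^ o))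
  where
  interchange : ∀ a b c d → a * b * (c * d) ≡ a * c * (b * d)
  interchange = solve-∀

^-cancelʳ-≤ : ∀ {m n} o → 1 ≤ o → m ^ o ≤ n ^ o → m ≤ n
^-cancelʳ-≤ {m} {n} o@(suc _) _ le with m ≤? n
... | yes m≤n = m≤n
... | no  m≰n = contradiction le (<⇒≱ (^-monoˡ-< o (≰⇒> m≰n)))

^-positive : ∀ {m} → 1 ≤ m → ∀ n → 1 ≤ m ^ n
^-positive {m@(suc _)} _ n = m^n>0 m n

*-positive : ∀ {m n} → 1 ≤ m → 1 ≤ n → 1 ≤ m * n
*-positive = *-mono-≤

≤-*ˡ : ∀ {m} n → 1 ≤ m → n ≤ m * n
≤-*ˡ {m@(suc _)} n _ = m≤n*m n m

≤-*ʳ : ∀ {m} n → 1 ≤ m → n ≤ n * m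
≤-*ʳ {m@(suc _)} n _ = m≤m*n n m

*-cancelˡ : ∀ {m n} o → 1 ≤ o → o * m ≤ o * n → m ≤ n
*-cancelˡ o@(suc _) _ = *-cancelˡ-≤ o

/-upper : ∀ m n .{{_ : NonZero n}} → m < n * suc (m / n)
/-upper m n = begin-strict
  m                    ≡⟨ m≡m%n+[m/n]*n m n ⟩
  m % n + m / n * n    <⟨ +-monoˡ-< (m / n * n) (m%n<n m n) ⟩
  n + m / n * n        ≡⟨ cong (n +_) (*-comm (m / n) n) ⟩
  n + n * (m / n)      ≡⟨ *-suc n (m / n) ⟨
  n * suc (m / n)      ∎
  where open ≤-Reasoning

-- Regularisation by density increments

module Regularisation (q s : ℕ) (1≤q : 1 ≤ q) (1≤s : 1 ≤ s) where

  private
    -- Dividing the number of vertices by `Λ` and the number of edges by 10^(q + s) takes the same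
    -- factor 10^(q(q + s)) from both sides of `Dense`, so a subset this small with that many edges
    -- is dense again.
    Λ : ℕ
    Λ = 10 ^ q

    1≤Λ : 1 ≤ Λ
    1≤Λ = ^-positive (s≤s z≤n) q

  -- Vertices whose degree exceeds κ times the average are set aside.
  κ : ℕ
  κ = 2 * 10 ^ q

  module _ {N : ℕ} (G : Graph (Fin N)) where
    open EdgeDensity G

    private
      heavy? : ∀ xs x → Dec (κ * edges xs < length xs * degree xs x)
      heavy? xs x = κ * edges xs <? length xs * degree xs x

    heavy light : List (Fin N) → List (Fin N)
    heavy xs = filter (heavy? xs) xs
    light xs = filter (¬? ∘ heavy? xs) xs

    -- Markov's inequality for the degrees, whose sum is `edges xs`.
    κ*heavy≤ : ∀ xs → 1 ≤ edges xs → κ * length (heavy xs) ≤ length xs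
    κ*heavy≤ xs 1≤E = *-cancelˡ (edges xs) 1≤E (begin
      edges xs * (κ * length (heavy xs))             ≡⟨ rotate (edges xs) κ (length (heavy xs)) ⟩
      length (heavy xs) * (κ * edges xs)
        ≤⟨ ∑-≥ (heavy xs) (κ * edges xs) (λ x∈ → <⇒≤ (proj₂ (∈-filter⁻ (heavy? xs) {xs = xs} x∈))) ⟩
      ∑ (heavy xs) (λ x → length xs * degree xs x)   ≡⟨ ∑-*ˡ (length xs) (heavy xs) (degree xs) ⟩
      length xs * ∑ (heavy xs) (degree xs)
        ≤⟨ *-monoʳ-≤ (length xs) (≤-trans (m≤m+n _ _) (≤-reflexive (sym (∑-partition (heavy? xs) xs (degree xs))))) ⟩
      length xs * edges xs                           ≡⟨ *-comm (length xs) (edges xs) ⟩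
      edges xs * length xs                           ∎)
      where
      open ≤-Reasoning
      rotate : ∀ a b c → a * (b * c) ≡ c * (b * a)
      rotate = solve-∀

    edges-split : ∀ xs → edges xs ≡ edges (heavy xs) + 2 * cross (heavy xs) (light xs) + edges (light xs)
    edges-split xs = begin
      edges xs
        ≡⟨ ∑-partition (heavy? xs) xs (degree xs) ⟩
      ∑ (heavy xs) (degree xs) + ∑ (light xs) (degree xs)
        ≡⟨ cong₂ _+_ (∑-cong (heavy xs) split) (∑-cong (light xs) split) ⟩
      cross (heavy xs) (heavy xs ++ light xs) + cross (light xs) (heavy xs ++ light xs)
        ≡⟨ ∑-++ (heavy xs) (light xs) _ ⟨
      edges (heavy xs ++ light xs)
        ≡⟨ edges-++ (heavy xs) (light xs) ⟩
      edges (heavy xs) + 2 * cross (heavy xs) (light xs) + edges (light xs) ∎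
      where
      open ≡-Reasoning
      split : ∀ x → degree xs x ≡ degree (heavy xs ++ light xs) x
      split x = trans (∑-partition (heavy? xs) xs (adj x)) (sym (∑-++ (heavy xs) (light xs) (adj x)))

    record DenserSubset (xs : List (Fin N)) : Set where
      field
        subset : List (Fin N)
        unique : Unique subset
        small  : Λ * length subset ≤ length xs
        denser : edges xs < 10 ^ (q + s) * edges subset

    -- Cut the light vertices into 2κ classes of size ≈ n / κ.  If the union of the heavy vertices with
    -- some class spans too many edges, recurse into it; otherwise most edges join light vertices.
    denser-or-light : ∀ xs → Unique xs → 1 ≤ edges xs → κ ≤ length xs →
                      DenserSubset xs ⊎ edges xs ≤ 2 * edges (light xs)
    denser-or-light xs unique 1≤E κ≤n = decide
      -- The empty class is tested first: either the heavy vertices alone form the denser subset, or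
      -- the edges inside `T` are bounded.
      (edges xs <? 10 ^ (q + s) * edges (T ++ []))
      (chop T h (10 ^ (q + s)) (edges xs) (2 * κ) (Unique.filter⁺ _ unique) enough)
      where
      instance
        nonZero-κ : NonZero κ
        nonZero-κ = >-nonZero (*-positive {2} (s≤s z≤n) 1≤Λ)
      n = length xs
      T = heavy xs
      A = light xs
      h = n / κ
      κh≤n : κ * h ≤ n
      κh≤n = ≤-trans (≤-reflexive (*-comm κ h)) (m/n*n≤m n κ)
      1≤h : 1 ≤ h
      1≤h with h | /-upper n κ
      ... | zero  | lt = contradiction lt (≤⇒≯ (≤-trans (≤-reflexive (*-identityʳ κ)) κ≤n))
      ... | suc _ | _  = s≤s z≤n
      enough : length A ≤ 2 * κ * h
      enough = begin
        length A       ≤⟨ length-filter _ xs ⟩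
        n              ≤⟨ <⇒≤ (/-upper n κ) ⟩
        κ * suc h      ≤⟨ *-monoʳ-≤ κ (+-monoˡ-≤ h 1≤h) ⟩
        κ * (h + h)    ≡⟨ double κ h ⟩
        2 * κ * h      ∎
        where
        open ≤-Reasoning
        double : ∀ a b → a * (b + b) ≡ 2 * a * b
        double = solve-∀
      denser : ∀ C → Unique C → (∀ {x} → x ∈ C → x ∈ A) → length C ≤ h →
               edges xs < 10 ^ (q + s) * edges (T ++ C) → DenserSubset xs
      denser C uniqueC C⊆ |C|≤h lt = record
        { subset = T ++ C
        ; unique = Unique.++⁺ (Unique.filter⁺ _ unique) uniqueC
            (λ (x∈T , x∈C) → proj₂ (∈-filter⁻ (¬? ∘ heavy? xs) {xs = xs} (C⊆ x∈C))
                                   (proj₂ (∈-filter⁻ (heavy? xs) {xs = xs} x∈T)))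
        ; small  = *-cancelˡ 2 (s≤s z≤n) (begin
            2 * (Λ * length (T ++ C))     ≡⟨ cong (λ l → 2 * (Λ * l)) (length-++ T) ⟩
            2 * (Λ * (length T + length C)) ≡⟨ distrib Λ (length T) (length C) ⟩
            κ * length T + κ * length C   ≤⟨ +-mono-≤ (κ*heavy≤ xs 1≤E) (≤-trans (*-monoʳ-≤ κ |C|≤h) κh≤n) ⟩
            n + n                         ≡⟨ cong (n +_) (+-identityʳ n) ⟨
            2 * n                         ∎)
        ; denser = lt
        }
        where
        open ≤-Reasoning
        distrib : ∀ a b c → 2 * (a * (b + c)) ≡ 2 * a * b + 2 * a * c
        distrib = solve-∀
      decide : Dec (edges xs < 10 ^ (q + s) * edges (T ++ [])) →
               DenserPart T A h (10 ^ (q + s)) (edges xs) ⊎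
                 10 ^ (q + s) * (2 * cross T A) ≤ 2 * κ * edges xs →
               DenserSubset xs ⊎ edges xs ≤ 2 * edges A
      decide (yes lt) _ = inj₁ (denser [] [] (λ ()) z≤n lt)
      decide (no _) (inj₁ (C , uniqueC , C⊆ , |C|≤h , lt)) = inj₁ (denser C uniqueC C⊆ |C|≤h lt)
      -- Up to the factor P, the edges inside `T` account for at most Λ E and those between `T` and
      -- `A` for 2κ E = 4Λ E. Twice the sum is 10Λ E ≤ P E, which is where the base 10 and the
      -- assumption s ≥ 1 enter.
      decide (no ≮) (inj₂ le) = inj₂ (*-cancelˡ P 1≤P (+-cancelˡ-≤ (P * E) _ _ (begin
        P * E + P * E
          ≡⟨ cong (λ e → P * e + P * e) (edges-split xs) ⟩
        P * (edges T + 2 * cross T A + edges A) + P * (edges T + 2 * cross T A + edges A)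
          ≡⟨ expand P (edges T) (cross T A) (edges A) ⟩
        2 * (P * edges T + P * (2 * cross T A)) + P * (2 * edges A)
          ≤⟨ +-monoˡ-≤ _ (*-monoʳ-≤ 2 (+-mono-≤ heavy-part le)) ⟩
        2 * (Λ * E + 2 * κ * E) + P * (2 * edges A)
          ≡⟨ cong (_+ P * (2 * edges A)) (collect Λ E) ⟩
        10 * Λ * E + P * (2 * edges A)
          ≤⟨ +-monoˡ-≤ _ (*-monoˡ-≤ E 10Λ≤P) ⟩
        P * E + P * (2 * edges A) ∎)))
        where
        open ≤-Reasoning
        P = 10 ^ (q + s)
        E = edges xs
        1≤P : 1 ≤ P
        1≤P = ^-positive (s≤s z≤n) (q + s)
        10Λ≤P : 10 * Λ ≤ P
        10Λ≤P = ^-monoʳ-≤ 10 (≤-trans (≤-reflexive (+-comm 1 q)) (+-monoʳ-≤ q 1≤s))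
        heavy-part : P * edges T ≤ Λ * E
        heavy-part = ≤-trans (*-monoʳ-≤ P (≤-trans (m≤m+n _ _) (≤-trans (m≤m+n _ _) (≤-reflexive (sym (edges-++ T []))))))
                             (≤-trans (≮⇒≥ ≮) (≤-*ˡ E 1≤Λ))
        expand : ∀ p a b c → p * (a + 2 * b + c) + p * (a + 2 * b + c) ≡
                 2 * (p * a + p * (2 * b)) + p * (2 * c)
        expand = solve-∀
        collect : ∀ l e → 2 * (l * e + 2 * (2 * l) * e) ≡ 10 * l * e
        collect = solve-∀

    -- `many-edges` says that d is at least (C / 8) m^(s/q), where m is the size of the core. The
    -- degree ratio 8κ depends on q alone, so `C` can still be chosen in terms of it.
    record RegularCore (C : ℕ) : Set where
      field
        d          : ℕ
        core       : List (Fin N)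
        unique     : Unique core
        1≤d        : 1 ≤ d
        nonempty   : 1 ≤ length core
        min-degree : ∀ {x} → x ∈ core → d ≤ degree core x
        max-degree : ∀ {x} → x ∈ core → degree core x ≤ 8 * κ * d
        many-edges : C ^ q * length core ^ s ≤ (8 * d) ^ q

    module _ (C : ℕ) (4≤C : 4 ≤ C) (κ≤C : κ ≤ C) where

      Dense : List (Fin N) → Set
      Dense xs = C ^ q * length xs ^ (q + s) ≤ edges xs ^ q

      private
        nonempty-edges : ∀ xs → 1 ≤ edges xs → 1 ≤ length xs
        nonempty-edges (_ ∷ _) _ = s≤s z≤n

        C*length≤edges : ∀ xs → 1 ≤ length xs → Dense xs → C * length xs ≤ edges xs
        C*length≤edges xs 1≤n dense = ^-cancelʳ-≤ q 1≤q (begin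
          (C * length xs) ^ q                         ≡⟨ ^-distribʳ-* C (length xs) q ⟩
          C ^ q * length xs ^ q                       ≤⟨ *-monoʳ-≤ (C ^ q) (≤-*ʳ (length xs ^ q) (^-positive 1≤n s)) ⟩
          C ^ q * (length xs ^ q * length xs ^ s)     ≡⟨ cong (C ^ q *_) (^-distribˡ-+-* (length xs) q s) ⟨
          C ^ q * length xs ^ (q + s)                 ≤⟨ dense ⟩
          edges xs ^ q                                ∎)
          where open ≤-Reasoning

        C≤length : ∀ xs → 1 ≤ length xs → Dense xs → C ≤ length xs
        C≤length xs 1≤n dense = *-cancelˡ (length xs) 1≤n
          (≤-trans (≤-reflexive (*-comm (length xs) C))
                   (≤-trans (C*length≤edges xs 1≤n dense) (edges≤length² xs)))

        light-core : ∀ xs → Unique xs → 1 ≤ length xs → Dense xs → edges xs ≤ 2 * edges (light xs) →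
                     RegularCore C
        light-core xs unique 1≤n dense E≤ = record
          { d = d ; core = core ; unique = unique′ ; 1≤d = 1≤d ; nonempty = nonempty
          ; min-degree = min-degree ; max-degree = max-degree ; many-edges = many-edges }
          where
          open ≤-Reasoning
          n = length xs
          E = edges xs
          instance
            nonZero-4n : NonZero (4 * n)
            nonZero-4n = >-nonZero (*-positive {4} (s≤s z≤n) 1≤n)
          -- The light vertices span at least E / 2 and `dense-core` asks for 2 d |A|, hence the 4.
          -- Since d ≥ 1, rounding down costs at most a factor 2, which turns the 4 into the 8 of
          -- `E≤8nd`.
          d = E / (4 * n)
          4dn≤E : d * (4 * n) ≤ E
          4dn≤E = m/n*n≤m E (4 * n)
          4n≤E : 4 * n ≤ E
          4n≤E = ≤-trans (*-monoˡ-≤ n 4≤C) (C*length≤edges xs 1≤n dense)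
          1≤d : 1 ≤ d
          1≤d with d | /-upper E (4 * n)
          ... | zero  | lt = contradiction lt (≤⇒≯ (≤-trans (≤-reflexive (*-identityʳ (4 * n))) 4n≤E))
          ... | suc _ | _  = s≤s z≤n
          E≤8nd : E ≤ n * (8 * d)
          E≤8nd = begin
            E                ≤⟨ <⇒≤ (/-upper E (4 * n)) ⟩
            4 * n * suc d    ≤⟨ *-monoʳ-≤ (4 * n) (+-monoˡ-≤ d 1≤d) ⟩
            4 * n * (d + d)  ≡⟨ regroup n d ⟩
            n * (8 * d)      ∎
            where
            regroup : ∀ a b → 4 * a * (b + b) ≡ a * (8 * b)
            regroup = solve-∀
          A = light xs
          |A|≤n : length A ≤ n
          |A|≤n = length-filter _ xs
          1≤|A| : 1 ≤ length A
          1≤|A| = nonempty-edges A (*-cancelˡ 2 (s≤s z≤n) (≤-trans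
            (≤-trans (s≤s (s≤s z≤n)) (≤-trans (≤-*ʳ 4 1≤n) 4n≤E)) E≤))
          denseA : 2 * d * length A ≤ edges A
          denseA = *-cancelˡ 2 (s≤s z≤n) (begin
            2 * (2 * d * length A)  ≤⟨ *-monoʳ-≤ 2 (*-monoʳ-≤ (2 * d) |A|≤n) ⟩
            2 * (2 * d * n)         ≡⟨ regroup d n ⟩
            d * (4 * n)             ≤⟨ 4dn≤E ⟩
            E                       ≤⟨ E≤ ⟩
            2 * edges A             ∎)
            where
            regroup : ∀ a b → 2 * (2 * a * b) ≡ a * (4 * b)
            regroup = solve-∀
          open DenseCore (dense-core d (length A) ≤-refl (Unique.filter⁺ _ unique) 1≤|A| denseA)
            renaming (unique to unique′)
          max-degree : ∀ {x} → x ∈ core → degree core x ≤ 8 * κ * d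
          max-degree {x} x∈ = *-cancelˡ n 1≤n (begin
            n * degree core x  ≤⟨ *-monoʳ-≤ n (≤-trans (sub-degree x) (light≤ x)) ⟩
            n * degree xs x    ≤⟨ ≮⇒≥ (proj₂ (∈-filter⁻ (¬? ∘ heavy? xs) {xs = xs} (core⊆ x∈))) ⟩
            κ * E              ≤⟨ *-monoʳ-≤ κ E≤8nd ⟩
            κ * (n * (8 * d))  ≡⟨ regroup κ n d ⟩
            n * (8 * κ * d)    ∎)
            where
            regroup : ∀ a b c → a * (b * (8 * c)) ≡ b * (8 * a * c)
            regroup = solve-∀
            light≤ : ∀ x → degree A x ≤ degree xs x
            light≤ x = ≤-trans (m≤n+m _ _) (≤-reflexive (sym (∑-partition (heavy? xs) xs (adj x))))
          many-edges : C ^ q * length core ^ s ≤ (8 * d) ^ q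
          many-edges = *-cancelˡ (n ^ q) (^-positive 1≤n q) (begin
            n ^ q * (C ^ q * length core ^ s)  ≤⟨ *-monoʳ-≤ (n ^ q) (*-monoʳ-≤ (C ^ q) (^-monoˡ-≤ s (≤-trans smaller |A|≤n))) ⟩
            n ^ q * (C ^ q * n ^ s)            ≡⟨ rotate (n ^ q) (C ^ q) (n ^ s) ⟩
            C ^ q * (n ^ q * n ^ s)            ≡⟨ cong (C ^ q *_) (^-distribˡ-+-* n q s) ⟨
            C ^ q * n ^ (q + s)                ≤⟨ dense ⟩
            E ^ q                              ≤⟨ ^-monoˡ-≤ q E≤8nd ⟩
            (n * (8 * d)) ^ q                  ≡⟨ ^-distribʳ-* n (8 * d) q ⟩
            n ^ q * (8 * d) ^ q                ∎)
            where
            rotate : ∀ a b c → a * (b * c) ≡ b * (a * c)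
            rotate = solve-∀

      -- `Dense` survives each passage to a denser subset while the number of vertices strictly
      -- drops. It also forces at least C ≥ κ vertices, so the classes used in `denser-or-light`
      -- have positive size.
      regular-core : ∀ fuel xs → length xs ≤ fuel → Unique xs → 1 ≤ length xs → Dense xs → RegularCore C
      regular-core zero       (_ ∷ _) ()
      regular-core (suc fuel) xs le unique 1≤n dense
        with denser-or-light xs unique 1≤E (≤-trans κ≤C (C≤length xs 1≤n dense))
        where
        1≤E : 1 ≤ edges xs
        1≤E = ≤-trans (*-positive (≤-trans (s≤s z≤n) 4≤C) 1≤n) (C*length≤edges xs 1≤n dense)
      ... | inj₂ E≤ = light-core xs unique 1≤n dense E≤
      ... | inj₁ denserSubset =
        regular-core fuel subset (≤-pred (≤-trans shorter le)) unique′ 1≤|S| dense′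
        where
        open DenserSubset denserSubset renaming (unique to unique′)
        open ≤-Reasoning
        S = subset
        n = length xs
        1≤|S| : 1 ≤ length S
        1≤|S| = nonempty-edges S (*-cancelˡ-< (10 ^ (q + s)) 0 (edges S)
          (≤-trans (s≤s (≤-reflexive (*-zeroʳ (10 ^ (q + s))))) (≤-trans (s≤s z≤n) denser)))
        shorter : length S < n
        shorter = ≤-trans (≤-trans (+-monoˡ-≤ (length S) 1≤|S|)
                    (≤-trans (≤-reflexive (cong (length S +_) (sym (+-identityʳ (length S)))))
                      (*-monoˡ-≤ (length S) 2≤Λ))) small
          where
          2≤Λ : 2 ≤ Λ
          2≤Λ = ≤-trans (s≤s (s≤s z≤n)) (^-monoʳ-≤ 10 1≤q)
        dense′ : Dense S
        dense′ = *-cancelˡ (Λ ^ (q + s)) (^-positive 1≤Λ (q + s)) (begin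
          Λ ^ (q + s) * (C ^ q * length S ^ (q + s))   ≡⟨ rotate (Λ ^ (q + s)) (C ^ q) _ ⟩
          C ^ q * (Λ ^ (q + s) * length S ^ (q + s))   ≡⟨ cong (C ^ q *_) (^-distribʳ-* Λ (length S) (q + s)) ⟨
          C ^ q * (Λ * length S) ^ (q + s)             ≤⟨ *-monoʳ-≤ (C ^ q) (^-monoˡ-≤ (q + s) small) ⟩
          C ^ q * n ^ (q + s)                          ≤⟨ dense ⟩
          edges xs ^ q                                 ≤⟨ ^-monoˡ-≤ q (<⇒≤ denser) ⟩
          (10 ^ (q + s) * edges S) ^ q                 ≡⟨ ^-distribʳ-* (10 ^ (q + s)) (edges S) q ⟩
          (10 ^ (q + s)) ^ q * edges S ^ q             ≡⟨ cong (_* edges S ^ q) exponents ⟩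
          Λ ^ (q + s) * edges S ^ q                    ∎)
          where
          rotate : ∀ a b c → a * (b * c) ≡ b * (a * c)
          rotate = solve-∀
          exponents : (10 ^ (q + s)) ^ q ≡ Λ ^ (q + s)
          exponents = trans (^-*-assoc 10 (q + s) q)
                            (trans (cong (10 ^_) (*-comm (q + s) q)) (sym (^-*-assoc 10 q (q + s))))

-- Good paths

-- Exhaustive search replaces excluded middle. The alternative `Q` is an arbitrary predicate instead
-- of the negation of `P`, so that a failed search returns positive evidence, such as the points
-- where paths meet a blocking set.
search-Fin : ∀ n {P Q : Fin n → Set} → (∀ x → P x ⊎ Q x) → ∃ P ⊎ (∀ x → Q x)
search-Fin zero    _ = inj₂ λ ()
search-Fin (suc n) d with d zero | search-Fin n (d ∘ suc)
... | inj₁ p | _            = inj₁ (zero , p)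
... | inj₂ _ | inj₁ (x , p) = inj₁ (suc x , p)
... | inj₂ q | inj₂ qs      = inj₂ λ { zero → q ; (suc x) → qs x }

search-List : ∀ {n} i {P Q : List (Fin n) → Set} → (∀ xs → P xs ⊎ Q xs) →
              (∃[ xs ] length xs ≡ i × P xs) ⊎ (∀ xs → length xs ≡ i → Q xs)
search-List zero d with d []
... | inj₁ p = inj₁ ([] , refl , p)
... | inj₂ q = inj₂ λ { [] _ → q }
search-List {n} (suc i) d with search-Fin n (λ x → search-List i (λ xs → d (x ∷ xs)))
... | inj₁ (x , xs , eq , p) = inj₁ (x ∷ xs , cong suc eq , p)
... | inj₂ q                 = inj₂ λ { (x ∷ xs) eq → q x xs (suc-injective eq) }

module _ {A : Set} {R : A → A → Set} where

  linked-prefix : ∀ xs {y zs} → Linked R (xs ++ y ∷ zs) → Linked R (xs ∷ʳ y)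
  linked-prefix []            _        = [-]
  linked-prefix (_ ∷ [])      (r ∷ _)  = r ∷ [-]
  linked-prefix (_ ∷ xs@(_ ∷ _)) (r ∷ rs) = r ∷ linked-prefix xs rs

  linked-suffix : ∀ xs {ys} → Linked R (xs ++ ys) → Linked R ys
  linked-suffix []       rs = rs
  linked-suffix (_ ∷ xs) rs = linked-suffix xs (Linked.tail rs)

  linked-∷ʳ : ∀ xs {y z} → Linked R (xs ∷ʳ y) → R y z → Linked R ((xs ∷ʳ y) ∷ʳ z)
  linked-∷ʳ []               _        r′ = r′ ∷ [-]
  linked-∷ʳ (_ ∷ [])         (r ∷ _)  r′ = r ∷ r′ ∷ [-]
  linked-∷ʳ (_ ∷ xs@(_ ∷ _)) (r ∷ rs) r′ = r ∷ linked-∷ʳ xs rs r′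

module Paths {n : ℕ} (G : Graph (Fin n)) where
  open Graph G

  V : Set
  V = Fin n

  -- q lists the i interior vertices of a path from x to y.
  Path : ℕ → V → V → List V → Set
  Path i x y q = length q ≡ i × Linked _~_ (x ∷ q ∷ʳ y) × Unique q

  Connected : ℕ → V → V → List V → Set
  Connected i x y Used = ∃[ q ] Path i x y q × Disjoint q Used

  Rich : ℕ → ℕ → V → V → Set
  Rich b i x y = ∀ Used → length Used ≤ b → Connected i x y Used

  Blocked : ℕ → ℕ → V → V → Set
  Blocked b i x y =
    ∃[ Used ] length Used ≤ b × (∀ q → Path i x y q → ∃[ a ] a ∈ q × a ∈ Used)

  meets-or-disjoint : ∀ (xs ys : List V) → (∃[ a ] a ∈ xs × a ∈ ys) ⊎ Disjoint xs ys
  meets-or-disjoint xs ys with any? (λ x → _∈?_ Fin._≟_ x ys) xs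
  ... | yes meets = inj₁ (find meets)
  ... | no  ¬meet = inj₂ λ (x∈xs , x∈ys) → ¬meet (lose x∈xs x∈ys)

  rich-or-blocked : ∀ b i x y → Rich b i x y ⊎ Blocked b i x y
  rich-or-blocked b i x y with search-List b blocked-or-connected
    where
    decide : ∀ Used q → (Linked _~_ (x ∷ q ∷ʳ y) × Unique q) × Disjoint q Used ⊎
                        (Linked _~_ (x ∷ q ∷ʳ y) × Unique q → ∃[ a ] a ∈ q × a ∈ Used)
    decide Used q
      with linked? _~?_ (x ∷ q ∷ʳ y) ×-dec DecUnique.unique? Fin._≟_ q | meets-or-disjoint q Used
    ... | no ¬path | _             = inj₂ λ path → contradiction path ¬path
    ... | yes path | inj₂ disjoint = inj₁ (path , disjoint)
    ... | yes _    | inj₁ meets    = inj₂ λ _ → meets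
    blocked-or-connected : ∀ Used →
      (∀ q → Path i x y q → ∃[ a ] a ∈ q × a ∈ Used) ⊎ Connected i x y Used
    blocked-or-connected Used with search-List i (decide Used)
    ... | inj₁ (q , eq , path , disjoint) = inj₂ (q , (eq , path) , disjoint)
    ... | inj₂ blocks                     = inj₁ λ q (eq , path) → blocks q eq path
  ... | inj₁ (Used , eq , blocks) = inj₂ (Used , ≤-reflexive eq , blocks)
  -- Only lists of length exactly `b` were searched. A shorter `Used` is padded with copies of `x`;
  -- a path avoiding more also avoids `Used`.
  ... | inj₂ connected            = inj₁ λ Used le →
    let q , path , disjoint = connected (Used ++ replicate (b ∸ length Used) x)
          (trans (length-++ Used) (trans (cong (length Used +_) (length-replicate _)) (m+[n∸m]≡n le)))
    in q , path , λ (z∈q , z∈Used) → disjoint (z∈q , ∈-++⁺ˡ z∈Used)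

  blocked⇒¬rich : ∀ {b i x y} → Blocked b i x y → ¬ Rich b i x y
  blocked⇒¬rich (Used , small , blocks) rich with q , path , disjoint ← rich Used small
    with _ , a∈q , a∈Used ← blocks q path = disjoint (a∈q , a∈Used)

  rich? : ∀ b i x y → Dec (Rich b i x y)
  rich? b i x y with rich-or-blocked b i x y
  ... | inj₁ rich    = yes rich
  ... | inj₂ blocked = no (blocked⇒¬rich blocked)

  -- b i is the richness threshold for pairs at distance i + 1.
  module Good (k : ℕ) (b : ℕ → ℕ) where

    -- Here `i` counts the walk's vertices strictly between x and y. An edge has empty interior,
    -- which no set blocks, so richness counts as a defect only from i = 1 on. The bound i < k
    -- exempts remote pairs. With `suc k` for `k`, as used later, these include the root u and the
    -- far end of a leg.
    Bad : ℕ → V → V → Set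
    Bad i x y = i < k × (x ≡ y ⊎ (1 ≤ i × Rich (b i) i x y))

    bad? : ∀ i x y → Dec (Bad i x y)
    bad? i x y = (i <? k) ×-dec ((x Fin.≟ y) ⊎-dec ((1 ≤? i) ×-dec rich? (b i) i x y))

    Clear : ℕ → V → List V → Set
    Clear i x []       = ⊤
    Clear i x (y ∷ ys) = ¬ Bad i x y × Clear (suc i) x ys

    Good : List V → Set
    Good []       = ⊤
    Good (x ∷ xs) = Clear 0 x xs × Good xs

    clear? : ∀ i x ys → Dec (Clear i x ys)
    clear? i x []       = yes tt
    clear? i x (y ∷ ys) = ¬? (bad? i x y) ×-dec clear? (suc i) x ys

    good? : ∀ xs → Dec (Good xs)
    good? []       = yes tt
    good? (x ∷ xs) = clear? 0 x xs ×-dec good? xs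

    clear-prefix : ∀ i x ys {zs} → Clear i x (ys ++ zs) → Clear i x ys
    clear-prefix i x []       _        = tt
    clear-prefix i x (y ∷ ys) (¬b , c) = ¬b , clear-prefix (suc i) x ys c

    clear-at : ∀ i x ys {y zs} → Clear i x (ys ++ y ∷ zs) → ¬ Bad (i + length ys) x y
    clear-at i x []       {y} (¬b , _) = subst (λ j → ¬ Bad j x y) (sym (+-identityʳ i)) ¬b
    clear-at i x (_ ∷ ys) {y} (_ , c)  =
      subst (λ j → ¬ Bad j x y) (sym (+-suc i (length ys))) (clear-at (suc i) x ys c)

    good-prefix : ∀ xs {ys} → Good (xs ++ ys) → Good xs
    good-prefix []       _       = tt
    good-prefix (x ∷ xs) (c , g) = clear-prefix 0 x xs c , good-prefix xs g

    good-suffix : ∀ xs {ys} → Good (xs ++ ys) → Good ys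
    good-suffix []       g       = g
    good-suffix (_ ∷ xs) (_ , g) = good-suffix xs g

    clear-≢ : ∀ i x ys → Clear i x ys → i + length ys ≤ k → All (x ≢_) ys
    clear-≢ i x []       _        _  = []
    clear-≢ i x (y ∷ ys) (¬b , c) le =
      (λ x≡y → ¬b (≤-trans (s≤s (m≤m+n i (length ys))) le′ , inj₁ x≡y)) ∷ clear-≢ (suc i) x ys c le′
      where le′ = ≤-trans (≤-reflexive (sym (+-suc i (length ys)))) le

    good-unique : ∀ xs → Good xs → length xs ≤ suc k → Unique xs
    good-unique []       _       _        = []
    good-unique (x ∷ xs) (c , g) (s≤s le) =
      clear-≢ 0 x xs c le ∷ good-unique xs g (≤-trans le (n≤1+n k))

    -- A good path is not between rich endpoints, hence it meets the set which blocks all such paths.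
    module Cover (f : ℕ → ℕ) (1≤f0 : 1 ≤ f 0) (f-mono : ∀ {i j} → i ≤ j → f i ≤ f j)
                 (f-step : ∀ i → b (suc i) * (suc i * (f i * f i)) ≤ f (suc i)) where

      IsCover : ℕ → V → V → List (List V) → Set
      IsCover i x y Ls = ∀ q → length q ≡ i → Linked _~_ (x ∷ q ∷ʳ y) → Good (x ∷ q ∷ʳ y) → q ∈ Ls

      private
        length-product : ∀ {A B C : Set} (h : A → B → C) xs ys →
                         length (cartesianProductWith h xs ys) ≡ length xs * length ys
        length-product h []       ys = refl
        length-product h (x ∷ xs) ys = trans (length-++ (map (h x) ys))
          (cong₂ _+_ (length-map (h x) ys) (length-product h xs ys))

      -- Strong induction on `i`, made structural by `m`. The factors of `f-step` are the choices
      -- for the blocking vertex a, for its position on the path, and for the two good halves, which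
      -- have j and i - j interior vertices.
      cover : ∀ m i → i ≤ m → i < k → ∀ x y → ∃[ Ls ] length Ls ≤ f i × IsCover i x y Ls
      cover m zero _ _ x y = [] ∷ [] , 1≤f0 , λ { [] _ _ _ → here refl }
      cover (suc m) (suc i) (s≤s i≤m) i<k x y with rich-or-blocked (b (suc i)) (suc i) x y
      ... | inj₁ rich = [] , z≤n , λ q eq _ (c , _) →
        contradiction (subst (_< k) (sym eq) i<k , inj₂ (subst (1 ≤_) (sym eq) (s≤s z≤n)
                        , subst (λ j → Rich (b j) j x y) (sym eq) rich))
                      (clear-at 0 x q c)
      ... | inj₂ (Used , small , blocks) = Ls , length-Ls , covers
        where
        j≤m : (j : Fin (suc i)) → toℕ j ≤ m
        j≤m j = ≤-trans (toℕ≤pred[n] j) i≤m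
        i∸j≤m : (j : Fin (suc i)) → i ∸ toℕ j ≤ m
        i∸j≤m j = ≤-trans (m∸n≤m i (toℕ j)) i≤m
        before : ∀ a (j : Fin (suc i)) → ∃[ Ls ] length Ls ≤ f (toℕ j) × IsCover (toℕ j) x a Ls
        before a j = cover m (toℕ j) (j≤m j) (≤-trans (s≤s (toℕ≤pred[n] j)) (<⇒≤ i<k)) x a
        after : ∀ a (j : Fin (suc i)) → ∃[ Ls ] length Ls ≤ f (i ∸ toℕ j) × IsCover (i ∸ toℕ j) a y Ls
        after a j = cover m (i ∸ toℕ j) (i∸j≤m j) (≤-trans (s≤s (m∸n≤m i (toℕ j))) (<⇒≤ i<k)) a y
        through : V → Fin (suc i) → List (List V)
        through a j = cartesianProductWith (λ q₁ q₂ → q₁ ++ a ∷ q₂) (proj₁ (before a j)) (proj₁ (after a j))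
        via : V → List (List V)
        via a = concatMap (through a) (allFin (suc i))
        Ls = concatMap via Used
        length-through : ∀ a j → length (through a j) ≤ f i * f i
        length-through a j = ≤-trans
          (≤-reflexive (length-product _ (proj₁ (before a j)) (proj₁ (after a j))))
          (*-mono-≤ (≤-trans (proj₁ (proj₂ (before a j))) (f-mono (toℕ≤pred[n] j)))
                    (≤-trans (proj₁ (proj₂ (after a j))) (f-mono (m∸n≤m i (toℕ j)))))
        length-Ls : length Ls ≤ f (suc i)
        length-Ls = ≤-trans (length-concatMap-≤ via Used (suc i * (f i * f i)) (λ a →
            ≤-trans (length-concatMap-≤ (through a) (allFin (suc i)) (f i * f i) (length-through a))
                    (≤-reflexive (cong (_* (f i * f i)) (length-tabulate {n = suc i} id)))))
          (≤-trans (*-monoˡ-≤ (suc i * (f i * f i)) small) (f-step i))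
        covers : IsCover (suc i) x y Ls
        covers q eq linked good
          with blocks q (eq , linked , AllPairs.tail unique-x∷q)
          where
          unique-x∷q : Unique (x ∷ q)
          unique-x∷q = good-unique (x ∷ q) (good-prefix (x ∷ q) good)
                         (s≤s (≤-trans (≤-reflexive eq) (<⇒≤ i<k)))
        ... | a , a∈q , a∈Used with q₁ , q₂ , refl ← ∈-∃++ a∈q =
          ∈-concatMap⁺ via (lose a∈Used (∈-concatMap⁺ (through a) (lose (∈-allFin j)
            (∈-cartesianProductWith⁺ (λ q₁ q₂ → q₁ ++ a ∷ q₂)
              (proj₂ (proj₂ (before a j)) q₁ (sym toℕ-j) (linked-prefix (x ∷ q₁) linked′)
                (good-prefix (x ∷ q₁ ∷ʳ a) (subst (λ p → Good (x ∷ p)) (sym (++-assoc q₁ (a ∷ []) (q₂ ∷ʳ y))) good′)))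
              (proj₂ (proj₂ (after a j)) q₂ length-q₂ (linked-suffix (x ∷ q₁) linked′)
                (good-suffix (x ∷ q₁) good′))))))
          where
          assoc : (q₁ ++ a ∷ q₂) ∷ʳ y ≡ q₁ ++ a ∷ (q₂ ∷ʳ y)
          assoc = ++-assoc q₁ (a ∷ q₂) (y ∷ [])
          linked′ = subst (λ p → Linked _~_ (x ∷ p)) assoc linked
          good′ = subst (λ p → Good (x ∷ p)) assoc good
          total : length q₁ + length q₂ ≡ i
          total = suc-injective (trans (sym (+-suc (length q₁) (length q₂))) (trans (sym (length-++ q₁)) eq))
          q₁<i : length q₁ < suc i
          q₁<i = s≤s (≤-trans (m≤m+n _ (length q₂)) (≤-reflexive total))
          j = fromℕ< q₁<i
          toℕ-j : toℕ j ≡ length q₁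
          toℕ-j = toℕ-fromℕ< q₁<i
          length-q₂ : length q₂ ≡ i ∸ toℕ j
          length-q₂ = trans (sym (m+n∸m≡n (length q₁) (length q₂))) (cong₂ _∸_ total (sym toℕ-j))

-- Fans from rich pairs

∷ʳ-∈ : ∀ {A : Set} (xs : List A) {x y} → y ∈ xs ∷ʳ x → y ∈ xs ⊎ y ≡ x
∷ʳ-∈ xs y∈ with ∈-++⁻ xs y∈
... | inj₁ y∈xs        = inj₁ y∈xs
... | inj₂ (here refl) = inj₂ refl

unique-∷ʳ : ∀ {A : Set} {xs : List A} {x} → Unique xs → x ∉ xs → Unique (xs ∷ʳ x)
unique-∷ʳ unique x∉ = Unique.++⁺ unique ([] ∷ []) λ { (y∈xs , here refl) → x∉ y∈xs }

module _ {n : ℕ} where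

  private
    V = Fin n

  fresh-many : ∀ s {xs} → Unique xs → ∀ (Used : List V) → length Used + s ≤ length xs →
    Σ[ ws ∈ (Fin s → V) ] (∀ j → ws j ∈ xs) × (∀ j → ws j ∉ Used) ×
                          (∀ {j j′} → j ≢ j′ → ws j ≢ ws j′)
  fresh-many zero    unique Used le = (λ ()) , (λ ()) , (λ ()) , λ { {()} }
  fresh-many (suc s) {xs} unique Used le
    with x , x∈ , x∉ ← fresh Fin._≟_ unique Used
           (≤-trans (s≤s (m≤m+n (length Used) s)) (≤-trans (≤-reflexive (sym (+-suc _ s))) le))
    with ws , ws∈ , ws∉ , distinct ← fresh-many s unique (x ∷ Used)
           (≤-trans (≤-reflexive (sym (+-suc _ s))) le)
    = (λ { zero → x ; (suc j) → ws j }) , (λ { zero → x∈ ; (suc j) → ws∈ j })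
    , (λ { zero → x∉ ; (suc j) → ws∉ j ∘ there })
    , λ { {zero} {zero} ne _ → ne refl
        ; {zero} {suc j} _ eq → ws∉ j (here (sym eq))
        ; {suc j} {zero} _ eq → ws∉ j (here eq)
        ; {suc j} {suc j′} ne → distinct (ne ∘ cong suc) }

  record CommonNeighbours (R : V → V → Set) (c T : ℕ) (vs Y : List V) : Set where
    field
      hubs          : List V
      common        : List V
      unique-hubs   : Unique hubs
      length-hubs   : length hubs ≡ T
      hubs⊆         : ∀ {v} → v ∈ hubs → v ∈ vs
      unique-common : Unique common
      common⊆       : ∀ {y} → y ∈ common → y ∈ Y
      large         : length Y ≤ c ^ T * length common
      related       : ∀ {v y} → v ∈ hubs → y ∈ common → R v y

  -- The hubs are chosen greedily, each related to a fraction 1 / c of the remaining elements of Y.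
  common-neighbours : ∀ {R : V → V → Set} (R? : ∀ x y → Dec (R x y)) c L T {vs Y} →
    Unique vs → length vs ≤ L → 1 ≤ L → Unique Y → 1 ≤ length Y →
    (∀ {y} → y ∈ Y → L ≤ c * (∑ vs (λ v → χ (R? v y)) ∸ T)) →
    CommonNeighbours R c T vs Y
  common-neighbours R? c L zero {vs} {Y} _ _ _ uniqueY _ _ = record
    { hubs = [] ; common = Y ; unique-hubs = [] ; length-hubs = refl ; hubs⊆ = λ ()
    ; unique-common = uniqueY ; common⊆ = id ; large = ≤-reflexive (sym (+-identityʳ _))
    ; related = λ () }
  common-neighbours {R} R? c L (suc T) {vs} {Y} uniqueV vs≤L 1≤L uniqueY 1≤Y rich =
    -- Exceeding |Y| - 1 means reaching |Y|: the pigeonhole principle is strict, and this gives a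
    -- hub related to at least |Y| / c elements of `Y`.
    finish (pigeonhole-∑ vs {λ v → c * ∑ Y (λ y → χ (R? v y))} (length Y ∸ 1) many)
    where
    open ≤-Reasoning
    many : length vs * (length Y ∸ 1) < ∑ vs (λ v → c * ∑ Y (λ y → χ (R? v y)))
    many = begin-strict
      length vs * (length Y ∸ 1)                     ≤⟨ *-monoˡ-≤ (length Y ∸ 1) vs≤L ⟩
      L * (length Y ∸ 1)                             <⟨ step L (length Y) 1≤L 1≤Y ⟩
      length Y * L
        ≤⟨ ∑-≥ Y L (λ y∈ → ≤-trans (rich y∈) (*-monoʳ-≤ c (m∸n≤m _ (suc T)))) ⟩
      ∑ Y (λ y → c * ∑ vs (λ v → χ (R? v y)))        ≡⟨ ∑-*ˡ c Y _ ⟩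
      c * ∑ Y (λ y → ∑ vs (λ v → χ (R? v y)))        ≡⟨ cong (c *_) (∑-swap Y vs _) ⟩
      c * ∑ vs (λ v → ∑ Y (λ y → χ (R? v y)))        ≡⟨ ∑-*ˡ c vs _ ⟨
      ∑ vs (λ v → c * ∑ Y (λ y → χ (R? v y)))        ∎
      where
      step : ∀ a b → 1 ≤ a → 1 ≤ b → a * (b ∸ 1) < b * a
      step a (suc b) 1≤a _ = ≤-trans (+-monoˡ-≤ (a * b) 1≤a) (≤-reflexive (cong (a +_) (*-comm a b)))
    finish : (∃[ v ] v ∈ vs × length Y ∸ 1 < c * ∑ Y (λ y → χ (R? v y))) →
             CommonNeighbours R c (suc T) vs Y
    finish (hub , hub∈ , Y₁<) = record
      { hubs          = hub ∷ hubs
      ; common        = common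
      ; unique-hubs   =
          All.tabulate (λ x∈ hub≡x → proj₂ (∈-filter⁻ (¬? ∘ (Fin._≟ hub)) {xs = vs} (hubs⊆ x∈)) (sym hub≡x))
          ∷ unique-hubs
      ; length-hubs   = cong suc length-hubs
      ; hubs⊆         = λ { (here refl) → hub∈ ; (there x∈) → proj₁ (∈-filter⁻ (¬? ∘ (Fin._≟ hub)) (hubs⊆ x∈)) }
      ; unique-common = unique-common
      ; common⊆       = λ y∈ → proj₁ (∈-filter⁻ (R? hub) (common⊆ y∈))
      ; large         = begin
          length Y                               ≤⟨ Y≤cY₁ ⟩
          c * length Y₁                          ≤⟨ *-monoʳ-≤ c large ⟩
          c * (c ^ T * length common)            ≡⟨ *-assoc c (c ^ T) (length common) ⟨
          c * c ^ T * length common              ∎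
      ; related       = λ { (here refl) y∈ → proj₂ (∈-filter⁻ (R? hub) {xs = Y} (common⊆ y∈))
                          ; (there x∈) y∈ → related x∈ y∈ }
      }
      where
      Y₁ = filter (R? hub) Y
      Y≤cY₁ : length Y ≤ c * length Y₁
      Y≤cY₁ = begin
        length Y                             ≡⟨ m∸n+n≡m 1≤Y ⟨
        length Y ∸ 1 + 1                     ≡⟨ +-comm _ 1 ⟩
        suc (length Y ∸ 1)                   ≤⟨ Y₁< ⟩
        c * ∑ Y (λ y → χ (R? hub y))           ≡⟨ cong (c *_) (length-filter-∑ (R? hub) Y) ⟨
        c * length Y₁                        ∎
      1≤Y₁ : 1 ≤ length Y₁
      1≤Y₁ with length Y₁ | Y≤cY₁
      ... | zero  | le = contradiction (≤-trans 1≤Y (≤-trans le (≤-reflexive (*-zeroʳ c)))) λ ()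
      ... | suc _ | _  = s≤s z≤n
      -- Removing the hub costs `y` at most one related vertex, which is exactly the drop from
      -- `suc T` to `T` in the reserve.
      rich′ : ∀ {y} → y ∈ Y₁ → L ≤ c * (∑ (remove hub vs) (λ x → χ (R? x y)) ∸ T)
      rich′ {y} y∈ = begin
        L                                                              ≤⟨ rich (proj₁ (∈-filter⁻ (R? hub) y∈)) ⟩
        c * (∑ vs (λ x → χ (R? x y)) ∸ suc T)
          ≤⟨ *-monoʳ-≤ c (∸-monoˡ-≤ (suc T) (≤-trans (∑-remove uniqueV hub (λ x → χ (R? x y)))
                                                     (+-monoˡ-≤ _ (χ≤1 (R? hub y))))) ⟩
        c * (∑ (remove hub vs) (λ x → χ (R? x y)) ∸ T)                   ∎
      open CommonNeighbours (common-neighbours R? c L T {remove hub vs} {Y₁}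
        (Unique.filter⁺ _ uniqueV) (≤-trans (length-filter _ vs) vs≤L) 1≤L
        (Unique.filter⁺ _ uniqueY) 1≤Y₁ rich′)

-- Bipartite subgraphs of large minimum degree

module BipartiteCore {n : ℕ} (G : Graph (Fin n)) where
  open EdgeDensity G

  cross-remove : ∀ {W} → Unique W → ∀ y A → cross W A ≤ degree A y + cross (remove y W) A
  cross-remove unique y A = ∑-remove unique y (degree A)

  record Core (b : ℕ) (W A : List (Fin n)) : Set where
    field
      W′ A′      : List (Fin n)
      W′⊆        : ∀ {y} → y ∈ W′ → y ∈ W
      unique-W′  : Unique W′
      unique-A′  : Unique A′
      degree-W′  : ∀ {y} → y ∈ W′ → b ≤ degree A′ y
      degree-A′  : ∀ {a} → a ∈ A′ → b ≤ degree W′ a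
      nonempty   : 1 ≤ length W′

  -- Deleting a vertex with fewer than `b` neighbours on the other side preserves the density
  -- inequality, so the process stops with a nonempty core. `W` and `A` may overlap, as legs are
  -- kept simple by avoiding used vertices rather than by the two sides.
  core : ∀ b fuel {W A} → length W + length A ≤ fuel → Unique W → Unique A →
         b * (length W + length A) < cross W A → Core b W A
  core b fuel {W} {A} le unique-W unique-A dense
    with any? (λ y → degree A y <? b) W | any? (λ a → degree W a <? b) A
  core b fuel {W} {A} le unique-W unique-A dense | no ¬low | no ¬low′ = record
    { W′ = W ; A′ = A ; W′⊆ = id ; unique-W′ = unique-W ; unique-A′ = unique-A
    ; degree-W′ = λ y∈ → ≮⇒≥ (λ lt → ¬low (lose y∈ lt))
    ; degree-A′ = λ a∈ → ≮⇒≥ (λ lt → ¬low′ (lose a∈ lt))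
    ; nonempty = nonempty W dense }
    where
    nonempty : ∀ W → b * (length W + length A) < cross W A → 1 ≤ length W
    nonempty (_ ∷ _) _ = s≤s z≤n
  core b zero {[]} {[]} le unique-W unique-A dense | yes () | _
  core b zero {[]} {[]} le unique-W unique-A dense | no _ | yes ()
  core b (suc fuel) {W} {A} le unique-W unique-A dense | yes low | _
    with y , y∈ , lt ← find low = record
      { W′ = W′ ; A′ = A′ ; W′⊆ = λ z∈ → proj₁ (∈-filter⁻ (¬? ∘ (Fin._≟ y)) (W′⊆ z∈))
      ; unique-W′ = unique-W′ ; unique-A′ = unique-A′
      ; degree-W′ = degree-W′ ; degree-A′ = degree-A′ ; nonempty = nonempty }
      where
      shorter : length (remove y W) < length W
      shorter = filter-notAll (¬? ∘ (Fin._≟ y)) W (Any.map (λ { refl ¬p → ¬p refl }) y∈)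
      open ≤-Reasoning
      dense′ : b * (length (remove y W) + length A) < cross (remove y W) A
      dense′ = +-cancelˡ-< b _ _ (begin-strict
        b + b * (length (remove y W) + length A)    ≡⟨ *-suc b _ ⟨
        b * suc (length (remove y W) + length A)    ≤⟨ *-monoʳ-≤ b (+-monoˡ-≤ (length A) shorter) ⟩
        b * (length W + length A)                   <⟨ dense ⟩
        cross W A                                   ≤⟨ cross-remove unique-W y A ⟩
        degree A y + cross (remove y W) A           ≤⟨ +-monoˡ-≤ _ (<⇒≤ lt) ⟩
        b + cross (remove y W) A                    ∎)
      open Core (core b fuel (≤-pred (≤-trans (+-monoˡ-≤ (length A) shorter) le))
                   (Unique.filter⁺ _ unique-W) unique-A dense′)
  core b (suc fuel) {W} {A} le unique-W unique-A dense | no _ | yes low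
    with a , a∈ , lt ← find low = record
      { W′ = W′ ; A′ = A′ ; W′⊆ = W′⊆
      ; unique-W′ = unique-W′ ; unique-A′ = unique-A′
      ; degree-W′ = degree-W′ ; degree-A′ = degree-A′ ; nonempty = nonempty }
      where
      shorter : length (remove a A) < length A
      shorter = filter-notAll (¬? ∘ (Fin._≟ a)) A (Any.map (λ { refl ¬p → ¬p refl }) a∈)
      open ≤-Reasoning
      dense′ : b * (length W + length (remove a A)) < cross W (remove a A)
      dense′ = +-cancelˡ-< b _ _ (begin-strict
        b + b * (length W + length (remove a A))    ≡⟨ *-suc b _ ⟨
        b * suc (length W + length (remove a A))    ≡⟨ cong (b *_) (+-suc (length W) _) ⟨
        b * (length W + suc (length (remove a A)))  ≤⟨ *-monoʳ-≤ b (+-monoʳ-≤ (length W) shorter) ⟩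
        b * (length W + length A)                   <⟨ dense ⟩
        cross W A                                   ≡⟨ cross-sym W A ⟩
        cross A W                                   ≤⟨ cross-remove unique-A a W ⟩
        degree W a + cross (remove a A) W           ≡⟨ cong (degree W a +_) (cross-sym (remove a A) W) ⟩
        degree W a + cross W (remove a A)           ≤⟨ +-monoˡ-≤ _ (<⇒≤ lt) ⟩
        b + cross W (remove a A)                    ∎)
      open Core (core b fuel (≤-pred (≤-trans (≤-reflexive (sym (+-suc (length W) _)))
                                (≤-trans (+-monoʳ-≤ (length W) shorter) le)))
                   unique-W (Unique.filter⁺ _ unique-A) dense′)

-- Greedy construction of legs and fans

module Legs {n : ℕ} (G : Graph (Fin n)) where
  open Graph G
  open EdgeDensity G
  open Paths G

  neighbour : ∀ {b} X z Used → Unique X → length Used < b → b ≤ degree X z →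
              ∃[ y ] y ∈ X × z ~ y × y ∉ Used
  neighbour X z Used unique lt le
    with y , y∈ , y∉ ← fresh Fin._≟_ (Unique.filter⁺ (z ~?_) unique) Used
           (≤-trans lt (≤-trans le (≤-reflexive (sym (length-filter-∑ (z ~?_) X)))))
    with y∈X , z~y ← ∈-filter⁻ (z ~?_) {xs = X} y∈ = y , y∈X , z~y , y∉

  -- The old end `y` becomes an interior vertex, so the shorter path must avoid it; hence `y ∷ Used`
  -- in the hypothesis.
  extend : ∀ {i x y z Used} → Connected i x y (y ∷ Used) → y ~ z → y ∉ Used → Connected (suc i) x z Used
  extend {x = x} {y} (q , (eq , linked , unique) , disjoint) y~z y∉ =
    q ∷ʳ y
    , (trans (length-++ q) (trans (+-comm (length q) 1) (cong suc eq))
      , linked-∷ʳ (x ∷ q) linked y~z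
      , unique-∷ʳ unique (λ y∈q → disjoint (y∈q , here refl)))
    , λ (z∈ , z∈Used) → [ (λ z∈q → disjoint (z∈q , there z∈Used)) , (λ { refl → y∉ z∈Used }) ]′ (∷ʳ-∈ q z∈)

  disjoint-legs : ∀ {k} s x (ws : Fin s → V) Used b →
    (∀ j Used → length Used ≤ b → Connected k x (ws j) Used) → length Used + s * k ≤ b →
    Σ[ qs ∈ (Fin s → List V) ] (∀ j → Path k x (ws j) (qs j)) × (∀ j → Disjoint (qs j) Used) ×
      (∀ {j j′} → j ≢ j′ → Disjoint (qs j) (qs j′))
  disjoint-legs zero x ws Used b _ _ = (λ ()) , (λ ()) , (λ ()) , λ { {()} }
  disjoint-legs {k} (suc s) x ws Used b connected le = qs , paths , avoids , disjoint
    where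
    first = connected zero Used (≤-trans (m≤m+n _ _) le)
    q₀ = proj₁ first
    rest = disjoint-legs s x (ws ∘ suc) (q₀ ++ Used) b (connected ∘ suc) (≤-trans (≤-reflexive (trans
      (cong (_+ s * k) (trans (length-++ q₀) (trans (cong (_+ length Used) (proj₁ (proj₁ (proj₂ first))))
                                                     (+-comm k (length Used)))))
      (+-assoc (length Used) k (s * k)))) le)
    qs : Fin (suc s) → List V
    qs zero    = q₀
    qs (suc j) = proj₁ rest j
    paths : ∀ j → Path k x (ws j) (qs j)
    paths zero    = proj₁ (proj₂ first)
    paths (suc j) = proj₁ (proj₂ rest) j
    avoids-rest : ∀ j → Disjoint (qs (suc j)) (q₀ ++ Used)
    avoids-rest = proj₁ (proj₂ (proj₂ rest))
    avoids : ∀ j → Disjoint (qs j) Used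
    avoids zero    = proj₂ (proj₂ first)
    avoids (suc j) (z∈ , z∈Used) = avoids-rest j (z∈ , ∈-++⁺ʳ q₀ z∈Used)
    disjoint : ∀ {j j′} → j ≢ j′ → Disjoint (qs j) (qs j′)
    disjoint {zero}  {zero}   ne _ = ne refl
    disjoint {zero}  {suc j′} _ (z∈ , z∈′) = avoids-rest j′ (z∈′ , ∈-++⁺ˡ z∈)
    disjoint {suc j} {zero}   _ (z∈ , z∈′) = avoids-rest j (z∈ , ∈-++⁺ˡ z∈′)
    disjoint {suc j} {suc j′} ne = proj₂ (proj₂ (proj₂ rest)) (ne ∘ cong suc)

  -- The budget counts what a new leg has to avoid: u₀ and v₀, the `s` roots, `Used`, and at most
  -- `s` earlier legs with `k` interior vertices each.
  connected-fan : ∀ {s k u₀ v₀ ws Used} b → u₀ ~ v₀ → (∀ {j j′} → j ≢ j′ → ws j ≢ ws j′) →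
    (∀ j → ws j ≢ u₀) → v₀ ∉ tabulate ws → v₀ ∉ Used →
    (∀ j Used → length Used ≤ b → Connected k v₀ (ws j) Used) →
    2 + s + length Used + s * k ≤ b → Fan G s k u₀ v₀ ws Used
  connected-fan {s} {k} {u₀} {v₀} {ws} {Used} b u~v distinct ws≢u v∉ws v∉Used connected le
    with qs , paths , avoids , disjoint ← disjoint-legs s v₀ ws (u₀ ∷ v₀ ∷ tabulate ws ++ Used) b connected
      (≤-trans (≤-reflexive (cong (λ l → 2 + l + s * k)
        (trans (length-++ (tabulate ws)) (cong (_+ length Used) (length-tabulate ws))))) le) =
    record
    { qs = qs ; length-qs = λ j → proj₁ (paths j) ; root-edge = u~v
    ; linked = λ j → proj₁ (proj₂ (paths j))
    ; u∉ = λ j u∈ → [ (λ u∈q → avoids j (u∈q , here refl)) , (λ u≡w → ws≢u j (sym u≡w)) ]′ (∷ʳ-∈ (qs j) u∈)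
    ; v∉ = λ j v∈ → [ (λ v∈q → avoids j (v∈q , there (here refl)))
                    , (λ v≡w → v∉ws (subst (_∈ tabulate ws) (sym v≡w) (∈-tabulate⁺ j))) ]′ (∷ʳ-∈ (qs j) v∈)
    ; unique = λ j → unique-∷ʳ (proj₂ (proj₂ (paths j))) (w∉ j j)
    ; disjoint = λ {j} {j′} ne (z∈ , z∈′) → meet ne (∷ʳ-∈ (qs j) z∈) (∷ʳ-∈ (qs j′) z∈′)
    ; v∉Used = v∉Used
    ; qs∉Used = λ j (z∈ , z∈Used) → avoids j (z∈ , there (there (∈-++⁺ʳ (tabulate ws) z∈Used)))
    }
    where
    w∉ : ∀ j j′ → ws j′ ∉ qs j
    w∉ j j′ w∈ = avoids j (w∈ , there (there (∈-++⁺ˡ (∈-tabulate⁺ j′))))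
    meet : ∀ {j j′} → j ≢ j′ → ∀ {z} → z ∈ qs j ⊎ z ≡ ws j → z ∈ qs j′ ⊎ z ≡ ws j′ → ⊥
    meet ne (inj₁ z∈)   (inj₁ z∈′)   = disjoint ne (z∈ , z∈′)
    meet ne (inj₁ z∈)   (inj₂ refl)  = w∉ _ _ z∈
    meet ne (inj₂ refl) (inj₁ z∈′)   = w∉ _ _ z∈′
    meet ne (inj₂ refl) (inj₂ w≡w′)  = distinct ne w≡w′

  -- From a vertex of the core every hub is reached by j steps inside the core, ending in W′, followed by
  -- one of the many paths from W′ to the hub.
  module _ {W A : List V} (b : ℕ) (bipartite : BipartiteCore.Core G (suc b) W A) where
    open BipartiteCore.Core bipartite

    -- The side on which an alternating walk that starts in `W′` arrives after j steps.
    side : ℕ → List V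
    side zero          = W′
    side (suc zero)    = A′
    side (suc (suc j)) = side j

    unique-side : ∀ j → Unique (side j)
    unique-side zero          = unique-W′
    unique-side (suc zero)    = unique-A′
    unique-side (suc (suc j)) = unique-side j

    degree-side : ∀ j {z} → z ∈ side (suc j) → suc b ≤ degree (side j) z
    degree-side zero          = degree-A′
    degree-side (suc zero)    = degree-W′
    degree-side (suc (suc j)) = degree-side j

    length-side : ∀ j → suc b ≤ length (side j)
    length-side zero with A′ in eq | length-side (suc zero)
    ... | a ∷ _ | _ = ≤-trans (degree-A′ (subst (a ∈_) (sym eq) (here refl))) (degree≤length W′ a)
    length-side (suc zero) = go W′ nonempty degree-W′
      where
      go : ∀ zs → 1 ≤ length zs → (∀ {y} → y ∈ zs → suc b ≤ degree A′ y) → suc b ≤ length A′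
      go (y ∷ _) _ deg = ≤-trans (deg (here refl)) (degree≤length A′ y)
    length-side (suc (suc j)) = length-side j

    -- The leg is built backwards from its root `z`. Each of the j steps adds one vertex to `Used`,
    -- and the rich path from the hub is chosen last, when everything it must avoid is known.
    connected-core : ∀ {i x} → (∀ {y} → y ∈ W′ → Rich b i x y) →
      ∀ j {z} → z ∈ side j → ∀ Used → length Used + j ≤ b → Connected (i + j) x z Used
    connected-core {i} {x} rich zero {z} z∈ Used le =
      subst (λ m → Connected m x z Used) (sym (+-identityʳ i)) (rich z∈ Used (≤-trans (m≤m+n _ 0) le))
    connected-core {i} {x} rich (suc j) {z} z∈ Used le
      with y , y∈ , z~y , y∉ ← neighbour (side j) z Used (unique-side j)
             (s≤s (≤-trans (m≤m+n _ (suc j)) le)) (degree-side j z∈) =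
      subst (λ m → Connected m x z Used) (sym (+-suc i j))
        (extend (connected-core rich j y∈ (y ∷ Used) (≤-trans (≤-reflexive (sym (+-suc _ j))) le))
                (~-sym z~y) y∉)

    -- The roots are fixed once in `side j`; every `Used` then gets its own hub, since there are
    -- more hubs than roots and used vertices together. Of the budget `b`, the part `j` is reserved
    -- for the steps inside the core.
    core-fans : ∀ {i} j s U u₀ (hubs : List V) → Unique hubs → suc b ≤ length hubs →
      (∀ {x} → x ∈ hubs → u₀ ~ x) → (∀ {x y} → x ∈ hubs → y ∈ W′ → Rich b i x y) →
      2 + s + U + s * (i + j) + j ≤ b →
      Σ[ ws ∈ (Fin s → V) ] ∀ Used → length Used ≤ U → ∃[ v₀ ] Fan G s (i + j) u₀ v₀ ws Used
    core-fans {i} j s U u₀ hubs unique-hubs many adjacent rich le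
      with ws , ws∈ , ws∉ , distinct ← fresh-many s (unique-side j) (u₀ ∷ [])
             (≤-trans (s≤s (≤-trans (m≤n+m s 2) (≤-trans (m≤m+n _ U)
               (≤-trans (m≤m+n _ (s * (i + j))) (≤-trans (m≤m+n _ j) le))))) (length-side j)) = ws , fan
      where
      too-few : ∀ Used → length Used ≤ U → length (tabulate ws ++ Used) ≤ b
      too-few Used small = begin
        length (tabulate ws ++ Used)          ≡⟨ length-++ (tabulate ws) ⟩
        length (tabulate ws) + length Used    ≡⟨ cong (_+ length Used) (length-tabulate ws) ⟩
        s + length Used                       ≤⟨ +-monoʳ-≤ s small ⟩
        s + U                                 ≤⟨ m≤n+m _ 2 ⟩
        2 + (s + U)                           ≤⟨ m≤m+n _ (s * (i + j)) ⟩
        2 + s + U + s * (i + j)               ≤⟨ m≤m+n _ j ⟩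
        2 + s + U + s * (i + j) + j           ≤⟨ le ⟩
        b                                     ∎
        where open ≤-Reasoning
      fan : ∀ Used → length Used ≤ U → ∃[ v₀ ] Fan G s (i + j) u₀ v₀ ws Used
      fan Used small = v₀ , connected-fan (b ∸ j) (adjacent v∈) distinct (λ m eq → ws∉ m (here eq))
          (v∉ ∘ ∈-++⁺ˡ) (v∉ ∘ ∈-++⁺ʳ (tabulate ws))
          (λ m Used′ le′ → connected-core (rich v∈) j (ws∈ m) Used′
            (≤-trans (+-monoˡ-≤ j le′) (≤-reflexive (m∸n+n≡m (≤-trans (m≤n+m j _) le)))))
          (m+n≤o⇒m≤o∸n _ (≤-trans (+-monoˡ-≤ j (+-monoˡ-≤ (s * (i + j)) (+-monoʳ-≤ (2 + s) small))) le))
        where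
        hub = fresh Fin._≟_ unique-hubs (tabulate ws ++ Used) (≤-trans (s≤s (too-few Used small)) many)
        v₀ = proj₁ hub
        v∈ = proj₁ (proj₂ hub)
        v∉ = proj₂ (proj₂ hub)

linked-last : ∀ {A : Set} {R : A → A → Set} xs {y z} → Linked R (xs ++ y ∷ z ∷ []) → R y z
linked-last []              (r ∷ _)  = r
linked-last (_ ∷ [])        (_ ∷ rs) = Linked.head rs
linked-last (_ ∷ xs@(_ ∷ _)) (_ ∷ rs) = linked-last xs rs

*-positiveʳ : ∀ m {n} → 1 ≤ m * n → 1 ≤ n
*-positiveʳ m {zero}  le = contradiction (≤-trans le (≤-reflexive (*-zeroʳ m))) λ ()
*-positiveʳ m {suc _} _  = s≤s z≤n

nonempty-∈ : ∀ {A : Set} (xs : List A) → 1 ≤ length xs → ∃[ x ] x ∈ xs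
nonempty-∈ (x ∷ _) _ = x , here refl

-- Fans from many common rich partners

module RichFans {n : ℕ} (G : Graph (Fin n)) (Δ : ℕ)
                (max-degree : ∀ x → length (filter (Graph._~?_ G x) (allFin n)) ≤ Δ) where
  open Graph G
  open EdgeDensity G
  open Paths G
  open Legs G

  neighbours : V → List V
  neighbours x = filter (x ~?_) (allFin n)

  ∈-neighbours : ∀ {x y} → x ~ y → y ∈ neighbours x
  ∈-neighbours {x} {y} x~y = ∈-filter⁺ (x ~?_) (∈-allFin y) x~y

  neighbours-∈ : ∀ {x y} → y ∈ neighbours x → x ~ y
  neighbours-∈ {x} y∈ = proj₂ (∈-filter⁻ (x ~?_) {xs = allFin n} y∈)

  unique-neighbours : ∀ x → Unique (neighbours x)
  unique-neighbours x = Unique.filter⁺ (x ~?_) (Unique.allFin⁺ n)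

  ends : ℕ → V → List V
  ends zero    x = x ∷ []
  ends (suc i) x = concatMap (ends i) (neighbours x)

  length-ends : ∀ i x → length (ends i x) ≤ Δ ^ i
  length-ends zero    x = ≤-refl
  length-ends (suc i) x = ≤-trans (length-concatMap-≤ (ends i) (neighbours x) (Δ ^ i) (length-ends i))
                                  (*-monoˡ-≤ (Δ ^ i) (max-degree x))

  ∈-ends : ∀ q {x y} → Linked _~_ (x ∷ q ∷ʳ y) → y ∈ ends (suc (length q)) x
  ∈-ends []      (x~y ∷ _)      = ∈-concatMap⁺ (ends 0) (lose (∈-neighbours x~y) (here refl))
  ∈-ends (z ∷ q) (x~z ∷ linked) = ∈-concatMap⁺ (ends (suc (length q))) (lose (∈-neighbours x~z) (∈-ends q linked))

  -- `ends` lists an endpoint once per walk. Filtering all vertices removes the repetitions and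
  -- keeps the bound Δ^i.
  reached : ℕ → V → List V
  reached i x = filter (λ a → _∈?_ Fin._≟_ a (ends i x)) (allFin n)

  length-reached : ∀ i x → length (reached i x) ≤ Δ ^ i
  length-reached i x = ≤-trans (≤-reflexive (length-filter-∑ _ (allFin n)))
    (≤-trans (∑-χ∈ Fin._≟_ (Unique.allFin⁺ n) (ends i x)) (length-ends i x))

  -- Otherwise the few last interior vertices of paths from x to y would meet all of these paths.
  rich-degree : ∀ {b i x y} → Rich b (suc i) x y → b < degree (reached (suc i) x) y
  rich-degree {b} {i} {x} {y} rich = subst (b <_) (length-filter-∑ (y ~?_) A) (≰⇒> few)
    where
    A = reached (suc i) x
    last-meets : ∀ q → length q ≡ suc i → Linked _~_ (x ∷ q ∷ʳ y) →
                 ¬ Disjoint q (filter (y ~?_) A)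
    last-meets q eq linked disjoint with initLast q
    last-meets .(q ∷ʳ a) eq linked disjoint | q ∷ʳ′ a =
      disjoint (∈-++⁺ʳ q (here refl) , ∈-filter⁺ (y ~?_)
        (∈-filter⁺ _ (∈-allFin a) (subst (λ l → a ∈ ends l x)
          (trans (+-comm 1 (length q)) (trans (sym (length-++ q)) eq))
          (∈-ends q (linked-prefix (x ∷ q) linked′))))
        (~-sym (linked-last (x ∷ q) linked′)))
      where
      linked′ : Linked _~_ (x ∷ q ++ a ∷ y ∷ [])
      linked′ = subst (λ p → Linked _~_ (x ∷ p)) (++-assoc q (a ∷ []) (y ∷ [])) linked
    few : ¬ length (filter (y ~?_) A) ≤ b
    few le with q , (eq , linked , _) , disjoint ← rich (filter (y ~?_) A) le =
      last-meets q eq linked disjoint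

  -- One hub suffices for the density of the bipartite graph: by `rich-degree` each vertex of `W`
  -- has more than `B` neighbours in `A`, while (b + 1) |A| ≤ c′ |W|, so c′ + b + 1 ≤ B gives more
  -- than (b + 1)(|W| + |A|) edges. The other hubs are needed as further centres.
  rich-fans : ∀ i j s U b B c c′ u₀ {Y} → Unique Y → 1 ≤ length Y → 1 ≤ Δ → 1 ≤ c →
    (∀ {y} → y ∈ Y → Δ ≤ c * (∑ (neighbours u₀) (λ x → χ (rich? B (suc i) x y)) ∸ suc b)) →
    suc b * Δ ^ suc i * c ^ suc b ≤ c′ * length Y → c′ + suc b ≤ B →
    2 + s + U + s * (suc i + j) + j ≤ b →
    Σ[ ws ∈ (Fin s → V) ] ∀ Used → length Used ≤ U → ∃[ v₀ ] Fan G s (suc i + j) u₀ v₀ ws Used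
  rich-fans i j s U b B c c′ u₀ {Y} unique-Y 1≤Y 1≤Δ 1≤c often large-Y c′≤B b-large =
    core-fans b bipartite j s U u₀ hubs unique-hubs (≤-reflexive (sym length-hubs))
      (neighbours-∈ ∘ hubs⊆) (λ x∈ y∈ Used le → related x∈ (BipartiteCore.Core.W′⊆ bipartite y∈) Used
        (≤-trans le (≤-trans (n≤1+n b) (≤-trans (m≤n+m (suc b) c′) c′≤B)))) b-large
    where
    open CommonNeighbours (common-neighbours (rich? B (suc i)) c Δ (suc b) (unique-neighbours u₀)
      (max-degree u₀) 1≤Δ unique-Y 1≤Y often)
    hub : ∃[ x ] x ∈ hubs
    hub = nonempty-∈ hubs (≤-trans (s≤s z≤n) (≤-reflexive (sym length-hubs)))
    W = common
    A = reached (suc i) (proj₁ hub)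
    open ≤-Reasoning
    1≤W : 1 ≤ length W
    1≤W = *-positiveʳ (c ^ suc b) (≤-trans 1≤Y large)
    few-reached : suc b * length A ≤ c′ * length W
    few-reached = *-cancelˡ (c ^ suc b) (^-positive 1≤c (suc b)) (begin
      c ^ suc b * (suc b * length A)       ≤⟨ *-monoʳ-≤ (c ^ suc b) (*-monoʳ-≤ (suc b) (length-reached (suc i) (proj₁ hub))) ⟩
      c ^ suc b * (suc b * Δ ^ suc i)      ≡⟨ *-comm (c ^ suc b) _ ⟩
      suc b * Δ ^ suc i * c ^ suc b        ≤⟨ large-Y ⟩
      c′ * length Y                        ≤⟨ *-monoʳ-≤ c′ large ⟩
      c′ * (c ^ suc b * length W)          ≡⟨ rotate c′ (c ^ suc b) (length W) ⟩
      c ^ suc b * (c′ * length W)          ∎)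
      where
      rotate : ∀ a b c → a * (b * c) ≡ b * (a * c)
      rotate = solve-∀
    dense : suc b * (length W + length A) < cross W A
    dense = begin-strict
      suc b * (length W + length A)                  ≡⟨ *-distribˡ-+ (suc b) (length W) (length A) ⟩
      suc b * length W + suc b * length A            ≤⟨ +-monoʳ-≤ _ few-reached ⟩
      suc b * length W + c′ * length W               ≡⟨ *-distribʳ-+ (length W) (suc b) c′ ⟨
      (suc b + c′) * length W                        ≤⟨ *-monoˡ-≤ (length W) (≤-trans (≤-reflexive (+-comm (suc b) c′)) c′≤B) ⟩
      B * length W                                   <⟨ +-monoˡ-≤ (B * length W) 1≤W ⟩
      suc B * length W                               ≡⟨ *-comm (suc B) (length W) ⟩
      length W * suc B                               ≤⟨ ∑-≥ W (suc B) (λ y∈ → rich-degree (related (proj₂ hub) y∈)) ⟩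
      cross W A                                      ∎
    bipartite : BipartiteCore.Core G (suc b) W A
    bipartite = BipartiteCore.core G (suc b) _ ≤-refl unique-common (Unique.filter⁺ _ (Unique.allFin⁺ n)) dense

-- Counting walks which are not good

module Walks {n : ℕ} (G : Graph (Fin n)) (Δ : ℕ)
             (max-degree : ∀ x → length (filter (Graph._~?_ G x) (allFin n)) ≤ Δ) where
  open Graph G
  open Paths G
  open RichFans G Δ max-degree

  all : List V
  all = allFin n

  -- The starting vertex x is omitted.
  walks : ℕ → V → List (List V)
  walks zero    x = [] ∷ []
  walks (suc m) x = concatMap (λ y → map (y ∷_) (walks m y)) (neighbours x)

  end : V → List V → V
  end x []      = x
  end x (y ∷ q) = end y q

  ∑-walks : ∀ m x (h : List V → ℕ) →
            ∑ (walks (suc m) x) h ≡ ∑ (neighbours x) (λ y → ∑ (walks m y) (λ q → h (y ∷ q)))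
  ∑-walks m x h = trans (∑-concatMap _ (neighbours x) h)
                        (∑-cong (neighbours x) (λ y → ∑-map (y ∷_) (walks m y) h))

  walks-∈ : ∀ m x {q} → q ∈ walks m x → length q ≡ m × Linked _~_ (x ∷ q)
  walks-∈ zero    x (here refl) = refl , [-]
  walks-∈ (suc m) x q∈
    with y , y∈ , q∈y ← find (∈-concatMap⁻ (λ y → map (y ∷_) (walks m y)) {xs = neighbours x} q∈)
    with q , q∈′ , refl ← ∈-map⁻ (y ∷_) q∈y
    with eq , linked ← walks-∈ m y q∈′ = cong suc eq , neighbours-∈ y∈ ∷ linked

  length-walks : ∀ m x → length (walks m x) ≤ Δ ^ m
  length-walks zero    x = ≤-refl
  length-walks (suc m) x = ≤-trans
    (length-concatMap-≤ _ (neighbours x) (Δ ^ m)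
      (λ y → ≤-trans (≤-reflexive (length-map (y ∷_) (walks m y))) (length-walks m y)))
    (*-monoˡ-≤ (Δ ^ m) (max-degree x))

  walks-≥ : ∀ {D} → (∀ x → D ≤ length (neighbours x)) → ∀ m x → D ^ m ≤ ∑ (walks m x) (λ _ → 1)
  walks-≥ min-degree zero    x = ≤-refl
  walks-≥ {D} min-degree (suc m) x = begin
    D * D ^ m                                          ≤⟨ *-monoˡ-≤ (D ^ m) (min-degree x) ⟩
    length (neighbours x) * D ^ m                      ≤⟨ ∑-≥ (neighbours x) (D ^ m) (λ {y} _ → walks-≥ min-degree m y) ⟩
    ∑ (neighbours x) (λ y → ∑ (walks m y) (λ _ → 1))   ≡⟨ ∑-walks m x (λ _ → 1) ⟨
    ∑ (walks (suc m) x) (λ _ → 1)                      ∎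
    where open ≤-Reasoning

  ∑-walks-≤ : ∀ m x {h : List V → ℕ} c → (∀ {q} → q ∈ walks m x → h q ≤ c) → ∑ (walks m x) h ≤ Δ ^ m * c
  ∑-walks-≤ m x c h≤c = ≤-trans (∑-≤ (walks m x) c h≤c) (*-monoˡ-≤ c (length-walks m x))

  ∑-walks-take : ∀ i r x (h : List V → ℕ) →
                 ∑ (walks (i + r) x) (λ q → h (take i q)) ≤ ∑ (walks i x) h * Δ ^ r
  ∑-walks-take zero    r x h = ≤-trans (∑-walks-≤ r x (h []) (λ _ → ≤-refl))
    (≤-reflexive (trans (*-comm (Δ ^ r) (h [])) (cong (_* Δ ^ r) (sym (+-identityʳ (h []))))))
  ∑-walks-take (suc i) r x h = begin
    ∑ (walks (suc i + r) x) (λ q → h (take (suc i) q))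
      ≡⟨ ∑-walks (i + r) x _ ⟩
    ∑ (neighbours x) (λ y → ∑ (walks (i + r) y) (λ q → h (y ∷ take i q)))
      ≤⟨ ∑-mono (neighbours x) (λ y → ∑-walks-take i r y (λ q → h (y ∷ q))) ⟩
    ∑ (neighbours x) (λ y → ∑ (walks i y) (λ q → h (y ∷ q)) * Δ ^ r)
      ≡⟨ ∑-*ʳ (Δ ^ r) (neighbours x) _ ⟩
    ∑ (neighbours x) (λ y → ∑ (walks i y) (λ q → h (y ∷ q))) * Δ ^ r
      ≡⟨ cong (_* Δ ^ r) (∑-walks i x h) ⟨
    ∑ (walks (suc i) x) h * Δ ^ r ∎
    where open ≤-Reasoning

  _≟ᴸ_ : (p q : List V) → Dec (p ≡ q)
  _≟ᴸ_ = ≡-dec Fin._≟_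

  -- The indicator of `y ∷ q ≡ a ∷ z` is the product of those for heads and tails, so the bound
  -- passes through the sum over the first step.
  walks-once : ∀ m x z → ∑ (walks m x) (λ q → χ (q ≟ᴸ z)) ≤ 1
  walks-once zero    x z       = ≤-trans (≤-reflexive (+-identityʳ _)) (χ≤1 ([] ≟ᴸ z))
  walks-once (suc m) x []      = ≤-trans (≤-reflexive (∑-walks m x _))
    (≤-trans (∑-mono (neighbours x) {g = λ _ → 0} (λ y → ≤-trans (∑-mono (walks m y) {g = λ _ → 0}
        (λ q → ≤-reflexive (χ-no ((y ∷ q) ≟ᴸ []) λ ())))
        (≤-reflexive (trans (∑-const (walks m y) 0) (*-zeroʳ (length (walks m y)))))))
      (≤-trans (≤-reflexive (trans (∑-const (neighbours x) 0) (*-zeroʳ (length (neighbours x))))) z≤n))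
  walks-once (suc m) x (a ∷ z) = begin
    ∑ (walks (suc m) x) (λ q → χ (q ≟ᴸ (a ∷ z)))
      ≡⟨ ∑-walks m x _ ⟩
    ∑ (neighbours x) (λ y → ∑ (walks m y) (λ q → χ ((y ∷ q) ≟ᴸ (a ∷ z))))
      ≤⟨ ∑-mono (neighbours x) (λ y → ∑-mono (walks m y) (λ q → χ-≤ ((y ∷ q) ≟ᴸ (a ∷ z))
           (λ { refl → ≤-reflexive (sym (cong₂ _*_ (χ-yes (y Fin.≟ y) refl) (χ-yes (q ≟ᴸ q) refl))) }))) ⟩
    ∑ (neighbours x) (λ y → ∑ (walks m y) (λ q → χ (y Fin.≟ a) * χ (q ≟ᴸ z)))
      ≡⟨ ∑-cong (neighbours x) (λ y → ∑-*ˡ (χ (y Fin.≟ a)) (walks m y) _) ⟩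
    ∑ (neighbours x) (λ y → χ (y Fin.≟ a) * ∑ (walks m y) (λ q → χ (q ≟ᴸ z)))
      ≤⟨ ∑-mono (neighbours x) (λ y → *-monoʳ-≤ (χ (y Fin.≟ a)) (walks-once m y z)) ⟩
    ∑ (neighbours x) (λ y → χ (y Fin.≟ a) * 1)
      ≡⟨ ∑-cong (neighbours x) (λ y → *-identityʳ (χ (y Fin.≟ a))) ⟩
    ∑ (neighbours x) (λ y → χ (y Fin.≟ a))
      ≤⟨ ∑-χ≡ Fin._≟_ (unique-neighbours x) a ⟩
    1 ∎
    where open ≤-Reasoning

  ∑-walks-cover : ∀ m x {P : List V → Set} (P? : ∀ q → Dec (P q)) Ls →
                  (∀ {q} → q ∈ walks m x → P q → q ∈ Ls) → ∑ (walks m x) (χ ∘ P?) ≤ length Ls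
  ∑-walks-cover m x P? Ls covers = ≤-trans
    (∑-mono-∈ (walks m x) (λ {q} q∈ → χ-mono (P? q) (_∈?_ _≟ᴸ_ q Ls) (covers q∈)))
    (∑-χ∈′ _≟ᴸ_ {walks m x} (walks-once m x) Ls)

  ∑-neighbours-swap : ∀ (g : V → V → ℕ) →
    ∑ all (λ x → ∑ (neighbours x) (g x)) ≡ ∑ all (λ y → ∑ (neighbours y) (λ x → g x y))
  ∑-neighbours-swap g = begin
    ∑ all (λ x → ∑ (neighbours x) (g x))              ≡⟨ ∑-cong all (λ x → ∑-filter (x ~?_) all (g x)) ⟩
    ∑ all (λ x → ∑ all (λ y → χ (x ~? y) * g x y))    ≡⟨ ∑-swap all all _ ⟩
    ∑ all (λ y → ∑ all (λ x → χ (x ~? y) * g x y))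
      ≡⟨ ∑-cong all (λ y → ∑-cong all (λ x → cong (_* g x y) (EdgeDensity.adj-sym G x y))) ⟩
    ∑ all (λ y → ∑ all (λ x → χ (y ~? x) * g x y))    ≡⟨ ∑-cong all (λ y → ∑-filter (y ~?_) all (λ x → g x y)) ⟨
    ∑ all (λ y → ∑ (neighbours y) (λ x → g x y))      ∎
    where open ≡-Reasoning

  ∑-neighbours-≤ : ∀ (g : V → ℕ) → ∑ all (λ x → ∑ (neighbours x) g) ≤ Δ * ∑ all g
  ∑-neighbours-≤ g = begin
    ∑ all (λ x → ∑ (neighbours x) g)              ≡⟨ ∑-neighbours-swap (λ _ → g) ⟩
    ∑ all (λ y → ∑ (neighbours y) (λ _ → g y))    ≡⟨ ∑-cong all (λ y → ∑-const (neighbours y) (g y)) ⟩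
    ∑ all (λ y → length (neighbours y) * g y)     ≤⟨ ∑-mono all (λ y → *-monoˡ-≤ (g y) (max-degree y)) ⟩
    ∑ all (λ y → Δ * g y)                         ≡⟨ ∑-*ˡ Δ all g ⟩
    Δ * ∑ all g                                   ∎
    where open ≤-Reasoning

  module BadWalks (k : ℕ) (β : ℕ → ℕ) where
    open Good k β

    At : ℕ → (V → Set) → List V → Set
    At i       P []      = ⊥
    At zero    P (y ∷ _) = P y
    At (suc i) P (_ ∷ q) = At i P q

    at? : ∀ i {P : V → Set} → (∀ y → Dec (P y)) → ∀ q → Dec (At i P q)
    at? i       P? []      = no λ ()
    at? zero    P? (y ∷ _) = P? y
    at? (suc i) P? (_ ∷ q) = at? i P? q

    at-take : ∀ i {P} q → At i P q → At i P (take (suc i) q)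
    at-take zero    (_ ∷ _) p = p
    at-take (suc i) (_ ∷ q) p = at-take i q p

    at-end : ∀ i {P} x q → length q ≡ i → At i P (x ∷ q) → P (end x q)
    at-end zero    x []      _  p = p
    at-end (suc i) x (y ∷ q) eq p = at-end i y q (suc-injective eq) p

    clear-from-at : ∀ j x q → (∀ (i : Fin (length q)) → ¬ At (toℕ i) (Bad (j + toℕ i) x) q) → Clear j x q
    clear-from-at j x []      _    = tt
    clear-from-at j x (y ∷ q) none =
      subst (λ m → ¬ Bad m x y) (+-identityʳ j) (none zero) ,
      clear-from-at (suc j) x q (λ i → subst (λ m → ¬ At (toℕ i) (Bad m x) q) (+-suc j (toℕ i)) (none (suc i)))

    badWalks : ℕ → V → ℕ
    badWalks m x = ∑ (walks m x) (λ q → χ (¬? (good? (x ∷ q))))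

    -- Walks x, y, …, z of i + 1 steps whose only bad pair is (x , z), counted by their second vertex y.
    barelyBad : ℕ → V → ℕ
    barelyBad i y = ∑ (neighbours y) (λ x → ∑ (walks i y) (λ q → χ (good? (y ∷ q) ×-dec bad? i x (end y q))))

    private
      barely : ∀ i x q → Dec (Good (take (suc i) q) × At i (Bad i x) (take (suc i) q))
      barely i x q = good? (take (suc i) q) ×-dec at? i (bad? i x) (take (suc i) q)

      -- If `q` is good and `x ∷ q` is not, then `x` forms a bad pair with some entry of `q`.
      -- Cutting `q` right after this entry leaves a good walk, as prefixes of good walks are good,
      -- and a union bound over the position follows.
      first-bad : ∀ x q → χ (¬? (good? (x ∷ q))) ≤
                  χ (¬? (good? q)) + ∑ (allFin (length q)) (λ i → χ (barely (toℕ i) x q))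
      first-bad x q = χ-≤ (¬? (good? (x ∷ q))) (positive (good? q) (search-Fin (length q) split))
        where
        split : ∀ i → At (toℕ i) (Bad (toℕ i) x) q ⊎ ¬ At (toℕ i) (Bad (toℕ i) x) q
        split i with at? (toℕ i) (bad? (toℕ i) x) q
        ... | yes p = inj₁ p
        ... | no ¬p = inj₂ ¬p
        positive : (g : Dec (Good q)) →
          (∃[ i ] At (toℕ i) (Bad (toℕ i) x) q) ⊎ (∀ i → ¬ At (toℕ i) (Bad (toℕ i) x) q) →
          ¬ Good (x ∷ q) → 1 ≤ χ (¬? g) + ∑ (allFin (length q)) (λ i → χ (barely (toℕ i) x q))
        positive (no _)  _ _ = s≤s z≤n
        positive (yes g) (inj₁ (i , at)) _ = ≤-trans
          (≤-reflexive (sym (χ-yes (barely (toℕ i) x q)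
            (good-prefix (take (suc (toℕ i)) q) (subst Good (sym (take++drop≡id (suc (toℕ i)) q)) g)
            , at-take (toℕ i) q at))))
          (∑-∈ (λ i → χ (barely (toℕ i) x q)) (∈-allFin i))
        positive (yes g) (inj₂ none) ¬good = contradiction (clear-from-at 0 x q none , g) ¬good

      -- The steps after the bad pair contribute Δ^(m - i). The first edge is then reversed, so that
      -- the sum runs over the second vertex y: this is the vertex that becomes the root u in the
      -- rich case, with the possible first vertices x as its hubs.
      barely-total : ∀ m (i : Fin (suc m)) →
        ∑ all (λ x → ∑ (walks (suc m) x) (λ q → χ (barely (toℕ i) x q))) ≤
        ∑ all (barelyBad (toℕ i)) * Δ ^ (m ∸ toℕ i)
      barely-total m i = begin
        ∑ all (λ x → ∑ (walks (suc m) x) (λ q → χ (barely (toℕ i) x q)))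
          ≡⟨ cong (λ l → ∑ all (λ x → ∑ (walks (suc l) x) (λ q → χ (barely (toℕ i) x q))))
               (sym (m+[n∸m]≡n (toℕ≤pred[n] i))) ⟩
        ∑ all (λ x → ∑ (walks (suc (toℕ i) + (m ∸ toℕ i)) x) (λ q → χ (barely (toℕ i) x q)))
          ≤⟨ ∑-mono all (λ x → ∑-walks-take (suc (toℕ i)) (m ∸ toℕ i) x
               (λ q → χ (good? q ×-dec at? (toℕ i) (bad? (toℕ i) x) q))) ⟩
        ∑ all (λ x → ∑ (walks (suc (toℕ i)) x) (λ q → χ (good? q ×-dec at? (toℕ i) (bad? (toℕ i) x) q)) * Δ ^ (m ∸ toℕ i))
          ≡⟨ ∑-*ʳ (Δ ^ (m ∸ toℕ i)) all _ ⟩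
        ∑ all (λ x → ∑ (walks (suc (toℕ i)) x) (λ q → χ (good? q ×-dec at? (toℕ i) (bad? (toℕ i) x) q))) * Δ ^ (m ∸ toℕ i)
          ≤⟨ *-monoˡ-≤ (Δ ^ (m ∸ toℕ i)) (∑-mono all (λ x → begin
              ∑ (walks (suc (toℕ i)) x) (λ q → χ (good? q ×-dec at? (toℕ i) (bad? (toℕ i) x) q))
                ≡⟨ ∑-walks (toℕ i) x _ ⟩
              ∑ (neighbours x) (λ y → ∑ (walks (toℕ i) y) (λ q →
                χ (good? (y ∷ q) ×-dec at? (toℕ i) (bad? (toℕ i) x) (y ∷ q))))
                ≤⟨ ∑-mono (neighbours x) (λ y → ∑-mono-∈ (walks (toℕ i) y) (λ {q} q∈ →
                     χ-mono (good? (y ∷ q) ×-dec at? (toℕ i) (bad? (toℕ i) x) (y ∷ q))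
                            (good? (y ∷ q) ×-dec bad? (toℕ i) x (end y q))
                            (λ (g , at) → g , at-end (toℕ i) y q (proj₁ (walks-∈ (toℕ i) y q∈)) at))) ⟩
              ∑ (neighbours x) (λ y → ∑ (walks (toℕ i) y) (λ q →
                χ (good? (y ∷ q) ×-dec bad? (toℕ i) x (end y q)))) ∎)) ⟩
        ∑ all (λ x → ∑ (neighbours x) (λ y → ∑ (walks (toℕ i) y) (λ q →
          χ (good? (y ∷ q) ×-dec bad? (toℕ i) x (end y q))))) * Δ ^ (m ∸ toℕ i)
          ≡⟨ cong (_* Δ ^ (m ∸ toℕ i)) (∑-neighbours-swap _) ⟩
        ∑ all (barelyBad (toℕ i)) * Δ ^ (m ∸ toℕ i) ∎
        where open ≤-Reasoning

    badWalks-suc : ∀ m → ∑ all (badWalks (suc m)) ≤ Δ * ∑ all (badWalks m) +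
                     ∑ (allFin (suc m)) (λ i → ∑ all (barelyBad (toℕ i)) * Δ ^ (m ∸ toℕ i))
    badWalks-suc m = begin
      ∑ all (badWalks (suc m))
        ≤⟨ ∑-mono all (λ x → ∑-mono-∈ (walks (suc m) x) (λ {q} q∈ → ≤-trans (first-bad x q)
             (≤-reflexive (cong (λ l → χ (¬? (good? q)) + ∑ (allFin l) (λ i → χ (barely (toℕ i) x q)))
               (proj₁ (walks-∈ (suc m) x q∈)))))) ⟩
      ∑ all (λ x → ∑ (walks (suc m) x) (λ q →
        χ (¬? (good? q)) + ∑ (allFin (suc m)) (λ i → χ (barely (toℕ i) x q))))
        ≡⟨ ∑-cong all (λ x → ∑-+ (walks (suc m) x) _ _) ⟩
      ∑ all (λ x → ∑ (walks (suc m) x) (λ q → χ (¬? (good? q))) +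
        ∑ (walks (suc m) x) (λ q → ∑ (allFin (suc m)) (λ i → χ (barely (toℕ i) x q))))
        ≡⟨ ∑-+ all _ _ ⟩
      ∑ all (λ x → ∑ (walks (suc m) x) (λ q → χ (¬? (good? q)))) +
      ∑ all (λ x → ∑ (walks (suc m) x) (λ q → ∑ (allFin (suc m)) (λ i → χ (barely (toℕ i) x q))))
        ≤⟨ +-mono-≤
            (≤-trans (≤-reflexive (∑-cong all (λ x → ∑-walks m x _))) (∑-neighbours-≤ (badWalks m)))
            (≤-reflexive (trans (∑-cong all (λ x → ∑-swap (walks (suc m) x) (allFin (suc m)) _))
                                (∑-swap all (allFin (suc m)) _))) ⟩
      Δ * ∑ all (badWalks m) +
      ∑ (allFin (suc m)) (λ i → ∑ all (λ x → ∑ (walks (suc m) x) (λ q → χ (barely (toℕ i) x q))))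
        ≤⟨ +-monoʳ-≤ (Δ * ∑ all (badWalks m)) (∑-mono (allFin (suc m)) (barely-total m)) ⟩
      Δ * ∑ all (badWalks m) +
      ∑ (allFin (suc m)) (λ i → ∑ all (barelyBad (toℕ i)) * Δ ^ (m ∸ toℕ i)) ∎
      where open ≤-Reasoning

    -- The recurrence adds m + 1 terms at stage m + 1, and m² + (m + 1) ≤ (m + 1)².
    badWalks-bound : ∀ {D e} → D ≤ Δ → (∀ i y → e * barelyBad i y ≤ D ^ suc i) →
                     ∀ m → e * ∑ all (badWalks m) ≤ m * m * (n * Δ ^ m)
    badWalks-bound {D} {e} D≤Δ few zero = ≤-reflexive (trans (cong (e *_) (trans
        (∑-cong all (λ x → trans (+-identityʳ _) (χ-no (¬? (good? (x ∷ []))) (λ ¬g → ¬g (tt , tt)))))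
        (trans (∑-const all 0) (*-zeroʳ (length all))))) (*-zeroʳ e))
    badWalks-bound {D} {e} D≤Δ few (suc m) = begin
      e * ∑ all (badWalks (suc m))
        ≤⟨ *-monoʳ-≤ e (badWalks-suc m) ⟩
      e * (Δ * ∑ all (badWalks m) + rest)
        ≡⟨ distrib e Δ (∑ all (badWalks m)) rest ⟩
      Δ * (e * ∑ all (badWalks m)) + e * rest
        ≤⟨ +-mono-≤ (*-monoʳ-≤ Δ (badWalks-bound {D} {e} D≤Δ few m)) rest≤ ⟩
      Δ * (m * m * (n * Δ ^ m)) + suc m * (n * Δ ^ suc m)
        ≤⟨ m≤m+n _ (m * (n * Δ ^ suc m)) ⟩
      Δ * (m * m * (n * Δ ^ m)) + suc m * (n * Δ ^ suc m) + m * (n * Δ ^ suc m)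
        ≡⟨ square Δ m n (Δ ^ m) ⟩
      suc m * suc m * (n * Δ ^ suc m) ∎
      where
      open ≤-Reasoning
      rest : ℕ
      rest = ∑ (allFin (suc m)) (λ i → ∑ all (barelyBad (toℕ i)) * Δ ^ (m ∸ toℕ i))
      distrib : ∀ e d a r → e * (d * a + r) ≡ d * (e * a) + e * r
      distrib = solve-∀
      square : ∀ d m n p → d * (m * m * (n * p)) + suc m * (n * (d * p)) + m * (n * (d * p)) ≡
                           suc m * suc m * (n * (d * p))
      square = solve-∀
      term≤ : ∀ (i : Fin (suc m)) → e * (∑ all (barelyBad (toℕ i)) * Δ ^ (m ∸ toℕ i)) ≤ n * Δ ^ suc m
      term≤ i = begin
        e * (∑ all (barelyBad (toℕ i)) * Δ ^ (m ∸ toℕ i))   ≡⟨ *-assoc e _ _ ⟨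
        e * ∑ all (barelyBad (toℕ i)) * Δ ^ (m ∸ toℕ i)
          ≡⟨ cong (_* Δ ^ (m ∸ toℕ i)) (∑-*ˡ e all _) ⟨
        ∑ all (λ y → e * barelyBad (toℕ i) y) * Δ ^ (m ∸ toℕ i)
          ≤⟨ *-monoˡ-≤ (Δ ^ (m ∸ toℕ i)) (∑-≤ all (Δ ^ suc (toℕ i))
               (λ {y} _ → ≤-trans (few (toℕ i) y) (^-monoˡ-≤ (suc (toℕ i)) D≤Δ))) ⟩
        length all * Δ ^ suc (toℕ i) * Δ ^ (m ∸ toℕ i)      ≡⟨ *-assoc (length all) _ _ ⟩
        length all * (Δ ^ suc (toℕ i) * Δ ^ (m ∸ toℕ i))
          ≡⟨ cong₂ _*_ (length-tabulate {n = n} id) (sym (^-distribˡ-+-* Δ (suc (toℕ i)) (m ∸ toℕ i))) ⟩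
        n * Δ ^ (suc (toℕ i) + (m ∸ toℕ i))
          ≡⟨ cong (λ l → n * Δ ^ suc l) (m+[n∸m]≡n (toℕ≤pred[n] i)) ⟩
        n * Δ ^ suc m ∎
      rest≤ : e * rest ≤ suc m * (n * Δ ^ suc m)
      rest≤ = begin
        e * rest                                                                ≡⟨ ∑-*ˡ e (allFin (suc m)) _ ⟨
        ∑ (allFin (suc m)) (λ i → e * (∑ all (barelyBad (toℕ i)) * Δ ^ (m ∸ toℕ i)))
          ≤⟨ ∑-≤ (allFin (suc m)) (n * Δ ^ suc m) (λ {i} _ → term≤ i) ⟩
        length (allFin (suc m)) * (n * Δ ^ suc m)
          ≡⟨ cong (_* (n * Δ ^ suc m)) (length-tabulate {n = suc m} id) ⟩
        suc m * (n * Δ ^ suc m) ∎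

-- Without fans, barely bad walks are rare

module FewBarelyBad {n : ℕ} (G : Graph (Fin n)) (D K : ℕ) (1≤D : 1 ≤ D) (1≤K : 1 ≤ K)
  (max-degree : ∀ x → length (filter (Graph._~?_ G x) (allFin n)) ≤ K * D)
  (k s U b e : ℕ) (1≤e : 1 ≤ e) (β f : ℕ → ℕ) where

  private
    Δ = K * D

    1≤Δ : 1 ≤ Δ
    1≤Δ = *-positive 1≤K 1≤D

  open Graph G
  open Paths G
  open RichFans G Δ max-degree
  open Walks G Δ max-degree
  open BadWalks (suc k) β
  open Good (suc k) β

  -- The 3 shares the error between walks that return to x, ends outside `Y` and ends in `Y`; K^k
  -- pays for replacing powers of Δ by powers of D. In `c`, the factor K replaces D by Δ, and the 2
  -- absorbs the `suc b` subtracted from `richDegree`.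
  c₁ c : ℕ
  c₁ = 3 * e * K ^ k
  c  = 2 * K * c₁

  -- The bracket consists of the factors which `few-Y` leaves on the right-hand side; cancelling
  -- them gives `3eKf|Y|≤`.
  c′ : ℕ → ℕ
  c′ i = 3 * e * K * f i * (suc b * c ^ suc b * K ^ k)

  private
    1≤κ : 1 ≤ K ^ k
    1≤κ = ^-positive 1≤K k

    1≤c₁ : 1 ≤ c₁
    1≤c₁ = *-positive (*-positive {3} (s≤s z≤n) 1≤e) 1≤κ

    1≤c : 1 ≤ c
    1≤c = *-positive (*-positive {2} (s≤s z≤n) 1≤K) 1≤c₁

    κ-mono : ∀ {i} → i ≤ k → K ^ i ≤ K ^ k
    κ-mono {i} i≤k = ^-mono 1≤K i≤k
      where
      ^-mono : ∀ {m i j} → 1 ≤ m → i ≤ j → m ^ i ≤ m ^ j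
      ^-mono {suc m} _ = ^-monoʳ-≤ (suc m)

  module _
    (no-fans : ∀ u₀ (ws : Fin s → V) →
               ¬ (∀ Used → length Used ≤ U → ∃[ v₀ ] Fan G s k u₀ v₀ ws Used))
    (D-large : 2 * c₁ * suc b ≤ D) (b-large : 2 + s + U + s * k + k ≤ b)
    (β-large : ∀ i → c′ i + suc b ≤ β (suc i))
    (1≤f0 : 1 ≤ f 0) (f-mono : ∀ {i j} → i ≤ j → f i ≤ f j)
    (f-step : ∀ i → β (suc i) * (suc i * (f i * f i)) ≤ f (suc i)) where

    open Cover f 1≤f0 f-mono f-step

    private
      module _ (i : ℕ) (i<k : suc i ≤ k) (y : V) where

        richDegree : V → ℕ
        richDegree z = ∑ (neighbours y) (λ x → χ (rich? (β (suc i)) (suc i) x z))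

        many? : ∀ z → Dec (D < c₁ * richDegree z)
        many? z = D <? c₁ * richDegree z

        Y : List V
        Y = filter many? all

        often : ∀ {z} → z ∈ Y → Δ ≤ c * (richDegree z ∸ suc b)
        often {z} z∈ = begin
          K * D                                 ≤⟨ *-monoʳ-≤ K (<⇒≤ D<) ⟩
          K * (c₁ * richDegree z)               ≤⟨ *-monoʳ-≤ K (*-monoʳ-≤ c₁ half) ⟩
          K * (c₁ * (2 * (richDegree z ∸ suc b)))  ≡⟨ regroup K c₁ (richDegree z ∸ suc b) ⟩
          c * (richDegree z ∸ suc b)            ∎
          where
          open ≤-Reasoning
          regroup : ∀ a b c → a * (b * (2 * c)) ≡ 2 * a * b * c
          regroup = solve-∀
          D< : D < c₁ * richDegree z
          D< = proj₂ (∈-filter⁻ many? {xs = all} z∈)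
          2T≤d : 2 * suc b ≤ richDegree z
          2T≤d = *-cancelˡ c₁ 1≤c₁ (≤-trans (≤-reflexive (swap₃ c₁ (suc b))) (≤-trans D-large (<⇒≤ D<)))
            where
            swap₃ : ∀ a b → a * (2 * b) ≡ 2 * a * b
            swap₃ = solve-∀
          half : richDegree z ≤ 2 * (richDegree z ∸ suc b)
          half = +-cancelʳ-≤ (2 * suc b) _ _ (begin
            richDegree z + 2 * suc b                      ≤⟨ +-monoʳ-≤ _ 2T≤d ⟩
            richDegree z + richDegree z                   ≡⟨ cong (richDegree z +_) (+-identityʳ _) ⟨
            2 * richDegree z                              ≡⟨ cong (2 *_) (m∸n+n≡m (≤-trans (m≤n*m (suc b) 2) 2T≤d)) ⟨
            2 * (richDegree z ∸ suc b + suc b)            ≡⟨ *-distribˡ-+ 2 (richDegree z ∸ suc b) (suc b) ⟩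
            2 * (richDegree z ∸ suc b) + 2 * suc b        ∎)

        -- A larger `Y` would satisfy the hypotheses of `rich-fans`, with the remaining k - (i + 1)
        -- vertices of each leg taken in the core, contrary to `no-fans`.
        few-Y : c′ i * length Y ≤ suc b * Δ ^ suc i * c ^ suc b
        few-Y with suc b * Δ ^ suc i * c ^ suc b ≤? c′ i * length Y
        ... | no  ≰ = <⇒≤ (≰⇒> ≰)
        ... | yes large-Y with 1 ≤? length Y
        ...   | no  ≱ = ≤-trans (≤-reflexive (trans (cong (c′ i *_) (n<1⇒n≡0 (≰⇒> ≱))) (*-zeroʳ (c′ i)))) z≤n
        ...   | yes 1≤Y = ⊥-elim (no-fans y (proj₁ fans) (proj₂ fans))
          where
          i+j≡k : suc i + (k ∸ suc i) ≡ k
          i+j≡k = m+[n∸m]≡n i<k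
          fans : Σ[ ws ∈ (Fin s → V) ] ∀ Used → length Used ≤ U → ∃[ v₀ ] Fan G s k y v₀ ws Used
          fans = subst (λ m → Σ[ ws ∈ (Fin s → V) ] ∀ Used → length Used ≤ U → ∃[ v₀ ] Fan G s m y v₀ ws Used)
            i+j≡k (rich-fans i (k ∸ suc i) s U b (β (suc i)) c (c′ i) y
              (Unique.filter⁺ many? (Unique.allFin⁺ n)) 1≤Y 1≤Δ 1≤c often large-Y (β-large i)
              (≤-trans (+-mono-≤ (≤-reflexive (cong (λ m → 2 + s + U + s * m) i+j≡k)) (m∸n≤m k (suc i))) b-large))

        3eKf|Y|≤ : 3 * e * K * f i * length Y ≤ D ^ suc i
        3eKf|Y|≤ = *-cancelˡ (suc b * c ^ suc b * K ^ k)
          (*-positive (*-positive {suc b} (s≤s z≤n) (^-positive 1≤c (suc b))) 1≤κ) (begin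
            suc b * c ^ suc b * K ^ k * (3 * e * K * f i * length Y)
              ≡⟨ swap₁ (suc b * c ^ suc b * K ^ k) (3 * e * K * f i) (length Y) ⟩
            c′ i * length Y                             ≤⟨ few-Y ⟩
            suc b * (K * D) ^ suc i * c ^ suc b
              ≡⟨ cong (λ p → suc b * p * c ^ suc b) (^-distribʳ-* K D (suc i)) ⟩
            suc b * (K ^ suc i * D ^ suc i) * c ^ suc b
              ≤⟨ *-monoˡ-≤ (c ^ suc b) (*-monoʳ-≤ (suc b) (*-monoˡ-≤ (D ^ suc i) (κ-mono i<k))) ⟩
            suc b * (K ^ k * D ^ suc i) * c ^ suc b
              ≡⟨ swap₂ (suc b) (K ^ k) (D ^ suc i) (c ^ suc b) ⟩
            suc b * c ^ suc b * K ^ k * D ^ suc i       ∎)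
          where
          open ≤-Reasoning
          swap₁ : ∀ a b c → a * (b * c) ≡ b * a * c
          swap₁ = solve-∀
          swap₂ : ∀ a b c d → a * (b * c) * d ≡ a * d * b * c
          swap₂ = solve-∀

        end-in-Y? : ∀ q → Dec (Good (y ∷ q) × end y q ∈ Y)
        end-in-Y? q = good? (y ∷ q) ×-dec _∈?_ Fin._≟_ (end y q) Y

        good-into-Y : ∑ (walks (suc i) y) (χ ∘ end-in-Y?) ≤ length Y * f i
        good-into-Y = ≤-trans
          (∑-walks-cover (suc i) y end-in-Y? (concatMap to Y) covers)
          (length-concatMap-≤ to Y (f i) (λ z → ≤-trans (≤-reflexive (length-map _ (proj₁ (paths z))))
            (proj₁ (proj₂ (paths z)))))
          where
          paths : ∀ z → ∃[ Ls ] length Ls ≤ f i × IsCover i y z Ls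
          paths = cover i i ≤-refl (≤-trans i<k (n≤1+n k)) y
          to : V → List (List V)
          to z = map (_∷ʳ z) (proj₁ (paths z))
          end-∷ʳ : ∀ x q z → end x (q ∷ʳ z) ≡ z
          end-∷ʳ x []      z = refl
          end-∷ʳ x (a ∷ q) z = end-∷ʳ a q z
          covers : ∀ {q} → q ∈ walks (suc i) y → Good (y ∷ q) × end y q ∈ Y → q ∈ concatMap to Y
          covers {q} q∈ (good , end∈) with initLast q | walks-∈ (suc i) y q∈
          covers .{q ∷ʳ z} q∈ (good , end∈) | q ∷ʳ′ z | eq , linked =
            ∈-concatMap⁺ to (lose (subst (_∈ Y) (end-∷ʳ y q z) end∈)
              (∈-map⁺ (_∷ʳ z) (proj₂ (proj₂ (paths z)) q
                (suc-injective (trans (+-comm 1 (length q)) (trans (sym (length-++ q)) eq))) linked good)))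

        term : List V → ℕ
        term q = χ (good? (y ∷ q)) * richDegree (end y q)

        -- An end outside `Y` has at most D / c₁ rich partners by definition. An end in `Y` may have
        -- up to Δ, but few good walks lead there by `good-into-Y`.
        term≤ : ∀ q → c₁ * term q ≤ D + c₁ * (Δ * χ (end-in-Y? q))
        term≤ q = split (good? (y ∷ q)) (many? (end y q))
          where
          open ≤-Reasoning
          split : (g : Dec (Good (y ∷ q))) → Dec (D < c₁ * richDegree (end y q)) →
                  c₁ * (χ g * richDegree (end y q)) ≤ D + c₁ * (Δ * χ (end-in-Y? q))
          split (no _)  _        = ≤-trans (≤-reflexive (*-zeroʳ c₁)) z≤n
          split (yes g) (no  ≮)  = ≤-trans (≤-trans (≤-reflexive (cong (c₁ *_) (+-identityʳ _))) (≮⇒≥ ≮)) (m≤m+n D _)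
          split (yes g) (yes lt) = ≤-trans (*-monoʳ-≤ c₁ (begin
            1 * richDegree (end y q)       ≡⟨ +-identityʳ _ ⟩
            richDegree (end y q)
              ≤⟨ ∑-≤ (neighbours y) 1 (λ {x} _ → χ≤1 (rich? (β (suc i)) (suc i) x (end y q))) ⟩
            length (neighbours y) * 1      ≤⟨ *-monoˡ-≤ 1 (max-degree y) ⟩
            Δ * 1
              ≡⟨ cong (Δ *_) (χ-yes (end-in-Y? q) (g , ∈-filter⁺ many? (∈-allFin (end y q)) lt)) ⟨
            Δ * χ (end-in-Y? q)            ∎)) (m≤n+m _ D)

        rich-part : 3 * e * ∑ (walks (suc i) y) term ≤ D ^ suc (suc i) + D ^ suc (suc i)
        rich-part = *-cancelˡ (K ^ k) 1≤κ (begin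
          K ^ k * (3 * e * S)
            ≡⟨ rotate (K ^ k) (3 * e) S ⟩
          c₁ * S
            ≡⟨ ∑-*ˡ c₁ (walks (suc i) y) term ⟨
          ∑ (walks (suc i) y) (λ q → c₁ * term q)
            ≤⟨ ∑-mono (walks (suc i) y) term≤ ⟩
          ∑ (walks (suc i) y) (λ q → D + c₁ * (Δ * χ (end-in-Y? q)))
            ≡⟨ ∑-+ (walks (suc i) y) _ _ ⟩
          ∑ (walks (suc i) y) (λ _ → D) + ∑ (walks (suc i) y) (λ q → c₁ * (Δ * χ (end-in-Y? q)))
            ≡⟨ cong (∑ (walks (suc i) y) (λ _ → D) +_)
                 (trans (∑-*ˡ c₁ (walks (suc i) y) _) (cong (c₁ *_) (∑-*ˡ Δ (walks (suc i) y) _))) ⟩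
          ∑ (walks (suc i) y) (λ _ → D) + c₁ * (Δ * ∑ (walks (suc i) y) (χ ∘ end-in-Y?))
            ≤⟨ +-mono-≤ (∑-walks-≤ (suc i) y D (λ _ → ≤-refl)) (*-monoʳ-≤ c₁ (*-monoʳ-≤ Δ good-into-Y)) ⟩
          Δ ^ suc i * D + c₁ * (Δ * (length Y * f i))
            ≡⟨ cong₂ _+_ (trans (cong (_* D) (^-distribʳ-* K D (suc i))) (regroup₁ (K ^ suc i) (D ^ suc i) D))
                         (regroup₂ e (K ^ k) K D (length Y) (f i)) ⟩
          K ^ suc i * D ^ suc (suc i) + K ^ k * (D * (3 * e * K * f i * length Y))
            ≤⟨ +-mono-≤ (*-monoˡ-≤ (D ^ suc (suc i)) (κ-mono i<k)) (*-monoʳ-≤ (K ^ k) (*-monoʳ-≤ D 3eKf|Y|≤)) ⟩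
          K ^ k * D ^ suc (suc i) + K ^ k * D ^ suc (suc i)
            ≡⟨ *-distribˡ-+ (K ^ k) _ _ ⟨
          K ^ k * (D ^ suc (suc i) + D ^ suc (suc i)) ∎)
          where
          open ≤-Reasoning
          S = ∑ (walks (suc i) y) term
          rotate : ∀ a b c → a * (b * c) ≡ b * a * c
          rotate = solve-∀
          regroup₁ : ∀ a b c → a * b * c ≡ a * (c * b)
          regroup₁ = solve-∀
          regroup₂ : ∀ e p k d l f → 3 * e * p * (k * d * (l * f)) ≡ p * (d * (3 * e * k * f * l))
          regroup₂ = solve-∀

        returning : V → List V → ℕ
        returning x q = χ (x Fin.≟ end y q)

        -- A walk from y determines the vertex x to which it returns. This saves a full factor D,
        -- and by `D-large` that factor covers the constant c₁.
        returning-part : 3 * e * ∑ (walks (suc i) y) (λ q → ∑ (neighbours y) (λ x → returning x q)) ≤ D ^ suc (suc i)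
        returning-part = begin
          3 * e * ∑ (walks (suc i) y) (λ q → ∑ (neighbours y) (λ x → returning x q))
            ≤⟨ *-monoʳ-≤ (3 * e) (∑-walks-≤ (suc i) y 1 (λ {q} _ → ∑-χ≡ Fin._≟_ (unique-neighbours y) (end y q))) ⟩
          3 * e * (Δ ^ suc i * 1)
            ≡⟨ cong (3 * e *_) (trans (*-identityʳ _) (^-distribʳ-* K D (suc i))) ⟩
          3 * e * (K ^ suc i * D ^ suc i)
            ≤⟨ *-monoʳ-≤ (3 * e) (*-monoˡ-≤ (D ^ suc i) (κ-mono i<k)) ⟩
          3 * e * (K ^ k * D ^ suc i)
            ≡⟨ *-assoc (3 * e) (K ^ k) _ ⟨
          c₁ * D ^ suc i
            ≤⟨ *-monoˡ-≤ (D ^ suc i) (≤-trans (≤-*ˡ {2} c₁ (s≤s z≤n)) (≤-trans (≤-*ʳ {suc b} (2 * c₁) (s≤s z≤n)) D-large)) ⟩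
          D * D ^ suc i ∎
          where open ≤-Reasoning

        barely-split : barelyBad (suc i) y ≤
          ∑ (walks (suc i) y) (λ q → ∑ (neighbours y) (λ x → returning x q)) + ∑ (walks (suc i) y) term
        barely-split = begin
          barelyBad (suc i) y
            ≤⟨ ∑-mono (neighbours y) (λ x → ∑-mono (walks (suc i) y) (λ q →
                 cases x q (good? (y ∷ q)) (bad? (suc i) x (end y q)))) ⟩
          ∑ (neighbours y) (λ x → ∑ (walks (suc i) y) (λ q →
            returning x q + χ (good? (y ∷ q)) * χ (rich? (β (suc i)) (suc i) x (end y q))))
            ≡⟨ ∑-swap (neighbours y) (walks (suc i) y) _ ⟩
          ∑ (walks (suc i) y) (λ q → ∑ (neighbours y) (λ x →
            returning x q + χ (good? (y ∷ q)) * χ (rich? (β (suc i)) (suc i) x (end y q))))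
            ≡⟨ ∑-cong (walks (suc i) y) (λ q → trans (∑-+ (neighbours y) _ _)
                 (cong (∑ (neighbours y) (λ x → returning x q) +_) (∑-*ˡ (χ (good? (y ∷ q))) (neighbours y) _))) ⟩
          ∑ (walks (suc i) y) (λ q → ∑ (neighbours y) (λ x → returning x q) + term q)
            ≡⟨ ∑-+ (walks (suc i) y) _ _ ⟩
          ∑ (walks (suc i) y) (λ q → ∑ (neighbours y) (λ x → returning x q)) + ∑ (walks (suc i) y) term ∎
          where
          open ≤-Reasoning
          cases : ∀ x q (g : Dec (Good (y ∷ q))) (bad : Dec (Bad (suc i) x (end y q))) →
                  χ (g ×-dec bad) ≤ returning x q + χ g * χ (rich? (β (suc i)) (suc i) x (end y q))
          cases x q (no _)  _       = z≤n
          cases x q (yes _) (no _)  = z≤n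
          cases x q (yes _) (yes (_ , inj₁ x≡end)) =
            ≤-trans (≤-reflexive (sym (χ-yes (x Fin.≟ end y q) x≡end))) (m≤m+n _ _)
          cases x q (yes _) (yes (_ , inj₂ (_ , rich))) =
            ≤-trans (≤-reflexive (sym (trans (+-identityʳ _) (χ-yes (rich? (β (suc i)) (suc i) x (end y q)) rich))))
                    (m≤n+m _ (returning x q))

        barelyBad≤ : e * barelyBad (suc i) y ≤ D ^ suc (suc i)
        barelyBad≤ = *-cancelˡ 3 (s≤s z≤n) (begin
          3 * (e * barelyBad (suc i) y)    ≡⟨ *-assoc 3 e _ ⟨
          3 * e * barelyBad (suc i) y      ≤⟨ *-monoʳ-≤ (3 * e) barely-split ⟩
          3 * e * (R + S)                  ≡⟨ *-distribˡ-+ (3 * e) R S ⟩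
          3 * e * R + 3 * e * S            ≤⟨ +-mono-≤ returning-part rich-part ⟩
          P + (P + P)                      ≡⟨ cong (λ p → P + (P + p)) (+-identityʳ P) ⟨
          3 * P                            ∎)
          where
          open ≤-Reasoning
          P = D ^ suc (suc i)
          R = ∑ (walks (suc i) y) (λ q → ∑ (neighbours y) (λ x → returning x q))
          S = ∑ (walks (suc i) y) term

      none : ∀ i y → (∀ {x} q → x ∈ neighbours y → q ∈ walks i y → ¬ Bad i x (end y q)) → barelyBad i y ≤ 0
      none i y ¬bad = ≤-trans
        (∑-mono-∈ (neighbours y) {g = λ _ → 0} (λ {x} x∈ → ≤-trans
          (∑-mono-∈ (walks i y) {g = λ _ → 0} (λ {q} q∈ →
            ≤-reflexive (χ-no (good? (y ∷ q) ×-dec bad? i x (end y q)) (λ (_ , bad) → ¬bad q x∈ q∈ bad))))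
          (≤-reflexive (trans (∑-const (walks i y) 0) (*-zeroʳ (length (walks i y)))))))
        (≤-reflexive (trans (∑-const (neighbours y) 0) (*-zeroʳ (length (neighbours y)))))

      nothing : ∀ i y → barelyBad i y ≤ 0 → e * barelyBad i y ≤ D ^ suc i
      nothing i y le = ≤-trans (*-monoʳ-≤ e le) (≤-trans (≤-reflexive (*-zeroʳ e)) z≤n)

    few-barelyBad : ∀ i y → e * barelyBad i y ≤ D ^ suc i
    few-barelyBad zero y = nothing zero y (none zero y
      (λ { [] x∈ _ (_ , inj₁ refl) → irrefl (neighbours-∈ x∈) ; (_ ∷ _) _ (here ()) _ ; (_ ∷ _) _ (there ()) _ }))
    few-barelyBad (suc i) y with suc i ≤? k
    ... | yes i<k = barelyBad≤ i i<k y
    ... | no  i≮k = nothing (suc i) y (none (suc i) y (λ _ _ _ (i<k , _) → i≮k (≤-pred i<k)))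

-- Fans from good walks

module FindFans {n : ℕ} (G : Graph (Fin n)) (Δ : ℕ)
  (max-degree : ∀ x → length (filter (Graph._~?_ G x) (allFin n)) ≤ Δ)
  (k : ℕ) (β f : ℕ → ℕ) (1≤f0 : 1 ≤ f 0) (f-mono : ∀ {i j} → i ≤ j → f i ≤ f j)
  (f-step : ∀ i → β (suc i) * (suc i * (f i * f i)) ≤ f (suc i)) where

  open Graph G
  open Paths G
  open RichFans G Δ max-degree
  open Walks G Δ max-degree
  open BadWalks (suc k) β
  open Good (suc k) β
  open Cover f 1≤f0 f-mono f-step

  meets? : ∀ (Used q : List V) → Dec (∃[ a ] a ∈ q × a ∈ Used)
  meets? Used q with meets-or-disjoint q Used
  ... | inj₁ meets    = yes meets
  ... | inj₂ disjoint = no λ (_ , a∈q , a∈Used) → disjoint (a∈q , a∈Used)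

  -- At each of the m positions, prescribing the vertex costs one factor Δ: the step that arrives at
  -- `a` is forced.
  walks-through : ∀ a m x → ∑ (walks m x) (λ q → χ (_∈?_ Fin._≟_ a q)) ≤ m * Δ ^ (m ∸ 1)
  walks-through a zero    x = ≤-reflexive (trans (+-identityʳ _) (χ-no (_∈?_ Fin._≟_ a []) λ ()))
  walks-through a (suc m) x = begin
    ∑ (walks (suc m) x) (λ q → χ (_∈?_ Fin._≟_ a q))
      ≡⟨ ∑-walks m x _ ⟩
    ∑ (neighbours x) (λ y → ∑ (walks m y) (λ q → χ (_∈?_ Fin._≟_ a (y ∷ q))))
      ≤⟨ ∑-mono (neighbours x) (λ y → ∑-mono (walks m y) (λ q → χ-≤ (_∈?_ Fin._≟_ a (y ∷ q)) (cases y q))) ⟩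
    ∑ (neighbours x) (λ y → ∑ (walks m y) (λ q → χ (y Fin.≟ a) + χ (_∈?_ Fin._≟_ a q)))
      ≡⟨ ∑-cong (neighbours x) (λ y → ∑-+ (walks m y) _ _) ⟩
    ∑ (neighbours x) (λ y → ∑ (walks m y) (λ _ → χ (y Fin.≟ a)) + ∑ (walks m y) (λ q → χ (_∈?_ Fin._≟_ a q)))
      ≤⟨ ∑-mono (neighbours x) (λ y → +-mono-≤ (∑-walks-≤ m y (χ (y Fin.≟ a)) (λ _ → ≤-refl)) (walks-through a m y)) ⟩
    ∑ (neighbours x) (λ y → Δ ^ m * χ (y Fin.≟ a) + m * Δ ^ (m ∸ 1))
      ≡⟨ ∑-+ (neighbours x) _ _ ⟩
    ∑ (neighbours x) (λ y → Δ ^ m * χ (y Fin.≟ a)) + ∑ (neighbours x) (λ _ → m * Δ ^ (m ∸ 1))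
      ≤⟨ +-mono-≤ (≤-trans (≤-reflexive (∑-*ˡ (Δ ^ m) (neighbours x) _))
                           (*-monoʳ-≤ (Δ ^ m) (∑-χ≡ Fin._≟_ (unique-neighbours x) a)))
                  (≤-trans (≤-reflexive (∑-const (neighbours x) _)) (*-monoˡ-≤ (m * Δ ^ (m ∸ 1)) (max-degree x))) ⟩
    Δ ^ m * 1 + Δ * (m * Δ ^ (m ∸ 1))
      ≤⟨ +-mono-≤ (≤-reflexive (*-identityʳ (Δ ^ m))) (shift m) ⟩
    Δ ^ m + m * Δ ^ m ∎
    where
    open ≤-Reasoning
    cases : ∀ y q → a ∈ y ∷ q → 1 ≤ χ (y Fin.≟ a) + χ (_∈?_ Fin._≟_ a q)
    cases y q (here refl) = ≤-trans (≤-reflexive (sym (χ-yes (y Fin.≟ y) refl))) (m≤m+n _ _)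
    cases y q (there a∈q) = ≤-trans (≤-reflexive (sym (χ-yes (_∈?_ Fin._≟_ a q) a∈q))) (m≤n+m _ (χ (y Fin.≟ a)))
    shift : ∀ m → Δ * (m * Δ ^ (m ∸ 1)) ≤ m * Δ ^ m
    shift zero    = ≤-reflexive (*-zeroʳ Δ)
    shift (suc m) = ≤-reflexive (rotate Δ (suc m) (Δ ^ m))
      where
      rotate : ∀ a b c → a * (b * c) ≡ b * (a * c)
      rotate = solve-∀

  walks-meeting : ∀ Used m x → ∑ (walks m x) (χ ∘ meets? Used) ≤ length Used * (m * Δ ^ (m ∸ 1))
  walks-meeting Used m x = begin
    ∑ (walks m x) (χ ∘ meets? Used)
      ≤⟨ ∑-mono (walks m x) (λ q → χ-≤ (meets? Used q) (λ (a , a∈q , a∈Used) →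
           ≤-trans (≤-reflexive (sym (χ-yes (_∈?_ Fin._≟_ a q) a∈q))) (∑-∈ (λ a → χ (_∈?_ Fin._≟_ a q)) a∈Used))) ⟩
    ∑ (walks m x) (λ q → ∑ Used (λ a → χ (_∈?_ Fin._≟_ a q)))
      ≡⟨ ∑-swap (walks m x) Used _ ⟩
    ∑ Used (λ a → ∑ (walks m x) (λ q → χ (_∈?_ Fin._≟_ a q)))
      ≤⟨ ∑-≤ Used (m * Δ ^ (m ∸ 1)) (λ {a} _ → walks-through a m x) ⟩
    length Used * (m * Δ ^ (m ∸ 1)) ∎
    where open ≤-Reasoning

  module _ (x y : V) where

    -- Goodness is demanded from x on, not merely from y: `legs-fan` needs the initial segments of a
    -- leg to be good walks starting at the root x.
    IsLeg : List V → V → List V → Set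
    IsLeg Used z q = Linked _~_ (y ∷ q ∷ʳ z) × Good (x ∷ y ∷ q ∷ʳ z) × Disjoint (q ∷ʳ z) Used

    Leg : List V → V → Set
    Leg Used z = ∃[ q ] length q ≡ k × IsLeg Used z q

    isLeg-or-not : ∀ Used z q → IsLeg Used z q ⊎ ¬ IsLeg Used z q
    isLeg-or-not Used z q
      with linked? _~?_ (y ∷ q ∷ʳ z) ×-dec good? (x ∷ y ∷ q ∷ʳ z) | meets-or-disjoint (q ∷ʳ z) Used
    ... | yes (linked , good) | inj₂ disjoint = inj₁ (linked , good , disjoint)
    ... | yes _ | inj₁ (_ , a∈q , a∈Used) = inj₂ λ (_ , _ , disjoint) → disjoint (a∈q , a∈Used)
    ... | no ¬p | _ = inj₂ λ (linked , good , _) → ¬p (linked , good)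

    leg? : ∀ Used z → Dec (Leg Used z)
    leg? Used z with search-List k (isLeg-or-not Used z)
    ... | inj₁ leg = yes leg
    ... | inj₂ none = no λ (q , eq , isLeg) → none q eq isLeg

    badContinuations : ℕ
    badContinuations = ∑ (walks (suc k) y) (λ q → χ (¬? (good? (x ∷ y ∷ q))))

    -- The predicate records the success of a greedy choice: each leg is the one found by `leg?`,
    -- and its vertices count as used for the rest. It is thus decidable, counts a tuple once
    -- however many legs its ends admit, and unfolds coordinate by coordinate in `many-legs`.
    Legs : ∀ {s} → List V → Vec V s → Set
    LegsFrom : ∀ {s Used z} → Dec (Leg Used z) → Vec V s → Set
    Legs Used []       = ⊤
    Legs Used (z ∷ zs) = LegsFrom (leg? Used z) zs
    LegsFrom {Used = Used} {z} (yes (q , _)) zs = Legs ((q ∷ʳ z) ++ Used) zs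
    LegsFrom                   (no _)        zs = ⊥

    legs? : ∀ {s} Used (zs : Vec V s) → Dec (Legs Used zs)
    legsFrom? : ∀ {s Used z} (leg : Dec (Leg Used z)) (zs : Vec V s) → Dec (LegsFrom leg zs)
    legs? Used []       = yes tt
    legs? Used (z ∷ zs) = legsFrom? (leg? Used z) zs
    legsFrom? {Used = Used} {z} (yes (q , _)) zs = legs? ((q ∷ʳ z) ++ Used) zs
    legsFrom?                   (no _)        zs = no λ ()

    LegFamily : ∀ {s} → List V → Vec V s → Set
    LegFamily {s} Used zs = Σ[ qs ∈ (Fin s → List V) ]
      (∀ j → length (qs j) ≡ k × IsLeg Used (lookupⱽ zs j) (qs j)) ×
      (∀ {j j′} → j ≢ j′ → Disjoint (qs j ∷ʳ lookupⱽ zs j) (qs j′ ∷ʳ lookupⱽ zs j′))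

    legs-family : ∀ {s} Used (zs : Vec V s) → Legs Used zs → LegFamily Used zs
    legs-family Used []       _    = (λ ()) , (λ ()) , λ { {()} }
    legs-family {suc s} Used (z ∷ zs) legs = from (leg? Used z) legs
      where
      from : (leg : Dec (Leg Used z)) → LegsFrom leg zs → LegFamily Used (z ∷ zs)
      from (yes (q , eq , isLeg)) legs′ = qs , isLegs , disjoint
        where
        rest = legs-family ((q ∷ʳ z) ++ Used) zs legs′
        qs : Fin (suc s) → List V
        qs zero    = q
        qs (suc j) = proj₁ rest j
        isLegs : ∀ j → length (qs j) ≡ k × IsLeg Used (lookupⱽ (z ∷ zs) j) (qs j)
        isLegs zero    = eq , isLeg
        isLegs (suc j) with eq′ , linked , good , avoids ← proj₁ (proj₂ rest) j =
          eq′ , linked , good , λ (a∈ , a∈Used) → avoids (a∈ , ∈-++⁺ʳ (q ∷ʳ z) a∈Used)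
        disjoint : ∀ {j j′} → j ≢ j′ →
                   Disjoint (qs j ∷ʳ lookupⱽ (z ∷ zs) j) (qs j′ ∷ʳ lookupⱽ (z ∷ zs) j′)
        disjoint {zero}  {zero}   ne _ = ne refl
        disjoint {zero}  {suc j′} _ (a∈ , a∈′) =
          proj₂ (proj₂ (proj₂ (proj₁ (proj₂ rest) j′))) (a∈′ , ∈-++⁺ˡ a∈)
        disjoint {suc j} {zero}   _ (a∈ , a∈′) =
          proj₂ (proj₂ (proj₂ (proj₁ (proj₂ rest) j))) (a∈ , ∈-++⁺ˡ a∈′)
        disjoint {suc j} {suc j′} ne = proj₂ (proj₂ rest) (ne ∘ cong suc)

    module _ {D : ℕ} (min-degree : ∀ x → D ≤ length (neighbours x))
             (fine : 2 * badContinuations ≤ D ^ suc k)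
             (L : ℕ) (L-small : 4 * (L * (suc k * Δ ^ k)) ≤ D ^ suc k) where

      -- Of at least D^(k + 1) walks, at most half, measured against D^(k + 1), continue badly and
      -- at most a quarter meet `Used`. The remaining quarter has at most f k good walks for each
      -- end z.
      many-ends : ∀ Used → length Used ≤ L → D ^ suc k ≤ 4 * f k * ∑ all (λ z → χ (leg? Used z))
      many-ends Used small = +-cancelˡ-≤ (3 * D ^ suc k) _ _ (begin
        3 * D ^ suc k + D ^ suc k
          ≡⟨ +-comm (3 * D ^ suc k) _ ⟩
        4 * D ^ suc k
          ≤⟨ *-monoʳ-≤ 4 (begin
            D ^ suc k
              ≤⟨ walks-≥ min-degree (suc k) y ⟩
            ∑ (walks (suc k) y) (λ _ → 1)
              ≤⟨ ∑-mono (walks (suc k) y) (λ q → trichotomy (good? (x ∷ y ∷ q)) (meets? Used q)) ⟩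
            ∑ (walks (suc k) y) (λ q → χ (¬? (good? (x ∷ y ∷ q))) + (χ (meets? Used q) + χ (usable? q)))
              ≡⟨ trans (∑-+ (walks (suc k) y) _ _) (cong (badContinuations +_) (∑-+ (walks (suc k) y) _ _)) ⟩
            badContinuations + (∑ (walks (suc k) y) (χ ∘ meets? Used) + ∑ (walks (suc k) y) (χ ∘ usable?))
              ≤⟨ +-monoʳ-≤ badContinuations (+-mono-≤
                   (≤-trans (walks-meeting Used (suc k) y) (*-monoˡ-≤ (suc k * Δ ^ k) small)) usable≤) ⟩
            badContinuations + (L * (suc k * Δ ^ k) + N * f k) ∎) ⟩
        4 * (badContinuations + (L * (suc k * Δ ^ k) + N * f k))
          ≡⟨ expand badContinuations (L * (suc k * Δ ^ k)) N (f k) ⟩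
        2 * (2 * badContinuations) + 4 * (L * (suc k * Δ ^ k)) + 4 * f k * N
          ≤⟨ +-monoˡ-≤ _ (+-mono-≤ (*-monoʳ-≤ 2 fine) L-small) ⟩
        2 * D ^ suc k + D ^ suc k + 4 * f k * N
          ≡⟨ cong (_+ 4 * f k * N) (+-comm (2 * D ^ suc k) (D ^ suc k)) ⟩
        3 * D ^ suc k + 4 * f k * N ∎)
        where
        open ≤-Reasoning
        N = ∑ all (λ z → χ (leg? Used z))
        expand : ∀ a b c d → 4 * (a + (b + c * d)) ≡ 2 * (2 * a) + 4 * b + 4 * d * c
        expand = solve-∀
        usable? : ∀ q → Dec (Good (x ∷ y ∷ q) × ¬ (∃[ a ] a ∈ q × a ∈ Used))
        usable? q = good? (x ∷ y ∷ q) ×-dec ¬? (meets? Used q)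
        trichotomy : ∀ {q} (g : Dec (Good (x ∷ y ∷ q))) (m : Dec (∃[ a ] a ∈ q × a ∈ Used)) →
                     1 ≤ χ (¬? g) + (χ m + χ (g ×-dec ¬? m))
        trichotomy (no _)  _       = s≤s z≤n
        trichotomy (yes _) (yes _) = s≤s z≤n
        trichotomy (yes _) (no _)  = ≤-refl
        paths : ∀ z → ∃[ Ls ] length Ls ≤ f k × IsCover k y z Ls
        paths = cover k k ≤-refl ≤-refl y
        to : V → List (List V)
        to z = map (_∷ʳ z) (proj₁ (paths z))
        covers : ∀ {q} → q ∈ walks (suc k) y → Good (x ∷ y ∷ q) × ¬ (∃[ a ] a ∈ q × a ∈ Used) →
                 q ∈ concatMap to (filter (leg? Used) all)
        covers {q} q∈ (good , avoids) with initLast q | walks-∈ (suc k) y q∈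
        covers .{q ∷ʳ z} q∈ (good , avoids) | q ∷ʳ′ z | eq , linked =
          ∈-concatMap⁺ to (lose (∈-filter⁺ (leg? Used) (∈-allFin z)
              (q , eq′ , linked , good , λ (a∈q , a∈Used) → avoids (_ , a∈q , a∈Used)))
            (∈-map⁺ (_∷ʳ z) (proj₂ (proj₂ (paths z)) q eq′ linked (proj₂ good))))
          where
          eq′ = suc-injective (trans (+-comm 1 (length q)) (trans (sym (length-++ q)) eq))
        usable≤ : ∑ (walks (suc k) y) (χ ∘ usable?) ≤ N * f k
        usable≤ = ≤-trans (∑-walks-cover (suc k) y usable? _ covers)
          (≤-trans (length-concatMap-≤ to (filter (leg? Used) all) (f k)
                     (λ z → ≤-trans (≤-reflexive (length-map _ (proj₁ (paths z)))) (proj₁ (proj₂ (paths z)))))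
                   (≤-reflexive (cong (_* f k) (length-filter-∑ (leg? Used) all))))

  tuples : ∀ s → List (Vec V s)
  tuples zero    = [] ∷ []
  tuples (suc s) = concatMap (λ z → map (z ∷_) (tuples s)) all

  ∑-tuples : ∀ s (h : Vec V (suc s) → ℕ) →
             ∑ (tuples (suc s)) h ≡ ∑ all (λ z → ∑ (tuples s) (λ zs → h (z ∷ zs)))
  ∑-tuples s h = trans (∑-concatMap _ all h) (∑-cong all (λ z → ∑-map (z ∷_) (tuples s) h))

  length-tuples : ∀ s → length (tuples s) ≤ n ^ s
  length-tuples zero    = ≤-refl
  length-tuples (suc s) = ≤-trans
    (length-concatMap-≤ _ all (n ^ s) (λ z → ≤-trans (≤-reflexive (length-map (z ∷_) (tuples s))) (length-tuples s)))
    (≤-reflexive (cong (_* n ^ s) (length-tabulate {n = n} id)))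

  many-legs : ∀ {D} x y → (∀ x → D ≤ length (neighbours x)) → 2 * badContinuations x y ≤ D ^ suc k →
    ∀ L → 4 * (L * (suc k * Δ ^ k)) ≤ D ^ suc k → ∀ s Used → length Used + s * suc k ≤ L →
    (D ^ suc k) ^ s ≤ (4 * f k) ^ s * ∑ (tuples s) (χ ∘ legs? x y Used)
  many-legs x y min-degree fine L L-small zero    Used le = ≤-refl
  many-legs {D} x y min-degree fine L L-small (suc s) Used le = begin
    D ^ suc k * P
      ≤⟨ *-monoˡ-≤ P (many-ends x y min-degree fine L L-small Used (≤-trans (m≤m+n _ _) le)) ⟩
    4 * f k * ∑ all (λ z → χ (leg? x y Used z)) * P
      ≡⟨ *-assoc (4 * f k) _ P ⟩
    4 * f k * (∑ all (λ z → χ (leg? x y Used z)) * P)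
      ≡⟨ cong (4 * f k *_) (∑-*ʳ P all _) ⟨
    4 * f k * ∑ all (λ z → χ (leg? x y Used z) * P)
      ≤⟨ *-monoʳ-≤ (4 * f k) (∑-mono all (λ z → continue z (leg? x y Used z))) ⟩
    4 * f k * ∑ all (λ z → (4 * f k) ^ s * ∑ (tuples s) (λ zs → χ (legsFrom? x y (leg? x y Used z) zs)))
      ≡⟨ cong (4 * f k *_) (∑-*ˡ ((4 * f k) ^ s) all _) ⟩
    4 * f k * ((4 * f k) ^ s * ∑ all (λ z → ∑ (tuples s) (λ zs → χ (legsFrom? x y (leg? x y Used z) zs))))
      ≡⟨ *-assoc (4 * f k) _ _ ⟨
    (4 * f k) ^ suc s * ∑ all (λ z → ∑ (tuples s) (λ zs → χ (legsFrom? x y (leg? x y Used z) zs)))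
      ≡⟨ cong ((4 * f k) ^ suc s *_) (∑-tuples s _) ⟨
    (4 * f k) ^ suc s * ∑ (tuples (suc s)) (χ ∘ legs? x y Used) ∎
    where
    open ≤-Reasoning
    P = (D ^ suc k) ^ s
    continue : ∀ z (leg : Dec (Leg x y Used z)) →
      χ leg * P ≤ (4 * f k) ^ s * ∑ (tuples s) (λ zs → χ (legsFrom? x y leg zs))
    continue z (no _) = z≤n
    continue z (yes (q , eq , _)) = ≤-trans (≤-reflexive (+-identityʳ P))
      (many-legs x y min-degree fine L L-small s ((q ∷ʳ z) ++ Used) (≤-trans (≤-reflexive length-eq) le))
      where
      regroup : ∀ a b c → suc a + b + c ≡ b + (suc a + c)
      regroup = solve-∀
      length-eq : length ((q ∷ʳ z) ++ Used) + s * suc k ≡ length Used + suc s * suc k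
      length-eq = trans (cong (_+ s * suc k) (trans (length-++ (q ∷ʳ z)) (cong (_+ length Used)
          (trans (length-++ q) (trans (+-comm (length q) 1) (cong suc eq))))))
        (regroup k (length Used) (s * suc k))

-- Popular roots and disjoint fans

module Spread {n : ℕ} (G : Graph (Fin n)) (Δ : ℕ)
  (max-degree : ∀ x → length (filter (Graph._~?_ G x) (allFin n)) ≤ Δ)
  (k : ℕ) (β f : ℕ → ℕ) (1≤f0 : 1 ≤ f 0) (f-mono : ∀ {i j} → i ≤ j → f i ≤ f j)
  (f-step : ∀ i → β (suc i) * (suc i * (f i * f i)) ≤ f (suc i)) where

  open Graph G
  open Paths G
  open RichFans G Δ max-degree
  open Walks G Δ max-degree
  open BadWalks (suc k) β
  open Good (suc k) β
  open Cover f 1≤f0 f-mono f-step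
  open FindFans G Δ max-degree k β f 1≤f0 f-mono f-step

  module _ {s : ℕ} (x : V) (zs : Vec V s) where

    private
      firstInterior : List V → V
      firstInterior []      = x
      firstInterior (y ∷ _) = y

      paths : ∀ a (i : Fin k) → ∃[ Ls ] length Ls ≤ f (suc (toℕ i)) × IsCover (suc (toℕ i)) x a Ls
      paths a i = cover (suc (toℕ i)) (suc (toℕ i)) ≤-refl (s≤s (Fin.toℕ<n i)) x a

      via : V → List V
      via a = concatMap (λ i → map firstInterior (proj₁ (paths a i))) (allFin k)

    -- A vertex y whose legs meet Used lies on one of the boundedly many good paths from x to Used.
    spoiled : List V → List V
    spoiled Used = Used ++ concatMap via Used

    length-spoiled : ∀ {U} Used → length Used ≤ U → length (spoiled Used) ≤ U + U * (k * f k)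
    length-spoiled {U} Used small = ≤-trans (≤-reflexive (length-++ Used)) (+-mono-≤ small
      (≤-trans (length-concatMap-≤ via Used (k * f k) (λ a →
          ≤-trans (length-concatMap-≤ _ (allFin k) (f k) (λ i →
              ≤-trans (≤-reflexive (length-map firstInterior (proj₁ (paths a i))))
                      (≤-trans (proj₁ (proj₂ (paths a i))) (f-mono (Fin.toℕ<n i)))))
            (≤-reflexive (cong (_* f k) (length-tabulate {n = k} id)))))
        (*-monoˡ-≤ (k * f k) small)))

    legs-fan : ∀ {y} Used → x ~ y → y ∉ spoiled Used → Legs x y (x ∷ []) zs →
               Fan G s k x y (lookupⱽ zs) Used
    legs-fan {y} Used x~y y∉ legs = record
      { qs = qs ; length-qs = λ j → proj₁ (isLegs j) ; root-edge = x~y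
      ; linked = λ j → proj₁ (proj₂ (isLegs j))
      -- Goodness does not separate x from the far end of a leg, which is why the greedy choice of
      -- legs starts with x marked as used.
      ; u∉ = λ j x∈ → proj₂ (proj₂ (proj₂ (isLegs j))) (x∈ , here refl)
      ; v∉ = λ j y∈ → Unique.Unique[x∷xs]⇒x∉xs (unique-y∷ j) y∈
      ; unique = λ j → AllPairs.tail (unique-y∷ j)
      ; disjoint = proj₂ (proj₂ family)
      ; v∉Used = y∉ ∘ ∈-++⁺ˡ
      ; qs∉Used = λ j (a∈q , a∈Used) → y∉ (∈-++⁺ʳ Used (∈-concatMap⁺ via (lose a∈Used (first-on-path j a∈q))))
      }
      where
      family = legs-family x y (x ∷ []) zs legs
      qs = proj₁ family
      isLegs = proj₁ (proj₂ family)
      unique-y∷ : ∀ j → Unique (y ∷ qs j ∷ʳ lookupⱽ zs j)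
      unique-y∷ j = good-unique (y ∷ qs j ∷ʳ lookupⱽ zs j) (proj₂ (proj₁ (proj₂ (proj₂ (isLegs j)))))
        (s≤s (≤-reflexive (trans (length-++ (qs j)) (trans (+-comm (length (qs j)) 1) (cong suc (proj₁ (isLegs j)))))))
      first-on-path : ∀ j {a} → a ∈ qs j → y ∈ via a
      first-on-path j {a} a∈q with q₁ , q₂ , eq ← ∈-∃++ a∈q =
        ∈-concatMap⁺ _ (lose (∈-allFin i) (∈-map⁺ firstInterior
          (proj₂ (proj₂ (paths a i)) (y ∷ q₁) (cong suc (sym (toℕ-fromℕ< q₁<k)))
            (linked-prefix (x ∷ y ∷ q₁) (x~y ∷ subst (λ p → Linked _~_ (y ∷ p)) leg-eq linked))
            (good-prefix (x ∷ y ∷ q₁ ∷ʳ a) (subst (λ p → Good (x ∷ y ∷ p))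
              (trans leg-eq (sym (++-assoc q₁ (a ∷ []) (q₂ ∷ʳ lookupⱽ zs j)))) good)))))
        where
        linked = proj₁ (proj₂ (isLegs j))
        good = proj₁ (proj₂ (proj₂ (isLegs j)))
        leg-eq : qs j ∷ʳ lookupⱽ zs j ≡ q₁ ++ a ∷ (q₂ ∷ʳ lookupⱽ zs j)
        leg-eq = trans (cong (_∷ʳ lookupⱽ zs j) eq) (++-assoc q₁ (a ∷ q₂) (lookupⱽ zs j ∷ []))
        q₁<k : length q₁ < k
        q₁<k = ≤-trans (≤-trans (s≤s (m≤m+n _ (length q₂))) (≤-reflexive (sym (+-suc (length q₁) (length q₂)))))
                       (≤-reflexive (trans (sym (length-++ q₁)) (trans (sym (cong length eq)) (proj₁ (isLegs j)))))
        i = fromℕ< q₁<k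

    many-centres-fans : ∀ U → U + U * (k * f k) < ∑ (neighbours x) (λ y → χ (legs? x y (x ∷ []) zs)) →
      ∀ Used → length Used ≤ U → ∃[ y ] Fan G s k x y (lookupⱽ zs) Used
    many-centres-fans U many Used small
      with y , y∈ , y∉ ← fresh Fin._≟_ {xs = filter (λ y → legs? x y (x ∷ []) zs) (neighbours x)}
             (Unique.filter⁺ _ (unique-neighbours x)) (spoiled Used)
             (≤-trans (s≤s (length-spoiled Used small))
               (≤-trans many (≤-reflexive (sym (length-filter-∑ (λ y → legs? x y (x ∷ []) zs) (neighbours x))))))
      with y∈N , legs ← ∈-filter⁻ (λ y → legs? x y (x ∷ []) zs) {xs = neighbours x} y∈
      = y , legs-fan Used (neighbours-∈ y∈N) y∉ legs

  -- A double count of triples (x, y, zs) with legs from y to all entries of zs. The last size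
  -- hypothesis makes the average number of centres per pair (x, zs) exceed the bound of
  -- `length-spoiled`.
  find-fans : ∀ {D} s U → (∀ x → D ≤ length (neighbours x)) → 1 ≤ D →
    4 * ∑ all (badWalks (suc (suc k))) ≤ n * D ^ suc (suc k) →
    4 * ((1 + s * suc k) * (suc k * Δ ^ k)) ≤ D ^ suc k →
    2 * (4 * f k) ^ s * (U + U * (k * f k)) * n ^ s < D * (D ^ suc k) ^ s → 1 ≤ n →
    ∃[ u₀ ] Σ[ ws ∈ (Fin s → V) ] ∀ Used → length Used ≤ U → ∃[ v₀ ] Fan G s k u₀ v₀ ws Used
  find-fans {D} s U min-degree 1≤D few-bad L-small threshold 1≤n =
    x , lookupⱽ zs , many-centres-fans x zs U many
    where
    open ≤-Reasoning
    M = U + U * (k * f k)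
    F = (4 * f k) ^ s
    P = (D ^ suc k) ^ s

    fine? : ∀ x y → Dec (2 * badContinuations x y ≤ D ^ suc k)
    fine? x y = 2 * badContinuations x y ≤? D ^ suc k

    fine coarse : ℕ
    fine   = ∑ all (λ x → ∑ (neighbours x) (λ y → χ (fine? x y)))
    coarse = ∑ all (λ x → ∑ (neighbours x) (λ y → χ (¬? (fine? x y))))

    -- Markov's inequality: a coarse edge carries more than D^(k + 1) / 2 bad continuations, and all
    -- bad walks together number at most n D^(k + 2) / 4. So at least n D / 2 ordered edges are
    -- fine.
    coarse≤ : 2 * coarse ≤ n * D
    coarse≤ = *-cancelˡ (D ^ suc k) (^-positive 1≤D (suc k)) (begin
      D ^ suc k * (2 * coarse)
        ≡⟨ rotate (D ^ suc k) 2 coarse ⟩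
      2 * (D ^ suc k * coarse)
        ≡⟨ cong (2 *_) (sym (trans (∑-cong all (λ x → ∑-*ˡ (D ^ suc k) (neighbours x) _)) (∑-*ˡ (D ^ suc k) all _))) ⟩
      2 * ∑ all (λ x → ∑ (neighbours x) (λ y → D ^ suc k * χ (¬? (fine? x y))))
        ≤⟨ *-monoʳ-≤ 2 (∑-mono all (λ x → ∑-mono (neighbours x) (λ y → bad-edge x y))) ⟩
      2 * ∑ all (λ x → ∑ (neighbours x) (λ y → 2 * badContinuations x y))
        ≡⟨ cong (2 *_) (trans (∑-cong all (λ x → ∑-*ˡ 2 (neighbours x) _)) (∑-*ˡ 2 all _)) ⟩
      2 * (2 * ∑ all (λ x → ∑ (neighbours x) (badContinuations x)))
        ≡⟨ *-assoc 2 2 (∑ all (λ x → ∑ (neighbours x) (badContinuations x))) ⟨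
      4 * ∑ all (λ x → ∑ (neighbours x) (badContinuations x))
        ≡⟨ cong (4 *_) (∑-cong all (λ x → ∑-walks (suc k) x (λ q → χ (¬? (good? (x ∷ q)))))) ⟨
      4 * ∑ all (badWalks (suc (suc k)))
        ≤⟨ few-bad ⟩
      n * D ^ suc (suc k)
        ≡⟨ regroup n D (D ^ suc k) ⟩
      D ^ suc k * (n * D) ∎)
      where
      rotate : ∀ a b c → a * (b * c) ≡ b * (a * c)
      rotate = solve-∀
      regroup : ∀ a b c → a * (b * c) ≡ c * (a * b)
      regroup = solve-∀
      bad-edge : ∀ x y → D ^ suc k * χ (¬? (fine? x y)) ≤ 2 * badContinuations x y
      bad-edge x y = ≤-trans (≤-reflexive (*-comm (D ^ suc k) (χ (¬? (fine? x y)))))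
        (χ*-≤ (¬? (fine? x y)) (λ ≰ → <⇒≤ (≰⇒> ≰)))

    nD≤2fine : n * D ≤ 2 * fine
    nD≤2fine = +-cancelʳ-≤ (n * D) _ _ (begin
      n * D + n * D
        ≡⟨ cong (n * D +_) (+-identityʳ (n * D)) ⟨
      2 * (n * D)
        ≤⟨ *-monoʳ-≤ 2 (begin
          n * D                                   ≡⟨ cong (_* D) (length-tabulate {n = n} id) ⟨
          length all * D                          ≤⟨ ∑-≥ all D (λ {x} _ → min-degree x) ⟩
          ∑ all (λ x → length (neighbours x))
            ≡⟨ ∑-cong all (λ x → trans (sym (*-identityʳ _)) (sym (∑-const (neighbours x) 1))) ⟩
          ∑ all (λ x → ∑ (neighbours x) (λ _ → 1))
            ≡⟨ ∑-cong all (λ x → ∑-cong (neighbours x) (λ y → χ-¬ (fine? x y))) ⟨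
          ∑ all (λ x → ∑ (neighbours x) (λ y → χ (fine? x y) + χ (¬? (fine? x y))))
            ≡⟨ trans (∑-cong all (λ x → ∑-+ (neighbours x) _ _)) (∑-+ all _ _) ⟩
          fine + coarse                           ∎) ⟩
      2 * (fine + coarse)
        ≡⟨ *-distribˡ-+ 2 fine coarse ⟩
      2 * fine + 2 * coarse
        ≤⟨ +-monoʳ-≤ (2 * fine) coarse≤ ⟩
      2 * fine + n * D ∎)

    centres : V → Vec V s → ℕ
    centres x zs = ∑ (neighbours x) (λ y → χ (legs? x y (x ∷ []) zs))

    total : ℕ
    total = ∑ all (λ x → ∑ (tuples s) (centres x))

    fine≤ : fine * P ≤ F * total
    fine≤ = begin
      fine * P
        ≡⟨ sym (trans (∑-cong all (λ x → ∑-*ʳ P (neighbours x) _)) (∑-*ʳ P all _)) ⟩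
      ∑ all (λ x → ∑ (neighbours x) (λ y → χ (fine? x y) * P))
        ≤⟨ ∑-mono all (λ x → ∑-mono (neighbours x) (λ y → χ*-≤ (fine? x y) (λ fine-xy →
             many-legs x y min-degree fine-xy (1 + s * suc k) L-small s (x ∷ []) ≤-refl))) ⟩
      ∑ all (λ x → ∑ (neighbours x) (λ y → F * ∑ (tuples s) (λ zs → χ (legs? x y (x ∷ []) zs))))
        ≡⟨ trans (∑-cong all (λ x → ∑-*ˡ F (neighbours x) _)) (∑-*ˡ F all _) ⟩
      F * ∑ all (λ x → ∑ (neighbours x) (λ y → ∑ (tuples s) (λ zs → χ (legs? x y (x ∷ []) zs))))
        ≡⟨ cong (F *_) (∑-cong all (λ x → ∑-swap (neighbours x) (tuples s) _)) ⟩
      F * total ∎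

    large : length all * (length (tuples s) * M) < total
    large = ≰⇒> λ le → <⇒≱ threshold (*-cancelˡ n 1≤n (begin
      n * (D * P)                                       ≡⟨ *-assoc n D P ⟨
      n * D * P                                         ≤⟨ *-monoˡ-≤ P nD≤2fine ⟩
      2 * fine * P                                      ≡⟨ *-assoc 2 fine P ⟩
      2 * (fine * P)                                    ≤⟨ *-monoʳ-≤ 2 fine≤ ⟩
      2 * (F * total)                                   ≤⟨ *-monoʳ-≤ 2 (*-monoʳ-≤ F le) ⟩
      2 * (F * (length all * (length (tuples s) * M)))
        ≤⟨ *-monoʳ-≤ 2 (*-monoʳ-≤ F (*-mono-≤ (≤-reflexive (length-tabulate {n = n} id)) (*-monoˡ-≤ M (length-tuples s)))) ⟩
      2 * (F * (n * (n ^ s * M)))                       ≡⟨ regroup F n (n ^ s) M ⟩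
      n * (2 * F * M * n ^ s)                           ∎))
      where
      regroup : ∀ a b c d → 2 * (a * (b * (c * d))) ≡ b * (2 * a * d * c)
      regroup = solve-∀

    popular-x = pigeonhole-∑ all {λ x → ∑ (tuples s) (centres x)} (length (tuples s) * M) large
    x = proj₁ popular-x
    popular-zs = pigeonhole-∑ (tuples s) {centres x} M (proj₂ (proj₂ popular-x))
    zs = proj₁ popular-zs
    many : M < centres x zs
    many = proj₂ (proj₂ popular-zs)

-- Choice of the constants

module Constants (s t k K : ℕ) where

  -- In `e`, the 4 is the fraction required by `find-fans`, (2 + k)² comes from `badWalks-bound` for
  -- walks of 2 + k steps, and K^(2 + k) from passing from Δ to D. `U` is the size of t copies of
  -- L_{s,1}(k + 1). The final k in `b` allows for the steps of a leg inside the core.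
  e U b c₁ c : ℕ
  e  = 4 * ((2 + k) * (2 + k) * K ^ (2 + k))
  U  = t * length (elements {L₁Vertex s (suc k)})
  b  = 2 + s + U + s * k + k
  c₁ = 3 * e * K ^ k
  c  = 2 * K * c₁

  -- f i bounds the number of good paths with i interior vertices between two given vertices.  The
  -- threshold β (suc i) required by rich-fans grows with f i, and f (suc i) grows with β (suc i).
  f β : ℕ → ℕ
  f zero    = 1
  f (suc i) = f i + (3 * e * K * f i * (suc b * c ^ suc b * K ^ k) + suc b) * (suc i * (f i * f i))
  β zero    = 0
  β (suc i) = 3 * e * K * f i * (suc b * c ^ suc b * K ^ k) + suc b

  f-mono : ∀ {i j} → i ≤ j → f i ≤ f j
  f-mono {i} {j} i≤j = subst (λ m → f i ≤ f m) (m∸n+n≡m i≤j) (grow (j ∸ i))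
    where
    grow : ∀ r → f i ≤ f (r + i)
    grow zero    = ≤-refl
    grow (suc r) = ≤-trans (grow r) (m≤m+n _ _)

  -- The two summands of `minDegree` serve `few-barelyBad` and `many-ends`; the 1 keeps D positive.
  -- The 1 in `density` makes the averaging in `find-fans` strict.
  minDegree density : ℕ
  minDegree = 1 + (2 * c₁ * suc b + 4 * ((1 + s * suc k) * (suc k * K ^ k)))
  density   = 1 + 2 * (4 * f k) ^ s * (U + U * (k * f k))

  module _ (1≤K : 1 ≤ K) {n : ℕ} (G : Graph (Fin n)) {D : ℕ} (1≤n : 1 ≤ n)
    (degree≥ : ∀ x → D ≤ length (filter (Graph._~?_ G x) (allFin n)))
    (degree≤ : ∀ x → length (filter (Graph._~?_ G x) (allFin n)) ≤ K * D)
    (D-large : minDegree ≤ D) (dense : density * n ^ s ≤ D ^ (s * suc k + 1)) where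

    -- The two alternatives need no case distinction: freeness excludes fans, so the rich case
    -- cannot occur and bad walks are few, and then `find-fans` supplies the excluded fans.
    almost-regular-not-free : ¬ Free (L s t (suc k)) G
    almost-regular-not-free free = no-fans (proj₁ fans) (proj₁ (proj₂ fans)) (proj₂ (proj₂ fans))
      where
      open ≤-Reasoning
      1≤D : 1 ≤ D
      1≤D = ≤-trans (s≤s z≤n) D-large
      open Walks G (K * D) degree≤
      open BadWalks (suc k) β
      no-fans : ∀ u₀ (ws : Fin s → Fin n) →
                ¬ (∀ Used → length Used ≤ U → ∃[ v₀ ] Fan G s k u₀ v₀ ws Used)
      no-fans u₀ ws spread = free (fans-copy G u₀ ws t spread)
      M = (2 + k) * (2 + k) * K ^ (2 + k)
      1≤M : 1 ≤ M
      1≤M = *-positive {(2 + k) * (2 + k)} (s≤s z≤n) (^-positive 1≤K (2 + k))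
      few : ∀ i y → e * barelyBad i y ≤ D ^ suc i
      few = FewBarelyBad.few-barelyBad G D K 1≤D 1≤K degree≤ k s U b e (*-positive {4} (s≤s z≤n) 1≤M) β f
        no-fans (≤-trans (≤-trans (m≤m+n _ _) (n≤1+n _)) D-large) ≤-refl (λ _ → ≤-refl) ≤-refl f-mono
        (λ i → m≤n+m _ (f i))
      few-bad : 4 * ∑ all (badWalks (2 + k)) ≤ n * D ^ (2 + k)
      few-bad = *-cancelˡ M 1≤M (begin
        M * (4 * ∑ all (badWalks (2 + k)))                   ≡⟨ rotate M 4 _ ⟩
        e * ∑ all (badWalks (2 + k))
          ≤⟨ badWalks-bound {D} {e} (≤-*ˡ D 1≤K) few (2 + k) ⟩
        (2 + k) * (2 + k) * (n * (K * D) ^ (2 + k))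
          ≡⟨ cong (λ p → (2 + k) * (2 + k) * (n * p)) (^-distribʳ-* K D (2 + k)) ⟩
        (2 + k) * (2 + k) * (n * (K ^ (2 + k) * D ^ (2 + k)))
          ≡⟨ regroup ((2 + k) * (2 + k)) n (K ^ (2 + k)) (D ^ (2 + k)) ⟩
        M * (n * D ^ (2 + k))                                ∎)
        where
        rotate : ∀ a b c → a * (b * c) ≡ b * a * c
        rotate = solve-∀
        regroup : ∀ a b c d → a * (b * (c * d)) ≡ a * c * (b * d)
        regroup = solve-∀
      L-small : 4 * ((1 + s * suc k) * (suc k * (K * D) ^ k)) ≤ D ^ suc k
      L-small = begin
        4 * ((1 + s * suc k) * (suc k * (K * D) ^ k))
          ≡⟨ cong (λ p → 4 * ((1 + s * suc k) * (suc k * p))) (^-distribʳ-* K D k) ⟩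
        4 * ((1 + s * suc k) * (suc k * (K ^ k * D ^ k)))
          ≡⟨ regroup (1 + s * suc k) (suc k) (K ^ k) (D ^ k) ⟩
        4 * ((1 + s * suc k) * (suc k * K ^ k)) * D ^ k
          ≤⟨ *-monoˡ-≤ (D ^ k) (≤-trans (≤-trans (m≤n+m _ (2 * c₁ * suc b)) (n≤1+n _)) D-large) ⟩
        D * D ^ k ∎
        where
        regroup : ∀ a b c d → 4 * (a * (b * (c * d))) ≡ 4 * (a * (b * c)) * d
        regroup = solve-∀
      threshold : 2 * (4 * f k) ^ s * (U + U * (k * f k)) * n ^ s < D * (D ^ suc k) ^ s
      threshold = begin-strict
        2 * (4 * f k) ^ s * (U + U * (k * f k)) * n ^ s   <⟨ +-monoˡ-≤ _ (^-positive 1≤n s) ⟩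
        density * n ^ s                                   ≤⟨ dense ⟩
        D ^ (s * suc k + 1)                               ≡⟨ cong (D ^_) (+-comm (s * suc k) 1) ⟩
        D * D ^ (s * suc k)                               ≡⟨ cong (λ m → D * D ^ m) (*-comm s (suc k)) ⟩
        D * D ^ (suc k * s)                               ≡⟨ cong (D *_) (^-*-assoc D (suc k) s) ⟨
        D * (D ^ suc k) ^ s                               ∎
      fans : ∃[ u₀ ] Σ[ ws ∈ (Fin s → Fin n) ] ∀ Used → length Used ≤ U → ∃[ v₀ ] Fan G s k u₀ v₀ ws Used
      fans = Spread.find-fans G (K * D) degree≤ k β f ≤-refl f-mono (λ i → m≤n+m _ (f i))
        s U degree≥ 1≤D few-bad L-small threshold 1≤n

-- Induced subgraphs and the bound on the extremal number

module _ {n : ℕ} (G : Graph (Fin n)) (xs : List (Fin n)) where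
  open Graph G
  open EdgeDensity G

  induced : Graph (Fin (length xs))
  induced = record
    { _~_ = λ i j → lookup xs i ~ lookup xs j ; ~-sym = ~-sym ; irrefl = irrefl
    ; _~?_ = λ i j → lookup xs i ~? lookup xs j }

  induced-degree : ∀ i → length (filter (Graph._~?_ induced i) (allFin (length xs))) ≡ degree xs (lookup xs i)
  induced-degree i = begin
    length (filter (Graph._~?_ induced i) (allFin (length xs)))
      ≡⟨ length-filter-∑ (Graph._~?_ induced i) (allFin (length xs)) ⟩
    ∑ (allFin (length xs)) (λ j → adj (lookup xs i) (lookup xs j))
      ≡⟨ ∑-map (lookup xs) (allFin (length xs)) (adj (lookup xs i)) ⟨
    ∑ (map (lookup xs) (allFin (length xs))) (adj (lookup xs i))
      ≡⟨ cong (λ zs → ∑ zs (adj (lookup xs i))) (trans (map-tabulate id (lookup xs)) (tabulate-lookup xs)) ⟩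
    degree xs (lookup xs i) ∎
    where open ≡-Reasoning

  induced-copy : ∀ {V : Set} {H : Graph V} → Unique xs → Copy H induced → Copy H G
  induced-copy unique C = record
    { embed     = lookup xs ∘ Copy.embed C
    ; injective = λ eq → Copy.injective C (lookup-unique unique _ _ eq)
    ; preserves = Copy.preserves C
    }

module _ {n : ℕ} (G : Graph (Fin n)) where
  open Graph G
  open EdgeDensity G

  edgeCount≤edges : edgeCount G ≤ edges (allFin n)
  edgeCount≤edges = begin
    edgeCount G
      ≡⟨ length-filter-∑ _ (cartesianProduct (allFin n) (allFin n)) ⟩
    ∑ (cartesianProduct (allFin n) (allFin n)) (λ (i , j) → χ ((i Fin.<? j) ×-dec (i ~? j)))
      ≤⟨ ∑-mono (cartesianProduct (allFin n) (allFin n))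
           (λ (i , j) → χ-mono ((i Fin.<? j) ×-dec (i ~? j)) (i ~? j) proj₂) ⟩
    ∑ (cartesianProduct (allFin n) (allFin n)) (λ (i , j) → adj i j)
      ≡⟨ ∑-product (allFin n) ⟩
    edges (allFin n) ∎
    where
    open ≤-Reasoning
    ∑-product : ∀ ys → ∑ (cartesianProduct ys (allFin n)) (λ (i , j) → adj i j) ≡ cross ys (allFin n)
    ∑-product []       = refl
    ∑-product (y ∷ ys) = trans (∑-++ (map (y ,_) (allFin n)) _ _)
      (cong₂ _+_ (∑-map (y ,_) (allFin n) _) (∑-product ys))

-- The maximum is either attained by a free graph or equal to the default 0, whose q-th power
-- vanishes as q ≥ 1.
ex-≤ : ∀ {V : Set} ⦃ _ : Finite V ⦄ n (H : Graph V) q {m} → 1 ≤ q →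
       (∀ G → Free H G → edgeCount {n} G ^ q ≤ m) → ex n H ^ q ≤ m
ex-≤ n H q@(suc _) _ bound
  with argmax-sel id 0 (map edgeCount (filter (λ G → ¬? (copy? H G)) (allGraphs n)))
... | inj₁ ex≡0 = ≤-trans (≤-reflexive (cong (_^ q) ex≡0)) z≤n
... | inj₂ ex∈ with G , G∈ , eq ← ∈-map⁻ edgeCount ex∈ =
  ≤-trans (≤-reflexive (cong (_^ q) eq))
          (bound G (proj₂ (∈-filter⁻ (λ G → ¬? (copy? H G)) {xs = allGraphs n} G∈)))

theorem1p12 : ∀ (s t k : ℕ) → 1 ≤ s → 1 ≤ t → 1 ≤ k →
    (λ n → ex n (L s t k)) =O[n^ ((s * k + 1) + s) / (s * k + 1) ]
theorem1p12 s t (suc k) 1≤s _ _ = 8 * C , 1 , λ n 1≤n →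
  ex-≤ n (L s t (suc k)) q 1≤q (λ G free → ≮⇒≥ (λ lt → not-free G free 1≤n lt))
  where
  q = s * suc k + 1
  1≤q : 1 ≤ q
  1≤q = m≤n+m 1 (s * suc k)
  open Regularisation q s 1≤q 1≤s
  -- The degree ratio of `RegularCore`; it does not involve `C`, so the constants below can be
  -- formed before `C`.
  K = 8 * κ
  1≤κ : 1 ≤ κ
  1≤κ = *-positive {2} (s≤s z≤n) (^-positive {10} (s≤s z≤n) q)
  open Constants s t k K
  -- Large enough for the minimum degree, the density and the regularisation at once. The theorem
  -- uses 8 C because `many-edges` bounds 8 d instead of d.
  C = minDegree + density + κ
  κ≤C : κ ≤ C
  κ≤C = m≤n+m κ (minDegree + density)
  C≤8C : C ≤ 8 * C
  C≤8C = ≤-*ˡ {8} C (s≤s z≤n)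
  not-free : ∀ {n} (G : Graph (Fin n)) → Free (L s t (suc k)) G → 1 ≤ n →
             ¬ (8 * C) ^ q * n ^ (q + s) < edgeCount G ^ q
  not-free {n} G free 1≤n lt =
    almost-regular-not-free (*-positive {8} (s≤s z≤n) 1≤κ) (induced G core) nonempty
      (λ i → ≤-trans (min-degree (∈-lookup i)) (≤-reflexive (sym (induced-degree G core i))))
      (λ i → ≤-trans (≤-reflexive (induced-degree G core i)) (max-degree (∈-lookup i)))
      (≤-trans (≤-trans (m≤m+n minDegree density) (m≤m+n _ κ)) C≤d)
      (≤-trans (*-monoˡ-≤ (length core ^ s) density≤) dense)
      (free ∘ induced-copy G core unique)
    where
    open ≤-Reasoning
    1≤C : 1 ≤ C
    1≤C = ≤-trans 1≤κ κ≤C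
    length-all : length (allFin n) ≡ n
    length-all = length-tabulate {n = n} id
    open RegularCore (regular-core G (8 * C) (≤-trans (s≤s (s≤s (s≤s (s≤s z≤n)))) (≤-*ʳ 8 1≤C)) (≤-trans κ≤C C≤8C)
      (length (allFin n)) (allFin n) ≤-refl (Unique.allFin⁺ n) (≤-trans 1≤n (≤-reflexive (sym length-all)))
      (begin
        (8 * C) ^ q * length (allFin n) ^ (q + s)   ≡⟨ cong (λ m → (8 * C) ^ q * m ^ (q + s)) length-all ⟩
        (8 * C) ^ q * n ^ (q + s)                   ≤⟨ <⇒≤ lt ⟩
        edgeCount G ^ q                             ≤⟨ ^-monoˡ-≤ q (edgeCount≤edges G) ⟩
        EdgeDensity.edges G (allFin n) ^ q          ∎))
    dense : C ^ q * length core ^ s ≤ d ^ q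
    dense = *-cancelˡ (8 ^ q) (^-positive {8} (s≤s z≤n) q) (begin
      8 ^ q * (C ^ q * length core ^ s)   ≡⟨ *-assoc (8 ^ q) _ _ ⟨
      8 ^ q * C ^ q * length core ^ s     ≡⟨ cong (_* length core ^ s) (^-distribʳ-* 8 C q) ⟨
      (8 * C) ^ q * length core ^ s       ≤⟨ many-edges ⟩
      (8 * d) ^ q                         ≡⟨ ^-distribʳ-* 8 d q ⟩
      8 ^ q * d ^ q                       ∎)
    -- A nonempty core already forces d ≥ C, so the minimum degree is large for every n ≥ 1 and no
    -- larger threshold on n is required.
    C≤d : C ≤ d
    C≤d = ^-cancelʳ-≤ q 1≤q (≤-trans (≤-*ʳ (C ^ q) (^-positive nonempty s)) dense)
    density≤ : density ≤ C ^ q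
    density≤ = begin
      density           ≤⟨ ≤-trans (m≤n+m density minDegree) (m≤m+n _ κ) ⟩
      C                 ≡⟨ *-identityʳ C ⟨
      C * 1             ≤⟨ *-monoʳ-≤ C (^-positive 1≤C (s * suc k)) ⟩
      C ^ suc (s * suc k)   ≡⟨ cong (C ^_) (+-comm 1 (s * suc k)) ⟩
      C ^ q             ∎
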